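{- Let $\Delta$ denote either the symmetric algebraic shifting operator $\Delta^s$ or the exterior algebraic shifting operator $\Delta^e$. The following holds for both choices of $\Delta$: for every integer $r$ with $2\leq r\leq 6$ and every graph $G$, if $\{r-1,r\}\in\Delta(G)$ then $G$ has a $K_r$ minor.
   Context: All graphs are finite and simple (no loops, no multiple edges). $K_r$ is the complete graph on $r$ vertices. Contracting an edge $\{v,u\}$ means identifying $v$ and $u$, deleting the resulting loop and one copy of each double edge created, to obtain a new simple graph. A graph $H$ is a minor of $G$ if $H$ can be obtained, up to isomorphism, from a subgraph of $G$ by repeated contraction of edges; $G$ has an $H$ minor if $H$ is a minor of $G$. Algebraic shifting. Let $K$ be a simplicial complex on vertex set $[n]=\{1,\dots,n\}$; a graph $G$ with $n$ vertices is regarded as a simplicial complex of dimension at most $1$ (faces: the empty set, the vertices, the edges) after numbering its vertices by $[n]$. Let $k$ be a field of characteristic zero, large enough for the generic choices below (e.g. $k=\mathbb{R}$). For distinct sets $S,T\subseteq[n]$ of equal size write $S<_L T$ iff $\min(S\triangle T)\in S$. Exterior shifting $\Delta^e$: let $V$ be a $k$-vector space with basis $e_1,\dots,e_n$, and for $S=\{s_1<\dots<s_j\}$ put $e_S=e_{s_1}\wedge\dots\wedge e_{s_j}$. Let $\bigwedge(K)=\bigwedge V/(e_S: S\notin K)$. Let $f_1,\dots,f_n$ be a basis of $V$ that is generic with respect to $e_1,\dots,e_n$, i.e. the entries of the transition matrix are algebraically independent over $\mathbb{Q}$. Define $f_S$ analogously to $e_S$ and let $\tilde f_S$ be its image in $\bigwedge(K)$.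 Then $$\Delta^e(K)=\{S\subseteq[n]: \tilde f_S\notin \mathrm{span}\{\tilde f_{S'}: |S'|=|S|,\ S'<_L S\}\}.$$ Symmetric shifting $\Delta^s$: let $k[K]=k[x_1,\dots,x_n]/I_K$ be the face ring, where $I_K$ is generated by the monomials whose support is not in $K$. Let $y_1,\dots,y_n$ be generic linear combinations of $x_1,\dots,x_n$ (coefficients algebraically independent over $\mathbb{Q}$). For monomials in the $y_i$ of the same degree write $\prod y_i^{a_i}<_L\prod y_i^{b_i}$ iff $a_j>b_j$ for $j=\min\{i:a_i\ne b_i\}$. Let $\tilde m$ denote the image of $m$ in $k[K]$, and let $GIN(K)$ be the set of monomials $m$ in the $y_i$ of degree at most $\dim K+1$ such that $\tilde m\notin\mathrm{span}\{\tilde m': \deg m'=\deg m,\ m'<_L m\}$. Let $gin(K)$ be the set of those $m=y_{i_1}y_{i_2}\cdots y_{i_r}\in GIN(K)$ with $r\le i_1\le i_2\le\dots\le i_r$ and $r\le\dim K+1$, and for such $m$ put $S(m)=\{i_1-r+1,i_2-r+2,\dots,i_r\}$. Then $\Delta^s(K)=\{S(m): m\in gin(K)\}$. Both $\Delta^e(K)$ and $\Delta^s(K)$ are independent of the numbering of the vertices and of the generic choices. -}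

module Defs where

open import Level using (_⊔_; 0ℓ)
open import Algebra.Apartness.Bundles using (HeytingField; module HeytingCommutativeRing)
open import Algebra.Bundles using (CommutativeRing; Semiring)
open import Algebra.Core using (Op₂)
import Algebra.Definitions.RawSemiring as RawSemiringDefs
open import Data.Bool.Base using (if_then_else_)
open import Data.Fin.Base using (Fin; toℕ; remQuot) renaming (_<_ to _<ᶠ_; _≤_ to _≤ᶠ_)
import Data.Fin.Properties as Fin
open import Data.Fin.Subset
  using (Subset; Side; inside; outside; _∈_; _∉_; _⊆_; _∪_; ⁅_⁆; ∣_∣) renaming (⊥ to ∅)
open import Data.Fin.Subset.Properties
  using (_∈?_; ⊆-antisym; ⊥⊆; x∈⁅y⁆⇒x≡y; x∈p∪q⁻)
open import Data.Integer.Base using (ℤ; +_; -[1+_])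
open import Data.List.Base
  using (List; []; _∷_; [_]; _++_; map; concatMap; foldr; filter; tabulate; allFin)
open import Data.List.Properties using () renaming (≡-dec to List-≡-dec)
open import Data.Nat.Base using (ℕ; zero; suc; _≤_; _>_; _∸_)
  renaming (_+_ to _+ℕ_; _*_ to _*ℕ_)
import Data.Nat.Properties as ℕ
open import Data.Product.Base using (Σ; ∃; ∃₂; _×_; _,_; proj₁; proj₂; uncurry)
open import Data.Rational.Base using (ℚ; mkℚ)
import Data.Rational.Properties as ℚ
open import Data.Sum.Base using (_⊎_; inj₁; inj₂; [_,_]′)
open import Data.Vec.Base as Vec using (Vec; lookup; zipWith; replicate; _[_]≔_)
open import Data.Vec.Properties using () renaming (≡-dec to Vec-≡-dec)
open import Function.Base using (_∘_)
open import Function.Bundles using (_⇔_; _↔_; Inverse)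
open import Function.Definitions using (Injective; Surjective)
open import Relation.Binary.Construct.Closure.ReflexiveTransitive using (Star)
open import Relation.Binary.Core using (Rel)
open import Relation.Binary.Definitions using (Decidable; DecidableEquality; Symmetric; Irreflexive)
open import Relation.Binary.PropositionalEquality.Core using (_≡_; _≢_; sym; subst)
open import Relation.Nullary.Decidable using (yes; no; does; ¬?)
open import Relation.Nullary.Negation using (¬_; contradiction)
open import Relation.Unary using (Pred)

record Graph (n : ℕ) : Set₁ where
  field
    _~_      : Rel (Fin n) 0ℓ
    _~?_     : Decidable _~_
    ~-sym    : Symmetric _~_
    ~-irrefl : Irreflexive _≡_ _~_

Adjacent : ∀ {n} → Graph n → Rel (Fin n) 0ℓ
Adjacent = Graph._~_

complete : (r : ℕ) → Graph r
complete r = record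
  { _~_ = _≢_
  ; _~?_ = λ x y → ¬? (x Fin.≟ y)
  ; ~-sym = λ x≢y y≡x → x≢y (sym y≡x)
  ; ~-irrefl = λ x≡y x≢y → x≢y x≡y
  }

-- H is a subgraph of G, after renumbering its vertices.
record Subgraph {m n} (H : Graph m) (G : Graph n) : Set where
  field
    embed     : Fin m → Fin n
    injective : Injective _≡_ _≡_ embed
    preserves : ∀ {x y} → Adjacent H x y → Adjacent G (embed x) (embed y)

-- H is obtained from G by contracting the edge {u , v}; π is the
-- identification map on vertices.
record Contraction {m n} (G : Graph m) (H : Graph n) : Set where
  field
    u v        : Fin m
    edge       : Adjacent G u v
    π          : Fin m → Fin n
    surjective : Surjective _≡_ _≡_ π
    identifies : ∀ x y → π x ≡ π y ⇔ (x ≡ y ⊎ (x ≡ u × y ≡ v) ⊎ (x ≡ v × y ≡ u))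
    adjacency  : ∀ a b → Adjacent H a b ⇔
                   (a ≢ b × ∃₂ λ x y → π x ≡ a × π y ≡ b × Adjacent G x y)

record Isomorphism {m n} (G : Graph m) (H : Graph n) : Set where
  field
    vertices  : Fin m ↔ Fin n
    adjacency : ∀ x y → Adjacent G x y ⇔ Adjacent H (Inverse.to vertices x) (Inverse.to vertices y)

_⟶_ : Rel (∃ Graph) 0ℓ
(_ , G) ⟶ (_ , H) = Contraction G H

HasMinor : ∀ {m n} → Graph n → Graph m → Set₁
HasMinor G H =
  Σ (∃ Graph) λ S → Σ (∃ Graph) λ C →
    Subgraph (proj₂ S) G × Star _⟶_ S C × Isomorphism (proj₂ C) H

-- The vertex set [n] is Fin n; i : Fin n is the vertex label i.
label : ∀ {n} → Fin n → ℕ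
label i = suc (toℕ i)

record Complex (n : ℕ) : Set₁ where
  field
    Face     : Pred (Subset n) 0ℓ
    empty    : Face ∅
    vertex   : ∀ i → Face ⁅ i ⁆
    downward : ∀ {S T} → S ⊆ T → Face T → Face S

open Complex using (Face)

-- d ≤ dim K + 1, where dim K + 1 is the largest cardinality of a face.
_≤1+dim_ : ∀ {n} → ℕ → Complex n → Set
d ≤1+dim K = ∃ λ S → Face K S × d ≤ ∣ S ∣

data GraphFace {n} (G : Graph n) : Pred (Subset n) 0ℓ where
  empty  : GraphFace G ∅
  vertex : ∀ u → GraphFace G ⁅ u ⁆
  edge   : ∀ u v → Adjacent G u v → GraphFace G (⁅ u ⁆ ∪ ⁅ v ⁆)

private
  singleton⊆ : ∀ {n} {u : Fin n} {S : Subset n} → u ∈ S → ⁅ u ⁆ ⊆ S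
  singleton⊆ {u = u} {S} u∈S x∈ = subst (_∈ S) (sym (x∈⁅y⁆⇒x≡y u x∈)) u∈S

  pair⊆ : ∀ {n} {u v : Fin n} {S : Subset n} → u ∈ S → v ∈ S → ⁅ u ⁆ ∪ ⁅ v ⁆ ⊆ S
  pair⊆ {u = u} {v} u∈S v∈S x∈ =
    [ singleton⊆ u∈S , singleton⊆ v∈S ]′ (x∈p∪q⁻ ⁅ u ⁆ ⁅ v ⁆ x∈)

  graphFace-downward : ∀ {n} (G : Graph n) {S T : Subset n} →
                       S ⊆ T → GraphFace G T → GraphFace G S
  graphFace-downward G S⊆T empty = subst (GraphFace G) (⊆-antisym ⊥⊆ S⊆T) empty
  graphFace-downward G {S} S⊆T (vertex u) with u ∈? S
  ... | yes u∈S = subst (GraphFace G) (⊆-antisym (singleton⊆ u∈S) S⊆T) (vertex u)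
  ... | no  u∉S = subst (GraphFace G) (⊆-antisym ⊥⊆ S⊆∅) empty
    where
    S⊆∅ : S ⊆ ∅
    S⊆∅ x∈S = contradiction (subst (_∈ S) (x∈⁅y⁆⇒x≡y u (S⊆T x∈S)) x∈S) u∉S
  graphFace-downward G {S} S⊆T (edge u v u~v) with u ∈? S | v ∈? S
  ... | yes u∈S | yes v∈S =
    subst (GraphFace G) (⊆-antisym (pair⊆ u∈S v∈S) S⊆T) (edge u v u~v)
  ... | _       | no  v∉S = graphFace-downward G S⊆u (vertex u)
    where
    S⊆u : S ⊆ ⁅ u ⁆
    S⊆u x∈S with x∈p∪q⁻ ⁅ u ⁆ ⁅ v ⁆ (S⊆T x∈S)
    ... | inj₁ x∈u = x∈u
    ... | inj₂ x∈v = contradiction (subst (_∈ S) (x∈⁅y⁆⇒x≡y v x∈v) x∈S) v∉S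
  ... | no  u∉S | yes _   = graphFace-downward G S⊆v (vertex v)
    where
    S⊆v : S ⊆ ⁅ v ⁆
    S⊆v x∈S with x∈p∪q⁻ ⁅ u ⁆ ⁅ v ⁆ (S⊆T x∈S)
    ... | inj₁ x∈u = contradiction (subst (_∈ S) (x∈⁅y⁆⇒x≡y u x∈u) x∈S) u∉S
    ... | inj₂ x∈v = x∈v

graphComplex : ∀ {n} → Graph n → Complex n
graphComplex G = record
  { Face     = GraphFace G
  ; empty    = empty
  ; vertex   = vertex
  ; downward = graphFace-downward G
  }

-- S <ₛ T iff min (S △ T) ∈ S.
_<ₛ_ : ∀ {n} → Rel (Subset n) 0ℓ
S <ₛ T = ∃ λ i → i ∈ S × i ∉ T × (∀ j → j <ᶠ i → j ∈ S ⇔ j ∈ T)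

elements : ∀ {n} → Subset n → List (Fin n)
elements S = filter (_∈? S) (allFin _)

-- The algebra R[B] of a monoid (B , _·_ , ε). A list of terms denotes its sum,
-- so lists are compared through the resulting coefficients.
module MonoidAlgebra {c ℓ} (R : CommutativeRing c ℓ)
  {B : Set} (_≟_ : DecidableEquality B) (_·_ : Op₂ B) (ε : B) where

  open CommutativeRing R using (Carrier; _≈_; _+_; _*_; -_; 0#; 1#)

  Alg : Set c
  Alg = List (Carrier × B)

  coeff : Alg → B → Carrier
  coeff p b = foldr (λ (a , b′) s → if does (b′ ≟ b) then a + s else s) 0# p

  infix  4 _≋_
  infixl 6 _⊕_ _⊖_
  infixl 7 _⊛_
  infixr 8 _⊙_

  _≋_ : Rel Alg ℓ
  p ≋ q = ∀ b → coeff p b ≈ coeff q b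

  𝟘 𝟙 : Alg
  𝟘 = []
  𝟙 = [ (1# , ε) ]

  monomial : B → Alg
  monomial b = [ (1# , b) ]

  _⊕_ : Op₂ Alg
  _⊕_ = _++_

  _⊙_ : Carrier → Alg → Alg
  a ⊙ p = map (λ (a′ , b) → a * a′ , b) p

  _⊖_ : Op₂ Alg
  p ⊖ q = p ⊕ (- 1#) ⊙ q

  _⊛_ : Op₂ Alg
  p ⊛ q = concatMap (λ (a , b) → map (λ (a′ , b′) → a * a′ , b · b′) q) p

  prod : List Alg → Alg
  prod = foldr _⊛_ 𝟙

  pow : Alg → ℕ → Alg
  pow p zero    = 𝟙
  pow p (suc e) = p ⊛ pow p e

  -- Σⱼ v j · b j
  linear : ∀ {n} → (Fin n → B) → (Fin n → Carrier) → Alg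
  linear b v = tabulate (λ j → v j , b j)

  data Ideal {g} (Gen : Pred Alg g) : Pred Alg (c ⊔ ℓ ⊔ g) where
    generator : ∀ {p} → Gen p → Ideal Gen p
    zero      : Ideal Gen 𝟘
    add       : ∀ {p q} → Ideal Gen p → Ideal Gen q → Ideal Gen (p ⊕ q)
    mulˡ      : ∀ a {p} → Ideal Gen p → Ideal Gen (a ⊛ p)
    mulʳ      : ∀ a {p} → Ideal Gen p → Ideal Gen (p ⊛ a)
    resp      : ∀ {p q} → p ≋ q → Ideal Gen p → Ideal Gen q

  data Span {f} (F : Pred Alg f) : Pred Alg (c ⊔ f) where
    zero : Span F 𝟘
    step : ∀ a {p q} → F p → Span F q → Span F (a ⊙ p ⊕ q)

  -- The image of p in the quotient by I lies in the span of the image of F.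
  InSpanMod : ∀ {i f} → Pred Alg i → Pred Alg f → Pred Alg (c ⊔ i ⊔ f)
  InSpanMod I F p = ∃ λ q → Span F q × I (p ⊖ q)

Exponent : ℕ → Set
Exponent = Vec ℕ

_+ᵉ_ : ∀ {n} → Op₂ (Exponent n)
_+ᵉ_ = zipWith _+ℕ_

0ᵉ : ∀ {n} → Exponent n
0ᵉ = replicate _ 0

var : ∀ {n} → Fin n → Exponent n
var j = 0ᵉ [ j ]≔ 1

degree : ∀ {n} → Exponent n → ℕ
degree = Vec.sum

positive : ℕ → Side
positive zero    = outside
positive (suc _) = inside

support : ∀ {n} → Exponent n → Subset n
support = Vec.map positive

-- The monomial order: y^a <ₘ y^b iff a has the larger exponent at the
-- first index where a and b differ.
_<ₘ_ : ∀ {n} → Rel (Exponent n) 0ℓ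
a <ₘ b = ∃ λ j → lookup a j > lookup b j × (∀ i → i <ᶠ j → lookup a i ≡ lookup b i)

-- The exponent vector of y_{i 0} y_{i 1} ⋯ y_{i (r-1)}.
exponent : ∀ {r n} → (Fin r → Fin n) → Exponent n
exponent i = foldr _+ᵉ_ 0ᵉ (tabulate (var ∘ i))

module Polynomial {c ℓ} (R : CommutativeRing c ℓ) (n : ℕ) =
  MonoidAlgebra R {Exponent n} (Vec-≡-dec ℕ._≟_) _+ᵉ_ 0ᵉ

module TensorAlgebra {c ℓ} (R : CommutativeRing c ℓ) (n : ℕ) =
  MonoidAlgebra R {List (Fin n)} (List-≡-dec Fin._≟_) _++_ []

data Shifting : Set where
  exterior symmetric : Shifting

module _ {c ℓ₁ ℓ₂} (k : HeytingField c ℓ₁ ℓ₂) where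

  ring : CommutativeRing c ℓ₁
  ring = HeytingCommutativeRing.commutativeRing (HeytingField.heytingCommutativeRing k)

  open HeytingField k using (Carrier; _≈_; _#_; _+_; _*_; -_; 0#; 1#; #⇒invertible)
  open RawSemiringDefs (Semiring.rawSemiring (CommutativeRing.semiring ring))
    using (_^_) renaming (_×_ to _·ℕ_)

  fromℕ : ℕ → Carrier
  fromℕ m = m ·ℕ 1#

  -- Apartness from 0# is the constructive form of being nonzero.
  CharacteristicZero : Set ℓ₂
  CharacteristicZero = ∀ m → fromℕ (suc m) # 0#

  fromℤ : ℤ → Carrier
  fromℤ (+ m)    = fromℕ m
  fromℤ -[1+ m ] = - fromℕ (suc m)

  -- #⇒invertible gives an inverse of fromℕ (suc d) - 0#.
  fromℚ : CharacteristicZero → ℚ → Carrier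
  fromℚ char0 (mkℚ p d _) = fromℤ p * proj₁ (#⇒invertible (char0 d))

  module _ (char0 : CharacteristicZero) where

    evaluateMonomial : ∀ {m} → (Fin m → Carrier) → Exponent m → Carrier
    evaluateMonomial a e = foldr _*_ 1# (tabulate λ i → a i ^ lookup e i)

    evaluate : ∀ {m} → (Fin m → Carrier) → Polynomial.Alg ℚ.+-*-commutativeRing m → Carrier
    evaluate a = foldr (λ (q , e) s → fromℚ char0 q * evaluateMonomial a e + s) 0#

    AlgebraicallyIndependent : ∀ {m} → (Fin m → Carrier) → Set ℓ₁
    AlgebraicallyIndependent {m} a = ∀ p → evaluate a p ≈ 0# → p ≋ 𝟘
      where open Polynomial ℚ.+-*-commutativeRing m

    -- remQuot n enumerates the n² matrix positions. A generic matrix is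
    -- invertible, since its determinant is a nonzero polynomial in its entries.
    Generic : ∀ {n} → (Fin n → Fin n → Carrier) → Set ℓ₁
    Generic {n} A = AlgebraicallyIndependent {n *ℕ n} (λ i → uncurry A (remQuot n i))

  module ExteriorShifting {n} (A : Fin n → Fin n → Carrier) (K : Complex n) where

    open TensorAlgebra ring n

    -- V is the degree-one part, with basis e.
    vector : (Fin n → Carrier) → Alg
    vector = linear [_]

    e f : Fin n → Alg
    e i = monomial [ i ]
    f i = vector (A i)

    wedge : (Fin n → Alg) → Subset n → Alg
    wedge b S = prod (map b (elements S))

    -- ⋀(K) = ⋀V / (e_S : S ∉ K) is taken as a quotient of the tensor
    -- algebra T(V) in one step, using ⋀V = T(V) / (v ⊗ v : v ∈ V).
    data Relator : Pred Alg c where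
      square  : ∀ v → Relator (vector v ⊛ vector v)
      nonface : ∀ S → ¬ Face K S → Relator (wedge e S)

    shifted : Pred (Subset n) (c ⊔ ℓ₁)
    shifted S = ¬ InSpanMod (Ideal Relator)
      (λ p → ∃ λ S′ → ∣ S′ ∣ ≡ ∣ S ∣ × S′ <ₛ S × p ≡ wedge f S′) (wedge f S)

  module SymmetricShifting {n} (A : Fin n → Fin n → Carrier) (K : Complex n) where

    open Polynomial ring n

    data Relator : Pred Alg c where
      nonface : ∀ a → ¬ Face K (support a) → Relator (monomial a)

    y : Fin n → Alg
    y i = linear var (A i)

    y^_ : Exponent n → Alg
    y^ a = prod (tabulate λ i → pow (y i) (lookup a i))

    GIN : Pred (Exponent n) (c ⊔ ℓ₁)
    GIN a = degree a ≤1+dim K × ¬ InSpanMod (Ideal Relator)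
      (λ p → ∃ λ b → degree b ≡ degree a × b <ₘ a × p ≡ y^ b) (y^ a)

    -- i lists the indices of a monomial in gin(K) in weakly increasing order.
    gin : ∀ r → Pred (Fin r → Fin n) (c ⊔ ℓ₁)
    gin r i = (∀ t → r ≤ label (i t)) × (∀ s t → s ≤ᶠ t → i s ≤ᶠ i t)
            × r ≤1+dim K × GIN (exponent i)

    -- T is the set S(m) for some m ∈ gin(K).
    shifted : Pred (Subset n) (c ⊔ ℓ₁)
    shifted T = ∃₂ λ r (i : Fin r → Fin n) → gin r i ×
      (∀ x → x ∈ T ⇔ (∃ λ t → label x ≡ (label (i t) ∸ r) +ℕ label t))

  Δ : Shifting → ∀ {n} → (Fin n → Fin n → Carrier) → Complex n → Pred (Subset n) (c ⊔ ℓ₁)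
  Δ exterior  A K = ExteriorShifting.shifted A K
  Δ symmetric A K = SymmetricShifting.shifted A K

{-# OPTIONS --safe #-}
-- Put d = r − 2. If every edge of a graph with at least one edge lies in d triangles, the graph
-- has a K_r minor. Coning reduces this to r = 6. If the degrees are large, Mader's theorem applies:
-- 4n − 9 edges force a K₆ minor. Otherwise some vertex has degree at most 7 and a link of minimum
-- degree at least 4. The link has a K₅ minor unless it is the octahedron or the pentagonal
-- bipyramid, two triangulations of the sphere; then either a path outside the link joins two of
-- its nonadjacent vertices, which again gives a K₅ minor, or a clique of size at most 3 separates
-- a smaller graph of the same kind.
--
-- So a graph without K_r minor shrinks to an edgeless one by contracting edges u v with fewer than
-- d common neighbours. That {r − 1 , r} is not in the shifting means that the products f_i ∧ w with
-- i ≤ d, respectively y_i w with i ≤ d + 1, span the degree-two part of the quotient, which is the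
-- solvability of a linear system with one equation for each edge (and, in the symmetric case, for
-- each vertex). Moving the point of v to that of u turns a solution for the contracted graph into
-- one for the graph itself, and solvability at a special point implies it at a generic point. The
-- claim about the shifting is a negation, so field elements may be compared classically.
module Submission where

open import Defs
open import Algebra.Apartness.Bundles using (HeytingField)
open import Data.Fin.Base using (Fin; toℕ; inject≤)
import Data.Fin.Properties as Fin
open import Data.Fin.Subset using (⁅_⁆; _∪_)
open import Data.Nat.Base using (ℕ; suc; _≤_; _<_; _∸_; s≤s)
import Data.Nat.Properties as ℕ
open import Data.Sum.Base using (_⊎_; inj₁; inj₂)
open import Relation.Binary.PropositionalEquality.Core using (_≡_; subst)
open import Relation.Nullary.Negation using (¬_; contradiction)

-- Mader's bound and the claim about pieces support each other, in one induction on the number of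
-- live vertices. A piece cut off along a clique Q keeps its triangles only on edges not inside Q,
-- so the triangle condition alone does not descend. If all nonisolated vertices outside Q have
-- degree at least 8, then, with q vertices in Q of degree at least q - 1, the degree sum is at
-- least 8n - q(9 - q), and q(9 - q) ≤ 18 for q ≤ 3 is just what 4n - 9 edges permit. Conversely a
-- low-degree vertex in the proof of Mader's bound is handled as a piece with Q empty.
--
-- On the algebraic side an edge with c < d common neighbours puts c + 1 ≤ d linear conditions on
-- the difference of the unknown vectors at u and v, and these conditions are independent at a
-- generic point. In the rigidity matrix, however, the row of u v vanishes when the two points
-- coincide. There v is placed at u plus ε times a direction, the row is divided by ε, and only then
-- is ε set to 0.

module Combinatorics where

  open import Data.Bool.Base using (Bool; true; false; T; _∧_; _∨_; not; if_then_else_)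
  open import Data.Bool.Properties using (T?; T-≡; T-∧; T-∨)
  import Data.Bool.Properties as Bool
  open import Data.Empty using (⊥)
  open import Data.Fin.Base using (Fin; zero; suc; punchIn; punchOut) renaming (_<_ to _<ᶠ_)
  open import Data.Fin.Patterns
  import Data.Fin.Properties as Fin
  open import Data.List.Base using (List; []; _∷_)
  open import Data.List.Membership.Propositional using (_∈_; find)
  open import Data.List.Relation.Unary.All as All using (All; []; _∷_)
  open import Data.List.Relation.Unary.Any as Any using (Any; here; there)
  open import Data.Maybe.Base as Maybe using (Maybe; just; nothing)
  import Data.Maybe.Properties as Maybe
  open import Data.Nat.Base using (ℕ; zero; suc; _≤_; _<_; _≤ᵇ_; _+_; _*_; _∸_; z≤n; s≤s)
  open import Data.Nat.Induction using (<-rec)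
  import Data.Nat.Properties as ℕ
  open import Data.Nat.Solver using (module +-*-Solver)
  open import Data.Product.Base using (Σ; ∃; ∃₂; _×_; _,_; proj₁; proj₂)
  open import Data.Sum.Base using (_⊎_; inj₁; inj₂)
  open import Data.Unit.Base using (⊤; tt)
  open import Data.Vec.Base as Vec using (Vec; []; _∷_; lookup; _[_]≔_; updateAt)
  import Data.Vec.Properties as Vec
  open import Function.Base using (_∘_; id)
  open import Function.Bundles using (mk⇔; Equivalence; mk↔ₛ′)
  open import Level using (0ℓ)
  open import Relation.Binary.Construct.Closure.ReflexiveTransitive using (Star; ε; _◅_; _◅◅_)
  open import Relation.Binary.Definitions using (tri<; tri≈; tri>)
  open import Relation.Binary.PropositionalEquality
    using (_≡_; _≢_; refl; sym; trans; cong; cong₂; subst)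
  open import Relation.Nullary.Decidable
    using (Dec; yes; no; does; _×-dec_; _⊎-dec_; _→-dec_; ¬?; ⌊_⌋; toWitness; fromWitness; decidable-stable)
  open import Relation.Nullary.Negation using (¬_; contradiction)
  open import Relation.Unary using (Pred; Decidable)
  open import Algebra.Properties.CommutativeMonoid.Sum ℕ.+-0-commutativeMonoid
    using (sum; sum-cong-≗; ∑-distrib-+)

  open ℕ.≤-Reasoning
  open +-*-Solver using (solve; con; _:=_; _:+_; _:*_)

  private variable
    m n r : ℕ
    P Q : Pred (Fin n) 0ℓ

  -- Branch sets and minors

  -- Nonempty branch sets are not demanded: for 2 ≤ r each set has a partner, and `joined` then
  -- exhibits a vertex in it. A step of a path records membership of its end only, since the start
  -- of the path already lies in the set.
  record Model (r : ℕ) (G : Graph n) : Set where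
    open Graph G
    field
      branch    : Fin n → Maybe (Fin r)
      connected : ∀ {i x y} → branch x ≡ just i → branch y ≡ just i →
                  Star (λ a b → a ~ b × branch b ≡ just i) x y
      joined    : ∀ {i j} → i ≢ j →
                  ∃₂ λ x y → branch x ≡ just i × branch y ≡ just j × x ~ y

  pullback : (Fin m → Fin n) → Graph n → Graph m
  pullback f G = record
    { _~_      = λ x y → f x ~ f y
    ; _~?_     = λ x y → f x ~? f y
    ; ~-sym    = ~-sym
    ; ~-irrefl = λ x≡y → ~-irrefl (cong f x≡y)
    } where open Graph G

  -- Serves both to delete a vertex that no branch set uses and to renumber vertices: the paths of a
  -- model never leave its branch sets, so only those have to lie in the image of `f`.
  pullback-model : (f : Fin m → Fin n) → (∀ {x y} → f x ≡ f y → x ≡ y) →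
                   {G : Graph n} (M : Model r G) →
                   (∀ y {i} → Model.branch M y ≡ just i → ∃ λ x → f x ≡ y) →
                   Model r (pullback f G)
  pullback-model f f-inj {G} M cover = record
    { branch    = branch ∘ f
    ; connected = λ bx by → lift refl (connected bx by)
    ; joined    = λ i≢j → joined′ (joined i≢j)
    }
    where
    open Model M
    open Graph G
    lift : ∀ {i x y a} → f x ≡ a → Star (λ a b → a ~ b × branch b ≡ just i) a (f y) →
           Star (λ a b → f a ~ f b × branch (f b) ≡ just i) x y
    lift eq ε with refl ← f-inj eq = ε
    lift refl ((a~c , bc) ◅ s) with cover _ bc
    ... | z , refl = (a~c , bc) ◅ lift refl s
    joined′ : ∀ {i j} → (∃₂ λ x y → branch x ≡ just i × branch y ≡ just j × x ~ y) →
              ∃₂ λ x y → branch (f x) ≡ just i × branch (f y) ≡ just j × f x ~ f y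
    joined′ (x , y , bx , by , x~y) with cover x bx | cover y by
    ... | x′ , refl | y′ , refl = x′ , y′ , bx , by , x~y

  -- Branch sets are pulled back along ρ. They stay connected because an edge of H lifts to an edge
  -- of G between the right fibres, and the fibres are connected. Contracting an edge and
  -- contracting a whole component are both instances.
  quotient-model : {G H : Graph n} (ρ : Fin n → Fin n) →
    (∀ {x y} → Adjacent H x y → ∃₂ λ x′ y′ → ρ x′ ≡ x × ρ y′ ≡ y × Adjacent G x′ y′) →
    (∀ {x y} → ρ x ≡ ρ y → Star (λ a b → Adjacent G a b × ρ a ≡ ρ b) x y) →
    Model r H → Model r G
  quotient-model {G = G} {H} ρ lifts fibre M = record
    { branch    = branch ∘ ρ
    ; connected = λ {i} {x} {y} bx by → go bx refl (connected bx by)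
    ; joined    = λ i≢j → joined′ (joined i≢j)
    }
    where
    open Model M
    open Graph G
    R : _ → _ → _ → Set
    R i a b = a ~ b × branch (ρ b) ≡ just i
    within : ∀ {i x y} → branch (ρ x) ≡ just i → Star (λ a b → a ~ b × ρ a ≡ ρ b) x y →
             Star (R i) x y
    within bx ε = ε
    within bx ((a~b , eq) ◅ s) = (a~b , bb) ◅ within bb s
      where bb = trans (cong branch (sym eq)) bx
    go : ∀ {i x y a} → branch (ρ x) ≡ just i → ρ x ≡ a →
         Star (λ a b → Adjacent H a b × branch b ≡ just i) a (ρ y) → Star (R i) x y
    go bx eq ε = within bx (fibre eq)
    go bx refl ((a~c , bc) ◅ s) with lifts a~c
    ... | x′ , z′ , eq₁ , refl , x′~z′ =
      within bx (fibre (sym eq₁)) ◅◅ ((x′~z′ , bc) ◅ go bc refl s)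
    joined′ : ∀ {i j} → (∃₂ λ x y → branch x ≡ just i × branch y ≡ just j × Adjacent H x y) →
              ∃₂ λ x y → branch (ρ x) ≡ just i × branch (ρ y) ≡ just j × x ~ y
    joined′ (x , y , bx , by , x~y) with lifts x~y
    ... | x′ , y′ , refl , refl , x′~y′ = x′ , y′ , bx , by , x′~y′

  model-⊆ : {G H : Graph n} → (∀ {x y} → Adjacent H x y → Adjacent G x y) →
            Model r H → Model r G
  model-⊆ {G = G} {H} H⊆G M = record
    { branch    = branch
    ; connected = λ bx by → widen (connected bx by)
    ; joined    = λ i≢j → let x , y , bx , by , x~y = joined i≢j in x , y , bx , by , H⊆G x~y
    }
    where
    open Model M
    widen : ∀ {i x y} → Star (λ a b → Adjacent H a b × branch b ≡ just i) x y →
            Star (λ a b → Adjacent G a b × branch b ≡ just i) x y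
    widen ε = ε
    widen ((a~b , bb) ◅ s) = (H⊆G a~b , bb) ◅ widen s

  module _ {m} (G : Graph (suc m)) (u v : Fin (suc m)) (u~v : Adjacent G u v) where
    open Graph G

    private
      v≢u : v ≢ u
      v≢u refl = ~-irrefl refl u~v

      merge : Fin (suc m) → Fin m
      merge x with v Fin.≟ x
      ... | yes _   = punchOut v≢u
      ... | no  v≢x = punchOut v≢x

      merge-section : ∀ a → merge (punchIn v a) ≡ a
      merge-section a with v Fin.≟ punchIn v a
      ... | yes eq = contradiction (sym eq) (Fin.punchInᵢ≢i v a)
      ... | no  _  = Fin.punchOut-punchIn v

      merge-v : merge v ≡ merge u
      merge-v with v Fin.≟ v | v Fin.≟ u
      ... | yes _  | yes v≡u = contradiction v≡u v≢u
      ... | yes _  | no  _   = Fin.punchOut-cong v refl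
      ... | no v≢v | _       = contradiction refl v≢v

      merge-injective : ∀ x y → merge x ≡ merge y → x ≡ y ⊎ (x ≡ u × y ≡ v) ⊎ (x ≡ v × y ≡ u)
      merge-injective x y eq with v Fin.≟ x | v Fin.≟ y
      ... | yes v≡x | yes v≡y = inj₁ (trans (sym v≡x) v≡y)
      ... | yes v≡x | no  v≢y = inj₂ (inj₂ (sym v≡x , sym (Fin.punchOut-injective v≢u v≢y eq)))
      ... | no  v≢x | yes v≡y = inj₂ (inj₁ (Fin.punchOut-injective v≢x v≢u eq , sym v≡y))
      ... | no  v≢x | no  v≢y = inj₁ (Fin.punchOut-injective v≢x v≢y eq)

      merge-identifies : ∀ x y → x ≡ y ⊎ (x ≡ u × y ≡ v) ⊎ (x ≡ v × y ≡ u) → merge x ≡ merge y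
      merge-identifies x y (inj₁ refl) = refl
      merge-identifies x y (inj₂ (inj₁ (refl , refl))) = sym merge-v
      merge-identifies x y (inj₂ (inj₂ (refl , refl))) = merge-v

    -- Here v is really removed, as `Contraction` requires; the inductions on graphs use `contract`
    -- instead, which keeps the vertex set.
    merged : Graph m
    merged = record
      { _~_      = λ a b → a ≢ b × ∃₂ λ x y → merge x ≡ a × merge y ≡ b × x ~ y
      ; _~?_     = λ a b → ¬? (a Fin.≟ b) ×-dec
                     Fin.any? λ x → Fin.any? λ y →
                       (merge x Fin.≟ a) ×-dec (merge y Fin.≟ b) ×-dec (x ~? y)
      ; ~-sym    = λ (a≢b , x , y , mx , my , x~y) →
                     a≢b ∘ sym , y , x , my , mx , ~-sym x~y
      ; ~-irrefl = λ a≡b (a≢b , _) → a≢b a≡b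
      }

    merged-contraction : Contraction G merged
    merged-contraction = record
      { u = u ; v = v ; edge = u~v ; π = merge
      ; surjective = λ a → punchIn v a , λ { refl → merge-section a }
      ; identifies = λ x y → mk⇔ (merge-injective x y) (merge-identifies x y)
      ; adjacency  = λ a b → mk⇔ id id
      }

    merged-model : (M : Model r G) → Model.branch M u ≡ Model.branch M v → Model r merged
    merged-model M bu≡bv = record
      { branch    = branch′
      ; connected = λ {i} {a} {b} ba bb →
          subst (λ a → Star _ a b) (merge-section a)
            (subst (Star _ _) (merge-section b) (go (connected ba bb)))
      ; joined    = λ i≢j → joined′ i≢j (joined i≢j)
      }
      where
      open Model M
      branch′ : Fin m → Maybe (Fin _)
      branch′ a = branch (punchIn v a)
      branch-merge : ∀ x → branch′ (merge x) ≡ branch x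
      branch-merge x with v Fin.≟ x
      ... | yes refl = trans (cong branch (Fin.punchIn-punchOut v≢u)) bu≡bv
      ... | no  v≢x  = cong branch (Fin.punchIn-punchOut v≢x)
      go : ∀ {i x y} → Star (λ a b → a ~ b × branch b ≡ just i) x y →
           Star (λ a b → Adjacent merged a b × branch′ b ≡ just i) (merge x) (merge y)
      go ε = ε
      go {x = x} (_◅_ {j = z} (x~z , bz) s) with merge x Fin.≟ merge z
      ... | yes eq = subst (λ a → Star _ a _) (sym eq) (go s)
      ... | no neq = ((neq , x , z , refl , refl , x~z) , trans (branch-merge z) bz) ◅ go s
      joined′ : ∀ {i j} → i ≢ j → (∃₂ λ x y → branch x ≡ just i × branch y ≡ just j × x ~ y) →
                ∃₂ λ a b → branch′ a ≡ just i × branch′ b ≡ just j × Adjacent merged a b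
      joined′ i≢j (x , y , bx , by , x~y) =
        merge x , merge y , bx′ , by′ ,
        (λ eq → i≢j (Maybe.just-injective (trans (sym bx′) (trans (cong branch′ eq) by′)))) ,
        x , y , refl , refl , x~y
        where
        bx′ = trans (branch-merge x) bx
        by′ = trans (branch-merge y) by

  -- From models to minors

  first-step : ∀ {A : Set} {R : A → A → Set} {x y} → Star R x y → x ≢ y → ∃ λ z → R x z
  first-step ε       x≢x = contradiction refl x≢x
  first-step (r ◅ _) _   = _ , r

  private
    other : ∀ {r} → 2 ≤ r → (i : Fin r) → ∃ λ j → i ≢ j
    other (s≤s (s≤s _)) zero    = suc zero , λ ()
    other (s≤s (s≤s _)) (suc i) = zero , λ ()

  HasComplete : ℕ → Graph n → Set₁
  HasComplete {n} r G = Σ (∃ Graph) λ C → Star _⟶_ (n , G) C × Isomorphism (proj₂ C) (complete r)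

  -- While two vertices share a branch set, the first step of a path between them is an edge inside
  -- that set, and contracting it preserves the model. When no two share one, the branch map is a
  -- bijection and `joined` makes all pairs adjacent.
  total-model-contracts : 2 ≤ r → (G : Graph n) (M : Model r G) →
    (∀ x → ∃ λ i → Model.branch M x ≡ just i) → HasComplete r G
  total-model-contracts {r} {n} 2≤r G M total
    with Fin.any? (λ x → Fin.any? λ y → ¬? (x Fin.≟ y) ×-dec Maybe.≡-dec Fin._≟_ (Model.branch M x)
        (Model.branch M y))
  ... | yes (x , y , x≢y , bx≡by) with n
  ...   | suc m =
    let C , path , iso = total-model-contracts 2≤r (merged G x z x~z)
          (merged-model G x z x~z M (trans bx (sym bz))) (λ a → total (punchIn z a))
    in C , merged-contraction G x z x~z ◅ path , iso
    where
    bx = proj₂ (total x)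
    by = trans (sym bx≡by) bx
    step = first-step (Model.connected M bx by) x≢y
    z = proj₁ step
    x~z = proj₁ (proj₂ step)
    bz = proj₂ (proj₂ step)
  total-model-contracts {r} {n} 2≤r G M total | no injective =
    (_ , G) , ε , record
      { vertices  = mk↔ₛ′ to from to-from from-to
      ; adjacency = λ x y → mk⇔
          (λ x~y tx≡ty → ~-irrefl (to-injective tx≡ty) x~y)
          (λ tx≢ty → adjacent (joined tx≢ty))
      }
    where
    open Graph G
    open Model M
    to : Fin n → Fin r
    to x = proj₁ (total x)
    to-≡ : ∀ {x i} → branch x ≡ just i → to x ≡ i
    to-≡ {x} bx = Maybe.just-injective (trans (sym (proj₂ (total x))) bx)
    to-injective : ∀ {x y} → to x ≡ to y → x ≡ y
    to-injective {x} {y} eq with x Fin.≟ y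
    ... | yes x≡y = x≡y
    ... | no  x≢y = contradiction
      (x , y , x≢y , trans (proj₂ (total x)) (trans (cong just eq) (sym (proj₂ (total y))))) injective
    from : Fin r → Fin n
    from i = proj₁ (joined (proj₂ (other 2≤r i)))
    to-from : ∀ i → to (from i) ≡ i
    to-from i = let _ , _ , bx , _ = joined (proj₂ (other 2≤r i)) in to-≡ bx
    from-to : ∀ x → from (to x) ≡ x
    from-to x = to-injective (to-from (to x))
    adjacent : ∀ {x y} →
      (∃₂ λ x′ y′ → branch x′ ≡ just (to x) × branch y′ ≡ just (to y) × x′ ~ y′) → x ~ y
    adjacent (x′ , y′ , bx , by , x′~y′)
      with refl ← to-injective (to-≡ bx) | refl ← to-injective (to-≡ by) = x′~y′

  model⇒minor : 2 ≤ r → (G : Graph n) → Model r G → HasMinor G (complete r)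
  model⇒minor {r} {n} 2≤r G M
    with Fin.any? (λ x → Maybe.≡-dec Fin._≟_ (Model.branch M x) nothing)
  ... | no none =
    let C , path , iso = total-model-contracts 2≤r G M total in
    (_ , G) , C , record { embed = id ; injective = id ; preserves = id } , path , iso
    where
    total : ∀ x → ∃ λ i → Model.branch M x ≡ just i
    total x with Model.branch M x in eq
    ... | just i  = i , refl
    ... | nothing = contradiction (x , eq) none
  ... | yes (x , bx) with n
  ...   | suc m =
    let S , C , sub , path , iso = model⇒minor 2≤r (pullback (punchIn x) G)
          (pullback-model (punchIn x) (λ {a} {b} → Fin.punchIn-injective x a b) M cover)
    in S , C , record
         { embed     = punchIn x ∘ Subgraph.embed sub
         ; injective = Subgraph.injective sub ∘ Fin.punchIn-injective x _ _
         ; preserves = Subgraph.preserves sub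
         } , path , iso
    where
    cover : ∀ y {i} → Model.branch M y ≡ just i → ∃ λ a → punchIn x a ≡ y
    cover y by with x Fin.≟ y
    ... | yes refl = contradiction (trans (sym bx) by) λ ()
    ... | no  x≢y  = punchOut x≢y , Fin.punchIn-punchOut x≢y

  -- Counting

  𝟏 : ∀ {a} {A : Set a} → Dec A → ℕ
  𝟏 a? = if does a? then 1 else 0

  𝟏-yes : ∀ {a} {A : Set a} (a? : Dec A) → A → 𝟏 a? ≡ 1
  𝟏-yes (yes _) _ = refl
  𝟏-yes (no ¬a) a = contradiction a ¬a

  𝟏-no : ∀ {a} {A : Set a} (a? : Dec A) → ¬ A → 𝟏 a? ≡ 0
  𝟏-no (yes a) ¬a = contradiction a ¬a
  𝟏-no (no _)  _  = refl

  count : Decidable P → ℕ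
  count P? = sum (λ x → 𝟏 (P? x))

  sum-mono : {f g : Fin n → ℕ} → (∀ x → f x ≤ g x) → sum f ≤ sum g
  sum-mono {zero}  f≤g = z≤n
  sum-mono {suc n} f≤g = ℕ.+-mono-≤ (f≤g zero) (sum-mono (f≤g ∘ suc))

  -- Besides supporting comparisons of counts, this identifies a decidable set with `Fin m`; it
  -- turns the link of a vertex into a graph on `Fin d`.
  record Enumeration (m : ℕ) (P : Pred (Fin n) 0ℓ) : Set where
    field
      elem      : Fin m → Fin n
      injective : ∀ {i j} → elem i ≡ elem j → i ≡ j
      sound     : ∀ i → P (elem i)
      index     : ∀ {x} → P x → ∃ λ i → elem i ≡ x

  enumerate : (P? : Decidable P) → Enumeration (count P?) P
  enumerate {zero}  P? = record
    { elem = λ () ; injective = λ { {()} } ; sound = λ () ; index = λ { {()} } }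
  enumerate {suc n} {P} P? with enumerate (P? ∘ suc) | P? zero
  ... | E | no ¬p = record
    { elem      = suc ∘ elem
    ; injective = injective ∘ Fin.suc-injective
    ; sound     = sound
    ; index     = λ { {zero} p → contradiction p ¬p
                    ; {suc x} p → let i , eq = index p in i , cong suc eq }
    } where open Enumeration E
  ... | E | yes p = record
    { elem      = elem′
    ; injective = injective′
    ; sound     = λ { zero → p ; (suc i) → sound i }
    ; index     = λ { {zero} p → zero , refl
                    ; {suc x} p → let i , eq = index p in suc i , cong suc eq }
    }
    where
    open Enumeration E
    elem′ : Fin (suc _) → Fin (suc n)
    elem′ zero    = zero
    elem′ (suc i) = suc (elem i)
    injective′ : ∀ {i j} → elem′ i ≡ elem′ j → i ≡ j
    injective′ {zero}  {zero}  eq = refl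
    injective′ {zero}  {suc j} ()
    injective′ {suc i} {zero}  ()
    injective′ {suc i} {suc j} eq = cong suc (injective (Fin.suc-injective eq))

  ≤-count : (P? : Decidable P) (f : Fin m → Fin n) → (∀ {i j} → f i ≡ f j → i ≡ j) →
            (∀ i → P (f i)) → m ≤ count P?
  ≤-count P? f f-inj Pf = Fin.injective⇒≤ {f = λ i → proj₁ (index (Pf i))} λ {i} {j} eq →
    f-inj (trans (sym (proj₂ (index (Pf i)))) (trans (cong elem eq) (proj₂ (index (Pf j)))))
    where open Enumeration (enumerate P?)

  count-≤ : {P : Pred (Fin m) 0ℓ} {Q : Pred (Fin n) 0ℓ} (P? : Decidable P) (Q? : Decidable Q)
            (f : ∀ {x} → P x → Fin n) → (∀ {x} (p : P x) → Q (f p)) →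
            (∀ {x y} (p : P x) (q : P y) → f p ≡ f q → x ≡ y) → count P? ≤ count Q?
  count-≤ P? Q? f Qf f-inj =
    ≤-count Q? (f ∘ sound) (λ {i} {j} → injective ∘ f-inj (sound i) (sound j)) (Qf ∘ sound)
    where open Enumeration (enumerate P?)

  count-⊆ : (P? : Decidable P) (Q? : Decidable Q) → (∀ {x} → P x → Q x) → count P? ≤ count Q?
  count-⊆ P? Q? P⊆Q = count-≤ P? Q? (λ {x} _ → x) P⊆Q (λ _ _ eq → eq)

  count-⊂ : (P? : Decidable P) (Q? : Decidable Q) → (∀ {x} → P x → Q x) →
            ∀ {y} → Q y → ¬ P y → count P? < count Q?
  count-⊂ {n} {P} {Q} P? Q? P⊆Q {y} Qy ¬Py = ≤-count Q? f f-inj Qf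
    where
    open Enumeration (enumerate P?)
    f : Fin (suc (count P?)) → Fin n
    f zero    = y
    f (suc i) = elem i
    f-inj : ∀ {i j} → f i ≡ f j → i ≡ j
    f-inj {zero}  {zero}  eq = refl
    f-inj {zero}  {suc j} eq = contradiction (subst P (sym eq) (sound j)) ¬Py
    f-inj {suc i} {zero}  eq = contradiction (subst P eq (sound i)) ¬Py
    f-inj {suc i} {suc j} eq = cong suc (injective eq)
    Qf : ∀ i → Q (f i)
    Qf zero    = Qy
    Qf (suc i) = P⊆Q (sound i)

  count-none : (P? : Decidable P) → (∀ {x} → ¬ P x) → count P? ≡ 0
  count-none {P = P} P? none with count P? | enumerate P?
  ... | zero  | _ = refl
  ... | suc _ | E = contradiction (Enumeration.sound E zero) none

  count-some : (P? : Decidable P) → 0 < count P? → ∃ P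
  count-some P? pos with count P? | enumerate P?
  ... | suc _ | E = _ , Enumeration.sound E zero

  count-insert : (P? : Decidable P) (Q? : Decidable Q) {y : Fin n} →
                 (∀ {x} → P x → x ≢ y → Q x) → count P? ≤ suc (count Q?)
  count-insert {n} {P} {Q} P? Q? {y} P⊆Q = Fin.injective⇒≤ {f = g} g-inj
    where
    open Enumeration (enumerate P?)
    open Enumeration (enumerate Q?) renaming (elem to elem′; index to index′) hiding (injective; sound)
    g : Fin (count P?) → Fin (suc (count Q?))
    g i with elem i Fin.≟ y
    ... | yes _ = zero
    ... | no ≢y = suc (proj₁ (index′ (P⊆Q (sound i) ≢y)))
    g-inj : ∀ {i j} → g i ≡ g j → i ≡ j
    g-inj {i} {j} eq with elem i Fin.≟ y | elem j Fin.≟ y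
    ... | yes p | yes q = injective (trans p (sym q))
    ... | no p  | no q  = injective (trans (sym (proj₂ (index′ (P⊆Q (sound i) p))))
        (trans (cong elem′ (Fin.suc-injective eq)) (proj₂ (index′ (P⊆Q (sound j) q)))))

  count-complement : (P? : Decidable {A = Fin n} P) → count P? + count (¬? ∘ P?) ≡ n
  count-complement {zero}  P? = refl
  count-complement {suc n} P? with P? zero
  ... | yes _ = cong suc (count-complement (P? ∘ suc))
  ... | no  _ = trans (ℕ.+-suc (count (P? ∘ suc)) (count (¬? ∘ P? ∘ suc)))
      (cong suc (count-complement (P? ∘ suc)))

  count-∪∩ : (P? : Decidable {A = Fin n} P) (Q? : Decidable {A = Fin n} Q) →
             count P? + count Q? ≡ count (λ x → P? x ⊎-dec Q? x) + count (λ x → P? x ×-dec Q? x)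
  count-∪∩ P? Q? = trans (sym (∑-distrib-+ (λ x → 𝟏 (P? x)) (λ x → 𝟏 (Q? x))))
    (trans (sum-cong-≗ pointwise) (∑-distrib-+ (λ x → 𝟏 (P? x ⊎-dec Q? x)) (λ x → 𝟏 (P? x ×-dec Q? x))))
    where
    pointwise : ∀ x → 𝟏 (P? x) + 𝟏 (Q? x) ≡ 𝟏 (P? x ⊎-dec Q? x) + 𝟏 (P? x ×-dec Q? x)
    pointwise x with P? x | Q? x
    ... | yes _ | yes _ = refl
    ... | yes _ | no  _ = refl
    ... | no  _ | yes _ = refl
    ... | no  _ | no  _ = refl

  sum-δ : (a : Fin n) (k : ℕ) → sum (λ x → 𝟏 (x Fin.≟ a) * k) ≡ k
  sum-δ {suc n} zero k = trans (cong (k + 0 +_) (sum-zero n)) (trans (ℕ.+-identityʳ (k + 0)) (ℕ.+-identityʳ k))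
    where
    sum-zero : ∀ n → sum {n} (λ _ → 0) ≡ 0
    sum-zero zero    = refl
    sum-zero (suc n) = sum-zero n
  sum-δ {suc n} (suc a) k = trans (sum-cong-≗ same) (sum-δ a k)
    where
    same : ∀ x → 𝟏 (suc x Fin.≟ suc a) * k ≡ 𝟏 (x Fin.≟ a) * k
    same x with x Fin.≟ a
    ... | yes _ = refl
    ... | no  _ = refl

  sum-mono-< : {f g : Fin n → ℕ} → (∀ x → f x ≤ g x) → ∀ y → f y < g y → sum f < sum g
  sum-mono-< {suc n} f≤g zero    f<g = ℕ.+-mono-<-≤ f<g (sum-mono (f≤g ∘ suc))
  sum-mono-< {suc n} f≤g (suc y) f<g = ℕ.+-mono-≤-< (f≤g zero) (sum-mono-< (f≤g ∘ suc) y f<g)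

  -- Graphs on at most seven vertices with minimum degree four

  BRel : ℕ → Set
  BRel m = Fin m → Fin m → Bool

  -- Five stars, each given by its centre and its leaves: the candidates for the branch sets of a
  -- K₅ minor.
  Clusters : ℕ → Set
  Clusters m = Vec (Fin m × List (Fin m)) 5

  members : Clusters m → Fin 5 → List (Fin m)
  members C c = let x , xs = lookup C c in x ∷ xs

  Linked : BRel m → Clusters m → Set
  Linked g C =
    (∀ c → All (λ y → T (g (proj₁ (lookup C c)) y)) (proj₂ (lookup C c))) ×
    (∀ c d → c <ᶠ d → Any (λ x → Any (λ y → T (g x y)) (members C d)) (members C c))

  linked? : (g : BRel m) (C : Clusters m) → Dec (Linked g C)
  linked? g C =
    Fin.all? (λ c → All.all? (λ y → T? (g (proj₁ (lookup C c)) y)) (proj₂ (lookup C c))) ×-dec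
    Fin.all? λ c → Fin.all? λ d → (c Fin.<? d) →-dec
      Any.any? (λ x → Any.any? (λ y → T? (g x y)) (members C d)) (members C c)

  common? : (g : BRel m) (i j : Fin m) (k : Fin m) → Dec (T (g i k) × T (g j k))
  common? g i j k = T? (g i k) ×-dec T? (g j k)

  -- Among the graphs met below, these are the octahedron and the pentagonal bipyramid.
  record Exceptional (g : BRel m) : Set where
    constructor exceptional
    field
      adjacent-common    : ∀ i j → T (g i j) → count (common? g i j) ≤ 2
      nonadjacent-common : ∀ i j → i ≢ j → ¬ T (g i j) → 3 ≤ count (common? g i j)
      nonadjacent        : ∀ i → ∃ λ j → i ≢ j × ¬ T (g i j)
      no-K₄              : ∀ i j → T (g i j) → ∀ k → T (g i k) × T (g j k) →
                           ∀ l → ¬ (T (g k l) × T (g i l) × T (g j l))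

  exceptional? : (g : BRel m) → Dec (Exceptional g)
  exceptional? g with
    (Fin.all? λ i → Fin.all? λ j → T? (g i j) →-dec (count (common? g i j) ℕ.≤? 2)) ×-dec
    (Fin.all? λ i → Fin.all? λ j → ¬? (i Fin.≟ j) →-dec (¬? (T? (g i j)) →-dec
       (3 ℕ.≤? count (common? g i j)))) ×-dec
    (Fin.all? λ i → Fin.any? λ j → ¬? (i Fin.≟ j) ×-dec ¬? (T? (g i j))) ×-dec
    (Fin.all? λ i → Fin.all? λ j → T? (g i j) →-dec (Fin.all? λ k → common? g i j k →-dec
       (Fin.all? λ l → ¬? (T? (g k l) ×-dec (T? (g i l) ×-dec T? (g j l))))))
  ... | yes (a , b , c , d) = yes (exceptional a b c d)
  ... | no ¬e = no λ (exceptional a b c d) → ¬e (a , b , c , d)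

  Knowledge : ℕ → Set
  Knowledge m = Vec (Vec (Maybe Bool) m) m

  entry : Knowledge m → Fin m → Fin m → Maybe Bool
  entry K i j = lookup (lookup K i) j

  setEntry : Fin m → Fin m → Bool → Knowledge m → Knowledge m
  setEntry i j b K = updateAt K i (_[ j ]≔ just b)

  set : Fin m → Fin m → Bool → Knowledge m → Knowledge m
  set i j b K = setEntry j i b (setEntry i j b K)

  isYes isNo : Maybe Bool → Bool
  isYes (just b) = b
  isYes nothing  = false
  isNo (just b) = not b
  isNo nothing  = false

  private
    _∈?_ : (x : Fin m) (xs : List (Fin m)) → Dec (x ∈ xs)
    x ∈? xs = Any.any? (x Fin.≟_) xs

  branchOf : Clusters m → Fin m → Maybe (Fin 5)
  branchOf C x with Fin.any? (λ c → x ∈? members C c)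
  ... | yes (c , _) = just c
  ... | no  _       = nothing

  -- `branchOf` commits to one cluster per vertex, so this amounts to the disjointness of the
  -- clusters.
  Separated : Clusters m → Set
  Separated C = ∀ c → All (λ x → branchOf C x ≡ just c) (members C c)

  separated? : (C : Clusters m) → Dec (Separated C)
  separated? C = Fin.all? λ c → All.all? (λ x → Maybe.≡-dec Fin._≟_ (branchOf C x) (just c)) (members C c)

  adjacency : Graph m → BRel m
  adjacency G x y = ⌊ Graph._~?_ G x y ⌋

  linked⇒model : (G : Graph m) {g : BRel m} (C : Clusters m) →
                 (∀ {x y} → T (g x y) → Adjacent G x y) →
                 Separated C → Linked g C → Model 5 G
  linked⇒model G {g} C sound separated (stars , joins) = record
    { branch    = branchOf C
    ; connected = λ {i} {x} {y} bx by → path i by (member bx) (member by)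
    ; joined    = λ {i} {j} i≢j → join i j i≢j
    }
    where
    open Graph G
    member : ∀ {x i} → branchOf C x ≡ just i → x ∈ members C i
    member {x} eq with Fin.any? (λ c → x ∈? members C c)
    member refl | yes (c , x∈) = x∈
    centre : ∀ i → Fin _
    centre i = proj₁ (lookup C i)
    fromCentre : ∀ i {y} → branchOf C y ≡ just i → y ∈ members C i →
                 Star (λ a b → a ~ b × branchOf C b ≡ just i) (centre i) y
    fromCentre i by (here refl) = ε
    fromCentre i by (there y∈)  = (sound (All.lookup (stars i) y∈) , by) ◅ ε
    path : ∀ i {x y} → branchOf C y ≡ just i → x ∈ members C i → y ∈ members C i →
           Star (λ a b → a ~ b × branchOf C b ≡ just i) x y
    path i by (here refl) y∈ = fromCentre i by y∈
    path i by (there x∈)  y∈ =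
      (~-sym (sound (All.lookup (stars i) x∈)) , All.head (separated i)) ◅ fromCentre i by y∈
    ordered : ∀ i j → i <ᶠ j → ∃₂ λ x y → branchOf C x ≡ just i × branchOf C y ≡ just j × x ~ y
    ordered i j i<j with find (joins i j i<j)
    ... | x , x∈ , any with find any
    ...   | y , y∈ , gxy = x , y , All.lookup (separated i) x∈ , All.lookup (separated j) y∈ , sound gxy
    join : ∀ i j → i ≢ j → ∃₂ λ x y → branchOf C x ≡ just i × branchOf C y ≡ just j × x ~ y
    join i j i≢j with Fin.<-cmp i j
    ... | tri< i<j _ _ = ordered i j i<j
    ... | tri≈ _ i≡j _ = contradiction i≡j i≢j
    ... | tri> _ _ j<i = let y , x , by , bx , y~x = ordered j i j<i in x , y , bx , by , ~-sym y~x

  -- A certificate: case distinctions on adjacencies, each branch ending in a clustering that gives a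
  -- K₅ minor, in an exceptional graph, or in a relabelling to a case already treated.
  data Tree (m : ℕ) : Set where
    split       : Fin m → Fin m → Tree m → Tree m → Tree m
    win         : ℕ → Tree m
    exceptional : Tree m
    relabel     : Vec (Fin m) m → Tree m

  nth : ∀ {a} {A : Set a} → List A → ℕ → Maybe A
  nth []       _       = nothing
  nth (x ∷ xs) zero    = just x
  nth (x ∷ xs) (suc k) = nth xs k

  Consistent : Knowledge m → Graph m → Set
  Consistent K G = ∀ i j {b} → entry K i j ≡ just b → adjacency G i j ≡ b

  Outcome : Graph m → Set
  Outcome G = Model 5 G ⊎ Exceptional (adjacency G)

  T-true : ∀ {b} → T b → b ≡ true
  T-true = Equivalence.to T-≡

  true-T : ∀ {b} → b ≡ true → T b
  true-T = Equivalence.from T-≡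

  ¬T-false : ∀ {b} → ¬ T b → b ≡ false
  ¬T-false {true}  ¬t = contradiction _ ¬t
  ¬T-false {false} _  = refl

  T-not : ∀ {b} → T (not b) → ¬ T b
  T-not {false} _ ()

  module _ (π : Fin m → Fin m) (involutive : ∀ i → π (π i) ≡ i) where

    involutive⇒injective : ∀ {i j} → π i ≡ π j → i ≡ j
    involutive⇒injective {i} {j} eq = trans (sym (involutive i)) (trans (cong π eq) (involutive j))

    -- Stated for involutions, so that one vector in a certificate determines both directions; the
    -- certificates relabel by products of disjoint swaps. The identity is used as well, to pass
    -- between two relations that agree.
    exceptional-permute : {g h : BRel m} → (∀ {i j} → T (g (π i) (π j)) → T (h i j)) →
                          (∀ {i j} → T (h i j) → T (g (π i) (π j))) → Exceptional g → Exceptional h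
    exceptional-permute {g} {h} fwd bwd e = record
      { adjacent-common    = λ i j hij → ℕ.≤-trans
          (count-≤ (common? h i j) (common? g (π i) (π j)) (λ {x} _ → π x)
            (λ (p , q) → bwd p , bwd q) (λ _ _ → involutive⇒injective))
          (adjacent-common (π i) (π j) (bwd hij))
      ; nonadjacent-common = λ i j i≢j ¬hij → ℕ.≤-trans
          (nonadjacent-common (π i) (π j) (i≢j ∘ involutive⇒injective) (¬hij ∘ fwd))
          (count-≤ (common? g (π i) (π j)) (common? h i j) (λ {x} _ → π x)
            (λ (p , q) → back p , back q) (λ _ _ → involutive⇒injective))
      ; nonadjacent        = λ i → let j , πi≢j , ¬g = nonadjacent (π i) in
          π j , (λ i≡πj → πi≢j (trans (cong π i≡πj) (involutive j))) , λ h → ¬g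
              (subst (T ∘ g (π i)) (involutive j) (bwd h))
      ; no-K₄              = λ i j hij k (hik , hjk) l (hkl , hil , hjl) →
          no-K₄ (π i) (π j) (bwd hij) (π k) (bwd hik , bwd hjk) (π l) (bwd hkl , bwd hil , bwd hjl)
      }
      where
      open Exceptional e
      back : ∀ {i x} → T (g (π i) x) → T (h i (π x))
      back {i} {x} p = fwd (subst (T ∘ g (π i)) (sym (involutive x)) p)

  setEntry-consistent : ∀ {K} (G : Graph m) i j {b} → adjacency G i j ≡ b →
                        Consistent K G → Consistent (setEntry i j b K) G
  setEntry-consistent {K = K} G i j {b} eq agrees x y entry≡ with x Fin.≟ i
  ... | no x≢i = agrees x y (trans (sym (cong (λ r → lookup r y) (Vec.lookup∘updateAt′ x i x≢i K))) entry≡)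
  ... | yes refl with trans (sym (cong (λ r → lookup r y) (Vec.lookup∘updateAt x {_[ j ]≔ just b} K))) entry≡
  ...   | entry≡′ with y Fin.≟ j
  ...     | yes refl = trans eq (Maybe.just-injective
            (trans (sym (Vec.lookup∘update y (lookup K x) (just b))) entry≡′))
  ...     | no y≢j = agrees x y (trans (sym (Vec.lookup∘update′ y≢j (lookup K x) (just b))) entry≡′)

  set-consistent : ∀ {K} (G : Graph m) i j {b} → adjacency G i j ≡ b →
                   Consistent K G → Consistent (set i j b K) G
  set-consistent {K = K} G i j {b} eq agrees =
    setEntry-consistent {K = setEntry i j b K} G j i (trans adjacency-sym eq)
      (setEntry-consistent {K = K} G i j eq agrees)
    where
    open Graph G
    adjacency-sym : adjacency G j i ≡ adjacency G i j
    adjacency-sym with j ~? i | i ~? j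
    ... | yes _   | yes _   = refl
    ... | no  _   | no  _   = refl
    ... | yes j~i | no  i≁j = contradiction (~-sym j~i) i≁j
    ... | no  j≁i | yes i~j = contradiction (~-sym i~j) j≁i

  module Check {m : ℕ} (cap : ℕ) (clusterings : List (Clusters m)) where

    -- A vertex counts among its own nonneighbours.
    Capped : Graph m → Set
    Capped G = ∀ x → count (λ y → ¬? (Graph._~?_ G x y)) ≤ cap

    noCount : Knowledge m → Fin m → ℕ
    noCount K i = count λ j → T? (isNo (entry K i j))

    -- Once cap nonneighbours of a vertex are known, it is adjacent to all remaining vertices.
    forced : Knowledge m → Fin m → Fin m → Bool
    forced K i j = not (isNo (entry K i j)) ∧ (cap ≤ᵇ noCount K i)

    present : Knowledge m → Fin m → Fin m → Bool
    present K i j = isYes (entry K i j) ∨ (forced K i j ∨ forced K j i)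

    table : Knowledge m → Vec (Vec Bool m) m
    table K = Vec.tabulate λ i → Vec.tabulate λ j → present K i j

    rel : Vec (Vec Bool m) m → BRel m
    rel V i j = lookup (lookup V i) j

    -- The last argument is knowledge for which the outcome is already established.
    check : Tree m → Knowledge m → Maybe (Knowledge m) → Bool
    check (split i j s t) K B = check s (set i j true K) B ∧ check t (set i j false K) B
    check (win k) K B with nth clusterings k
    ... | just C  = ⌊ separated? C ×-dec linked? (rel (table K)) C ⌋
    ... | nothing = false
    check exceptional K B =
      ⌊ (Fin.all? λ i → Fin.all? λ j → T? (rel (table K) i j) ⊎-dec T? (isNo (entry K i j)))
        ×-dec exceptional? (rel (table K)) ⌋
    check (relabel π) K nothing  = false
    check (relabel π) K (just B) =
      ⌊ (Fin.all? λ i → lookup π (lookup π i) Fin.≟ i) ×-dec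
        (Fin.all? λ i → Fin.all? λ j →
           Maybe.≡-dec Bool._≟_ (entry B i j) nothing ⊎-dec
           (Maybe.≡-dec Bool._≟_ (entry B i j) (just true) ×-dec
            T? (present K (lookup π i) (lookup π j))) ⊎-dec
           (Maybe.≡-dec Bool._≟_ (entry B i j) (just false) ×-dec
            T? (isNo (entry K (lookup π i) (lookup π j))))) ⌋

    rel-table : ∀ K x y → rel (table K) x y ≡ present K x y
    rel-table K x y = trans (cong (λ r → lookup r y) (Vec.lookup∘tabulate _ x)) (Vec.lookup∘tabulate _ y)

    module _ (G : Graph m) (capped : Capped G) (K : Knowledge m) (consistent : Consistent K G) where
      open Graph G

      no⇒≁ : ∀ {x y} → T (isNo (entry K x y)) → ¬ x ~ y
      no⇒≁ {x} {y} isno x~y with entry K x y in eq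
      ... | just false with () ← trans (sym (consistent x y eq)) (T-true (fromWitness x~y))

      -- If y were a nonneighbour, it would come on top of the `cap` nonneighbours of x already
      -- known.
      forced⇒~ : ∀ {x y} → T (forced K x y) → x ~ y
      forced⇒~ {x} {y} f with x ~? y
      ... | yes x~y = x~y
      ... | no  x≁y with Equivalence.to (T-∧ {not (isNo (entry K x y))}) f
      ...   | ¬no , full = contradiction
        (count-⊂ (λ j → T? (isNo (entry K x j))) (λ y → ¬? (x ~? y)) no⇒≁ x≁y (T-not ¬no))
        (ℕ.≤⇒≯ (ℕ.≤-trans (capped x) (ℕ.≤ᵇ⇒≤ cap _ full)))

      present⇒~ : ∀ {x y} → T (present K x y) → x ~ y
      present⇒~ {x} {y} p with Equivalence.to (T-∨ {isYes (entry K x y)}) p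
      ... | inj₂ q with Equivalence.to (T-∨ {forced K x y}) q
      ...   | inj₁ f = forced⇒~ f
      ...   | inj₂ f = ~-sym (forced⇒~ f)
      present⇒~ {x} {y} p | inj₁ q with entry K x y in eq
      ... | just true = toWitness (true-T (consistent x y eq))

      rel⇒~ : ∀ {x y} → T (rel (table K) x y) → x ~ y
      rel⇒~ {x} {y} p = present⇒~ (subst T (rel-table K x y) p)

      decided⇒exceptional : (∀ x y → T (rel (table K) x y) ⊎ T (isNo (entry K x y))) →
                            Exceptional (rel (table K)) → Exceptional (adjacency G)
      decided⇒exceptional decided = exceptional-permute id (λ _ → refl) (λ {x} {y} → fromWitness ∘ rel⇒~ {x} {y}) backward
        where
        backward : ∀ {x y} → T (adjacency G x y) → T (rel (table K) x y)
        backward {x} {y} a with decided x y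
        ... | inj₁ p  = p
        ... | inj₂ p = contradiction (toWitness a) (no⇒≁ p)

    -- `B` is the case to which a `relabel` leaf appeals, and the first hypothesis is its proof.
    -- Such a leaf only has to imply the entries decided in `B` after renumbering by π; since π is
    -- an involution, a second renumbering carries the outcome back.
    check-sound : ∀ t {K B} →
      (∀ {K′} → B ≡ just K′ → ∀ G → Capped G → Consistent K′ G → Outcome G) →
      T (check t K B) → ∀ G → Capped G → Consistent K G → Outcome G
    check-sound (split i j s t) {K} {B} base ok G capped agrees
      with Equivalence.to (T-∧ {check s (set i j true K) B}) ok | adjacency G i j in eq
    ... | ok₁ , _ | true  = check-sound s base ok₁ G capped (set-consistent {K = K} G i j eq agrees)
    ... | _ , ok₂ | false = check-sound t base ok₂ G capped (set-consistent {K = K} G i j eq agrees)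
    check-sound (win k) {K} base ok G capped agrees with nth clusterings k
    ... | just C = let separated , linked = toWitness ok in
      inj₁ (linked⇒model G C (rel⇒~ G capped K agrees) separated linked)
    check-sound exceptional {K} base ok G capped agrees =
      let decided , e = toWitness ok in inj₂ (decided⇒exceptional G capped K agrees decided e)
    check-sound (relabel v) {K} {just B} base ok G capped agrees = transfer (base refl G′ capped′ agrees′)
      where
      open Graph G
      π : Fin m → Fin m
      π = lookup v
      facts = toWitness ok
      involutive = proj₁ facts
      refines = proj₂ facts
      π-injective : ∀ {i j} → π i ≡ π j → i ≡ j
      π-injective = involutive⇒injective π involutive
      G′ = pullback π G
      capped′ : Capped G′
      capped′ x = ℕ.≤-trans (count-≤ (λ y → ¬? (π x ~? π y)) (λ y → ¬? (π x ~? y)) (λ {y} _ → π y)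
        (λ p → p) (λ _ _ → π-injective)) (capped (π x))
      agrees′ : Consistent B G′
      agrees′ i j entry≡ with refines i j
      ... | inj₁ none with () ← trans (sym none) entry≡
      ... | inj₂ (inj₂ (no≡ , p)) with refl ← Maybe.just-injective (trans (sym no≡) entry≡) =
        ¬T-false (no⇒≁ G capped K agrees p ∘ toWitness)
      ... | inj₂ (inj₁ (yes≡ , p)) with refl ← Maybe.just-injective (trans (sym yes≡) entry≡) =
        T-true (fromWitness (present⇒~ G capped K agrees p))
      transfer : Outcome G′ → Outcome G
      transfer (inj₁ M) = inj₁ (model-⊆ {H = pullback π G′}
        (λ {x} {y} → subst (λ z → z ~ y) (involutive x) ∘ subst (π (π x) ~_) (involutive y))
        (pullback-model π π-injective M λ y _ → π y , involutive y))
      transfer (inj₂ e) = inj₂ (exceptional-permute π involutive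
        (λ {i} {j} p → subst (λ z → T (adjacency G z j)) (involutive i)
          (subst (λ z → T (adjacency G (π (π i)) z)) (involutive j) p))
        (λ {i} {j} p → subst (λ z → T (adjacency G z (π (π j)))) (sym (involutive i))
          (subst (λ z → T (adjacency G i z)) (sym (involutive j)) p)) e)

  loopless : Knowledge m
  loopless {m} = Vec.tabulate λ i → Vec.replicate m nothing [ i ]≔ just false

  loopless-consistent : (G : Graph m) → Consistent loopless G
  loopless-consistent {m} G i j eq
    with trans (sym (cong (λ r → lookup r j) (Vec.lookup∘tabulate
        (λ i → Vec.replicate m nothing [ i ]≔ just false) i))) eq
  ... | eq′ with j Fin.≟ i
  ...   | no j≢i with () ← trans (sym (trans (Vec.lookup∘update′ j≢i (Vec.replicate m nothing) (just false))
      (Vec.lookup-replicate j nothing))) eq′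
  loopless-consistent {m} G i j eq | eq′ | yes refl
    with refl ← Maybe.just-injective (trans (sym (Vec.lookup∘update j (Vec.replicate m nothing)
        (just false))) eq′)
    with Graph._~?_ G j j
  ... | yes j~j = contradiction j~j (Graph.~-irrefl G refl)
  ... | no  _   = refl

  -- Certificates for links with five, six and seven vertices

  clusterings5 : List (Clusters 5)
  clusterings5 =
    ((0F , []) ∷ (1F , []) ∷ (2F , []) ∷ (3F , []) ∷ (4F , []) ∷ []) ∷
    []

  -- The diagonal entry alone exhausts the cap 1, so every pair is forced to be adjacent and no case
  -- distinction remains.
  tree5 : Tree 5
  tree5 =
    win 0

  clusterings6 : List (Clusters 6)
  clusterings6 =
    ((0F , 1F ∷ []) ∷ (2F , []) ∷ (3F , []) ∷ (4F , []) ∷ (5F , []) ∷ []) ∷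
    ((0F , []) ∷ (1F , []) ∷ (2F , []) ∷ (3F , []) ∷ (4F , 5F ∷ []) ∷ []) ∷
    ((0F , []) ∷ (1F , []) ∷ (2F , []) ∷ (3F , 4F ∷ []) ∷ (5F , []) ∷ []) ∷
    ((0F , []) ∷ (1F , 5F ∷ []) ∷ (2F , []) ∷ (3F , []) ∷ (4F , []) ∷ []) ∷
    ((0F , []) ∷ (1F , []) ∷ (2F , 3F ∷ []) ∷ (4F , []) ∷ (5F , []) ∷ []) ∷
    ((0F , []) ∷ (1F , []) ∷ (2F , 5F ∷ []) ∷ (3F , []) ∷ (4F , []) ∷ []) ∷
    ((0F , []) ∷ (1F , 2F ∷ []) ∷ (3F , []) ∷ (4F , []) ∷ (5F , []) ∷ []) ∷
    ((0F , []) ∷ (1F , 3F ∷ []) ∷ (2F , []) ∷ (4F , []) ∷ (5F , []) ∷ []) ∷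
    []

  -- A vertex misses at most one other, so the nonadjacent pairs form a matching; the octahedron is
  -- the case of a perfect one.
  tree6 : Tree 6
  tree6 =
    split 4F 5F (split 0F 1F (split 0F 2F (split 0F 3F (split 0F 4F (split 1F 2F (split 1F 3F
    (split 1F 4F (split 2F 3F (split 2F 4F (split 3F 4F (win 1) (win 1)) (win 1)) (win 5)) (split
    2F 3F (win 1) (split 0F 5F (win 2) exceptional))) (split 2F 4F (win 3) (split 0F 5F (win 2)
    exceptional))) (split 0F 5F (win 4) (split 3F 4F (win 0) exceptional))) (split 1F 2F (split 1F
    3F (split 2F 3F (win 1) (split 1F 5F (win 2) exceptional)) (split 2F 5F (win 0) exceptional))
    (split 3F 5F (win 0) exceptional))) (split 1F 4F (split 1F 5F (win 4) (split 2F 4F (win 0)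
    exceptional)) (split 2F 5F (win 0) exceptional))) (split 1F 4F (split 1F 5F (win 4) (split 3F
    4F (win 0) exceptional)) (split 3F 5F (win 0) exceptional))) (split 3F 4F (split 3F 5F (win 6)
    (split 2F 4F (win 3) exceptional)) (split 2F 5F (win 7) exceptional))) (split 0F 1F (split 0F
    2F (split 1F 2F (win 2) (split 0F 3F (win 3) exceptional)) (split 1F 3F (win 5) exceptional))
    (split 2F 3F (win 3) exceptional))

  clusterings7 : List (Clusters 7)
  clusterings7 =
    ((0F , []) ∷ (1F , 2F ∷ []) ∷ (3F , 6F ∷ []) ∷ (4F , []) ∷ (5F , []) ∷ []) ∷
    ((0F , []) ∷ (1F , 5F ∷ []) ∷ (2F , 6F ∷ []) ∷ (3F , []) ∷ (4F , []) ∷ []) ∷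
    ((0F , []) ∷ (1F , 2F ∷ []) ∷ (3F , []) ∷ (4F , 6F ∷ []) ∷ (5F , []) ∷ []) ∷
    ((0F , []) ∷ (1F , 2F ∷ 3F ∷ []) ∷ (4F , []) ∷ (5F , []) ∷ (6F , []) ∷ []) ∷
    ((0F , []) ∷ (1F , 6F ∷ []) ∷ (2F , 4F ∷ []) ∷ (3F , []) ∷ (5F , []) ∷ []) ∷
    ((0F , []) ∷ (1F , 4F ∷ []) ∷ (2F , 5F ∷ []) ∷ (3F , []) ∷ (6F , []) ∷ []) ∷
    ((0F , []) ∷ (1F , 5F ∷ []) ∷ (2F , 3F ∷ []) ∷ (4F , []) ∷ (6F , []) ∷ []) ∷
    ((0F , []) ∷ (1F , 3F ∷ []) ∷ (2F , 6F ∷ []) ∷ (4F , []) ∷ (5F , []) ∷ []) ∷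
    ((0F , []) ∷ (1F , []) ∷ (2F , 3F ∷ []) ∷ (4F , []) ∷ (5F , 6F ∷ []) ∷ []) ∷
    ((0F , []) ∷ (1F , 6F ∷ []) ∷ (2F , 5F ∷ []) ∷ (3F , []) ∷ (4F , []) ∷ []) ∷
    ((0F , []) ∷ (1F , []) ∷ (2F , 4F ∷ []) ∷ (3F , 5F ∷ []) ∷ (6F , []) ∷ []) ∷
    ((0F , []) ∷ (1F , 3F ∷ 6F ∷ []) ∷ (2F , []) ∷ (4F , []) ∷ (5F , []) ∷ []) ∷
    ((0F , []) ∷ (1F , 4F ∷ []) ∷ (2F , 6F ∷ []) ∷ (3F , []) ∷ (5F , []) ∷ []) ∷
    ((0F , []) ∷ (1F , 3F ∷ []) ∷ (2F , 5F ∷ []) ∷ (4F , []) ∷ (6F , []) ∷ []) ∷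
    ((0F , []) ∷ (1F , []) ∷ (2F , []) ∷ (3F , 5F ∷ []) ∷ (4F , 6F ∷ []) ∷ []) ∷
    ((0F , []) ∷ (1F , []) ∷ (2F , []) ∷ (3F , 6F ∷ []) ∷ (4F , 5F ∷ []) ∷ []) ∷
    ((0F , []) ∷ (1F , []) ∷ (4F , 2F ∷ 3F ∷ []) ∷ (5F , []) ∷ (6F , []) ∷ []) ∷
    ((0F , 5F ∷ []) ∷ (1F , 2F ∷ []) ∷ (3F , []) ∷ (4F , []) ∷ (6F , []) ∷ []) ∷
    ((0F , []) ∷ (1F , 6F ∷ []) ∷ (2F , 3F ∷ []) ∷ (4F , []) ∷ (5F , []) ∷ []) ∷
    ((0F , []) ∷ (1F , []) ∷ (2F , []) ∷ (3F , 4F ∷ []) ∷ (5F , 6F ∷ []) ∷ []) ∷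
    ((0F , []) ∷ (1F , []) ∷ (2F , 6F ∷ []) ∷ (3F , 5F ∷ []) ∷ (4F , []) ∷ []) ∷
    ((0F , []) ∷ (1F , 2F ∷ 4F ∷ []) ∷ (3F , []) ∷ (5F , []) ∷ (6F , []) ∷ []) ∷
    ((0F , []) ∷ (4F , 1F ∷ 2F ∷ []) ∷ (3F , []) ∷ (5F , []) ∷ (6F , []) ∷ []) ∷
    ((0F , []) ∷ (1F , 5F ∷ []) ∷ (2F , 4F ∷ []) ∷ (3F , []) ∷ (6F , []) ∷ []) ∷
    ((0F , []) ∷ (1F , []) ∷ (2F , 4F ∷ 6F ∷ []) ∷ (3F , []) ∷ (5F , []) ∷ []) ∷
    ((0F , []) ∷ (1F , []) ∷ (2F , []) ∷ (6F , 3F ∷ 5F ∷ []) ∷ (4F , []) ∷ []) ∷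
    ((0F , []) ∷ (1F , []) ∷ (2F , 3F ∷ []) ∷ (4F , 5F ∷ []) ∷ (6F , []) ∷ []) ∷
    ((0F , []) ∷ (1F , []) ∷ (5F , 2F ∷ 6F ∷ []) ∷ (3F , []) ∷ (4F , []) ∷ []) ∷
    ((0F , []) ∷ (1F , 3F ∷ []) ∷ (2F , []) ∷ (4F , 5F ∷ []) ∷ (6F , []) ∷ []) ∷
    ((0F , []) ∷ (1F , 3F ∷ []) ∷ (2F , 4F ∷ []) ∷ (5F , []) ∷ (6F , []) ∷ []) ∷
    ((0F , []) ∷ (1F , 4F ∷ 6F ∷ []) ∷ (2F , []) ∷ (3F , []) ∷ (5F , []) ∷ []) ∷
    ((0F , 4F ∷ []) ∷ (1F , 3F ∷ []) ∷ (2F , []) ∷ (5F , []) ∷ (6F , []) ∷ []) ∷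
    ((0F , 4F ∷ []) ∷ (1F , 5F ∷ []) ∷ (2F , []) ∷ (3F , []) ∷ (6F , []) ∷ []) ∷
    []

  -- A vertex misses at most two others, so the complement is a disjoint union of paths and cycles;
  -- for the pentagonal bipyramid it is a pentagon and an edge.
  tree7 : Tree 7
  tree7 =
    split 1F 3F (split 2F 4F (split 1F 4F (split 3F 5F (split 1F 6F (split 5F 6F (split 4F 5F
    (split 2F 6F (win 7) (split 2F 3F (win 4) (win 11))) (split 2F 5F (split 4F 6F (win 13) (win
    4)) (split 3F 6F (win 22) (split 2F 3F (split 2F 6F (win 12) (split 0F 1F (win 8) (split 3F 4F
    (win 2) exceptional))) (split 0F 1F (win 10) (split 4F 6F (win 2) exceptional)))))) (split 1F
    5F (split 2F 3F (split 2F 5F (win 4) (win 4)) (split 3F 4F (split 2F 5F (win 4) (win 4))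
    (split 2F 5F (split 2F 6F (win 5) (split 0F 1F (win 10) (split 4F 5F (win 0) exceptional)))
    (split 0F 1F (win 10) (split 4F 6F (win 0) exceptional))))) (split 2F 6F (win 7) (split 0F 1F
    (win 10) (split 0F 2F (win 0) (split 3F 4F (win 9) exceptional)))))) (split 2F 6F (split 1F 5F
    (split 3F 6F (split 2F 5F (win 12) (split 5F 6F (win 12) (split 0F 1F (win 24) (split 0F 2F
    (win 0) (split 3F 4F (win 1) exceptional))))) (split 2F 3F (win 6) (split 0F 1F (win 24)
    (split 0F 2F (win 2) (split 4F 5F (win 3) exceptional))))) (split 2F 5F (split 3F 4F (win 20)
    (split 4F 5F (win 7) (split 0F 2F (win 14) (split 3F 6F (win 2) exceptional)))) (win 7)))
    (split 4F 5F (win 22) (split 1F 5F (win 22) (win 2))))) (split 2F 5F (split 1F 5F (split 3F 6F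
    (split 5F 6F (split 2F 6F (win 29) (split 4F 6F (win 13) (split 2F 3F (win 5) (split 0F 1F
    (win 16) (split 4F 5F (win 0) exceptional))))) (split 2F 6F (win 7) (split 2F 3F (win 6) (win
    11)))) (split 1F 6F (win 9) (win 1))) (split 0F 2F (split 1F 2F (split 1F 6F (win 11) (split
    3F 6F (win 25) (win 3))) (split 2F 3F (win 8) (win 11))) (split 2F 3F (split 1F 6F (win 18)
    (split 3F 4F (win 27) (split 4F 6F (win 0) exceptional))) (split 0F 1F (win 0) (split 4F 6F
    (win 3) exceptional))))) (split 3F 6F (split 2F 6F (win 7) (split 3F 4F (win 0) (split 0F 1F
    (win 8) (split 4F 6F (win 0) exceptional)))) (split 2F 6F (win 1) (win 3))))) (split 1F 2F
    (split 1F 5F (split 3F 6F (split 5F 6F (split 4F 5F (split 4F 6F (win 3) (split 0F 1F (win 0)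
    (split 0F 2F (win 0) (split 3F 5F (win 4) (split 2F 6F (win 1) exceptional))))) (win 23))
    (split 1F 6F (split 3F 4F (split 2F 6F (win 23) (win 17)) (split 2F 3F (win 6) (split 0F 1F
    (win 0) (split 0F 2F (win 0) exceptional)))) (split 3F 4F (win 17) (split 0F 2F (win 15)
    (split 3F 5F (win 0) exceptional))))) (split 1F 6F (split 4F 5F (split 2F 6F (split 2F 3F
    (split 4F 6F (win 6) (win 1)) (win 4)) (win 3)) (split 2F 5F (split 2F 6F (win 13) (win 13))
    (split 0F 1F (win 2) (split 0F 2F (win 2) exceptional)))) (split 4F 5F (win 3) (split 0F 2F
    (win 19) (split 3F 5F (win 2) exceptional))))) (split 3F 4F (split 4F 6F (split 5F 6F (split
    3F 5F (win 10) (win 3)) (win 2)) (split 5F 6F (split 3F 5F (win 4) (split 0F 2F (win 11)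
    (split 3F 6F (win 0) exceptional))) (win 0))) (split 3F 5F (split 3F 6F (win 10) (split 0F 2F
    (win 14) (split 5F 6F (win 3) exceptional))) (win 0)))) (split 3F 4F (split 4F 5F (split 2F 6F
    (split 2F 3F (win 1) (win 7)) (win 11)) (split 2F 5F (split 2F 3F (win 9) (win 13)) (win 16)))
    (split 2F 3F (split 2F 6F (win 6) (win 11)) (win 11))))) (split 2F 5F (split 1F 2F (split 1F
    4F (split 4F 6F (split 3F 6F (split 2F 3F (split 5F 6F (win 5) (split 2F 6F (win 5) (split 3F
    4F (win 17) (split 0F 1F (win 15) (split 3F 5F (win 0) exceptional))))) (split 3F 5F (win 5)
    (win 17))) (split 2F 6F (split 3F 5F (split 4F 5F (win 7) (split 0F 1F (win 20) (split 5F 6F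
    (split 0F 2F (win 2) (split 1F 5F (win 1) exceptional)) (split 2F 3F (win 1) exceptional))))
    (split 1F 5F (win 1) (win 3))) (split 4F 5F (win 3) (split 0F 1F (win 8) (split 3F 5F (win 2)
    exceptional))))) (split 1F 6F (split 2F 3F (win 9) (split 3F 5F (win 9) (split 0F 1F (win 15)
    (split 5F 6F (win 0) exceptional)))) (split 0F 1F (win 0) (split 0F 2F (win 0) (split 3F 5F
    (win 12) exceptional))))) (split 1F 6F (split 2F 6F (win 13) (win 9)) (split 2F 6F (win 7)
    (win 3)))) (split 1F 5F (split 1F 6F (split 5F 6F (win 31) (split 3F 6F (win 32) (split 4F 5F
    (win 28) (win 1)))) (split 4F 6F (split 4F 5F (win 7) (win 1)) (win 8))) (split 4F 5F (split
    4F 6F (win 13) (win 9)) (win 8)))) (split 5F 6F (split 1F 4F (split 1F 5F (split 3F 5F (win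
    12) (split 4F 6F (win 3) (split 0F 1F (win 8) (split 3F 6F (win 0) exceptional)))) (win 12))
    (split 1F 5F (win 1) (win 3))) (split 4F 6F (split 3F 4F (win 1) (split 0F 1F (win 14) (split
    3F 6F (win 0) exceptional))) (win 0))))) (split 1F 4F (split 2F 3F (split 1F 2F (split 1F 5F
    (split 4F 6F (split 5F 6F (split 3F 5F (split 3F 6F (win 21) (split 0F 1F (win 2) (split 0F 2F
    (win 2) (split 4F 5F (win 18) (split 2F 6F (win 1) exceptional))))) (win 6)) (split 1F 6F
    (split 3F 4F (split 2F 6F (win 6) (win 6)) (split 2F 4F (win 6) (split 0F 1F (win 0) (split 0F
    2F (win 0) exceptional)))) (split 3F 4F (win 17) (split 0F 2F (win 14) (split 4F 5F (win 0)
    exceptional))))) (split 1F 6F (split 3F 5F (split 2F 6F (split 2F 4F (split 3F 6F (win 23)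
    (win 1)) (win 18)) (win 21)) (split 2F 5F (split 2F 6F (win 5) (win 5)) (split 0F 1F (win 0)
    (split 0F 2F (win 0) exceptional)))) (split 3F 5F (win 21) (split 0F 2F (win 19) (split 4F 5F
    (win 0) exceptional))))) (split 3F 4F (split 3F 6F (split 5F 6F (split 4F 5F (win 8) (win 5))
    (win 0)) (split 5F 6F (split 4F 5F (win 8) (split 0F 2F (win 19) (split 4F 6F (win 2)
    exceptional))) (win 2))) (split 4F 5F (split 4F 6F (win 26) (split 0F 2F (win 15) (split 5F 6F
    (win 4) exceptional))) (win 2)))) (split 2F 4F (split 3F 5F (split 2F 6F (split 3F 6F (win 10)
    (win 1)) (split 3F 4F (win 30) (win 4))) (split 2F 5F (win 9) (win 16))) (split 3F 4F (split
    3F 6F (win 5) (win 12)) (win 20)))) (split 2F 5F (split 1F 2F (split 1F 6F (split 2F 6F (win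
    5) (win 9)) (split 2F 6F (win 12) (win 5))) (win 1)) (split 1F 5F (win 1) (win 4)))) (split 2F
    4F (split 4F 5F (split 4F 6F (split 2F 3F (split 3F 6F (win 6) (win 2)) (win 0)) (split 2F 6F
    (split 5F 6F (win 16) (split 0F 2F (win 15) (split 3F 5F (win 0) exceptional))) (win 0)))
    (split 2F 5F (split 5F 6F (win 16) (split 0F 2F (win 14) (split 3F 6F (win 4) exceptional)))
    (win 10))) (split 2F 3F (split 2F 6F (win 6) (win 18)) (win 1))))

  -- Only row 0 is examined. Once two nonadjacencies are known the cap forces the rest of the row,
  -- and swaps fixing 0 move them to the positions 1 and 2 that `base7` leaves open.
  root7 : Tree 7
  root7 =
    split 0F 1F (split 0F 2F (split 0F 3F (split 0F 4F (split 0F 5F (split 0F 6F (relabel (0F ∷ 1F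
    ∷ 2F ∷ 3F ∷ 4F ∷ 5F ∷ 6F ∷ [])) (relabel (0F ∷ 6F ∷ 2F ∷ 3F ∷ 4F ∷ 5F ∷ 1F ∷ []))) (split 0F
    6F (relabel (0F ∷ 5F ∷ 2F ∷ 3F ∷ 4F ∷ 1F ∷ 6F ∷ [])) (relabel (0F ∷ 5F ∷ 6F ∷ 3F ∷ 4F ∷ 1F ∷
    2F ∷ [])))) (split 0F 5F (split 0F 6F (relabel (0F ∷ 4F ∷ 2F ∷ 3F ∷ 1F ∷ 5F ∷ 6F ∷ []))
    (relabel (0F ∷ 4F ∷ 6F ∷ 3F ∷ 1F ∷ 5F ∷ 2F ∷ []))) (relabel (0F ∷ 4F ∷ 5F ∷ 3F ∷ 1F ∷ 2F ∷ 6F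
    ∷ [])))) (split 0F 4F (split 0F 5F (split 0F 6F (relabel (0F ∷ 3F ∷ 2F ∷ 1F ∷ 4F ∷ 5F ∷ 6F ∷
    [])) (relabel (0F ∷ 3F ∷ 6F ∷ 1F ∷ 4F ∷ 5F ∷ 2F ∷ []))) (relabel (0F ∷ 3F ∷ 5F ∷ 1F ∷ 4F ∷ 2F
    ∷ 6F ∷ []))) (relabel (0F ∷ 3F ∷ 4F ∷ 1F ∷ 2F ∷ 5F ∷ 6F ∷ [])))) (split 0F 3F (split 0F 4F
    (split 0F 5F (split 0F 6F (relabel (0F ∷ 1F ∷ 2F ∷ 3F ∷ 4F ∷ 5F ∷ 6F ∷ [])) (relabel (0F ∷ 6F
    ∷ 2F ∷ 3F ∷ 4F ∷ 5F ∷ 1F ∷ []))) (relabel (0F ∷ 5F ∷ 2F ∷ 3F ∷ 4F ∷ 1F ∷ 6F ∷ []))) (relabel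
    (0F ∷ 4F ∷ 2F ∷ 3F ∷ 1F ∷ 5F ∷ 6F ∷ []))) (relabel (0F ∷ 3F ∷ 2F ∷ 1F ∷ 4F ∷ 5F ∷ 6F ∷ []))))
    (split 0F 2F (split 0F 3F (split 0F 4F (split 0F 5F (split 0F 6F (relabel (0F ∷ 1F ∷ 2F ∷ 3F ∷
    4F ∷ 5F ∷ 6F ∷ [])) (relabel (0F ∷ 1F ∷ 6F ∷ 3F ∷ 4F ∷ 5F ∷ 2F ∷ []))) (relabel (0F ∷ 1F ∷ 5F
    ∷ 3F ∷ 4F ∷ 2F ∷ 6F ∷ []))) (relabel (0F ∷ 1F ∷ 4F ∷ 3F ∷ 2F ∷ 5F ∷ 6F ∷ []))) (relabel (0F ∷
    1F ∷ 3F ∷ 2F ∷ 4F ∷ 5F ∷ 6F ∷ []))) (relabel (0F ∷ 1F ∷ 2F ∷ 3F ∷ 4F ∷ 5F ∷ 6F ∷ [])))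

  outcome₅ : (G : Graph 5) → Check.Capped 1 clusterings5 G → Outcome G
  outcome₅ G capped = Check.check-sound 1 clusterings5 tree5 {loopless} {nothing}
      -- The underscore is the run of the checker: its type reduces to the unit type by evaluation.
      (λ ()) _ G capped (loopless-consistent G)

  outcome₆ : (G : Graph 6) → Check.Capped 2 clusterings6 G → Outcome G
  outcome₆ G capped = Check.check-sound 2 clusterings6 tree6 {loopless} {nothing}
      (λ ()) _ G capped (loopless-consistent G)

  -- Up to relabelling, the only possible nonneighbours of the vertex 0 are 1 and 2.
  base7 : Knowledge 7
  base7 = (just false ∷ nothing ∷ nothing ∷ just true ∷ just true ∷ just true ∷ just true ∷ []) ∷
    Vec.tail loopless

  outcome₇ : (G : Graph 7) → Check.Capped 3 clusterings7 G → Outcome G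
  outcome₇ G capped = Check.check-sound 3 clusterings7 root7 {loopless} {just base7}
    (λ { refl → Check.check-sound 3 clusterings7 tree7 {base7} {nothing} (λ ()) _ })
    _ G capped (loopless-consistent G)

  -- Contracting an edge

  degreeOf : Graph n → Fin n → ℕ
  degreeOf G x = count (Graph._~?_ G x)

  common : Graph n → Fin n → Fin n → ℕ
  common G x y = count λ z → (Graph._~?_ G x z) ×-dec (Graph._~?_ G y z)

  -- Twice the number of edges, which spares counting unordered pairs.
  degreeSum : Graph n → ℕ
  degreeSum G = sum (degreeOf G)

  -- The merged vertex keeps the label u, and v becomes isolated.
  contract : Graph n → Fin n → Fin n → Graph n
  contract G u v = record
    { _~_      = λ x y → x ≢ v × y ≢ v × x ≢ y × (x ~ y ⊎ (x ≡ u × v ~ y) ⊎ (y ≡ u × x ~ v))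
    ; _~?_     = λ x y → ¬? (x Fin.≟ v) ×-dec ¬? (y Fin.≟ v) ×-dec ¬? (x Fin.≟ y) ×-dec
                   ((x ~? y) ⊎-dec ((x Fin.≟ u) ×-dec (v ~? y)) ⊎-dec ((y Fin.≟ u) ×-dec (x ~? v)))
    ; ~-sym    = λ (x≢v , y≢v , x≢y , e) → y≢v , x≢v , x≢y ∘ sym , flip e
    ; ~-irrefl = λ x≡y (_ , _ , x≢y , _) → x≢y x≡y
    }
    where
    open Graph G
    flip : ∀ {x y} → x ~ y ⊎ (x ≡ u × v ~ y) ⊎ (y ≡ u × x ~ v) →
           y ~ x ⊎ (y ≡ u × v ~ x) ⊎ (x ≡ u × y ~ v)
    flip (inj₁ e)                 = inj₁ (~-sym e)
    flip (inj₂ (inj₁ (x≡u , e))) = inj₂ (inj₂ (x≡u , ~-sym e))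
    flip (inj₂ (inj₂ (y≡u , e))) = inj₂ (inj₁ (y≡u , ~-sym e))

  module _ (G : Graph n) {u v : Fin n} (u~v : Adjacent G u v) where
    open Graph G
    private
      G′ = contract G u v
      open Graph G′ using () renaming (_~_ to _~′_; _~?_ to _~?′_)

      u≢v : u ≢ v
      u≢v u≡v = ~-irrefl u≡v u~v

      ρ : Fin n → Fin n
      ρ x with x Fin.≟ v
      ... | yes _ = u
      ... | no  _ = x

      ρ-v : ρ v ≡ u
      ρ-v with v Fin.≟ v
      ... | yes _   = refl
      ... | no v≢v = contradiction refl v≢v

      ρ-other : ∀ {x} → x ≢ v → ρ x ≡ x
      ρ-other {x} x≢v with x Fin.≟ v
      ... | yes x≡v = contradiction x≡v x≢v
      ... | no  _   = refl

    contract-model : Model r (contract G u v) → Model r G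
    contract-model = quotient-model ρ lifts fibre
      where
      lifts : ∀ {x y} → x ~′ y → ∃₂ λ x′ y′ → ρ x′ ≡ x × ρ y′ ≡ y × x′ ~ y′
      lifts (x≢v , y≢v , _ , inj₁ x~y) = _ , _ , ρ-other x≢v , ρ-other y≢v , x~y
      lifts (x≢v , y≢v , _ , inj₂ (inj₁ (refl , v~y))) = _ , _ , ρ-v , ρ-other y≢v , v~y
      lifts (x≢v , y≢v , _ , inj₂ (inj₂ (refl , x~v))) = _ , _ , ρ-other x≢v , ρ-v , x~v
      ρu≡ρv : ρ u ≡ ρ v
      ρu≡ρv = trans (ρ-other u≢v) (sym ρ-v)
      fibre : ∀ {x y} → ρ x ≡ ρ y → Star (λ a b → a ~ b × ρ a ≡ ρ b) x y
      fibre {x} {y} eq with x Fin.≟ v | y Fin.≟ v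
      ... | yes refl | yes refl = ε
      ... | yes refl | no _ with refl ← eq = (~-sym u~v , sym ρu≡ρv) ◅ ε
      ... | no _ | yes refl with refl ← eq = (u~v , ρu≡ρv) ◅ ε
      ... | no _ | no _ with refl ← eq = ε

    private
      δ : Fin n → Fin n → ℕ
      δ a x = 𝟏 (x Fin.≟ a)

      common-row : ∀ x → ℕ
      common-row x = 𝟏 ((u ~? x) ×-dec (v ~? x))

      -- Inclusion and exclusion for the two neighbourhoods; their union contains u and v
      -- themselves, which are not neighbours of the merged vertex, hence the 2.
      degree-u : degreeOf G u + degreeOf G v ≤ degreeOf G′ u + (common G u v + 2)
      degree-u = begin
        degreeOf G u + degreeOf G v          ≡⟨ count-∪∩ (u ~?_) (v ~?_) ⟩
        count (λ x → (u ~? x) ⊎-dec (v ~? x)) + common G u v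
          ≤⟨ ℕ.+-monoˡ-≤ (common G u v) (ℕ.≤-trans
               (count-insert (λ x → (u ~? x) ⊎-dec (v ~? x))
                 (λ x → ((u ~? x) ⊎-dec (v ~? x)) ×-dec ¬? (x Fin.≟ v)) {v} _,_)
               (s≤s (count-insert (λ x → ((u ~? x) ⊎-dec (v ~? x)) ×-dec ¬? (x Fin.≟ v))
                 (u ~?′_) {u} into))) ⟩
        2 + degreeOf G′ u + common G u v
          ≡⟨ solve 2 (λ d c → con 2 :+ d :+ c := d :+ (c :+ con 2)) refl (degreeOf G′ u) (common G u v) ⟩
        degreeOf G′ u + (common G u v + 2)   ∎
        where
        into : ∀ {x} → (u ~ x ⊎ v ~ x) × x ≢ v → x ≢ u → u ~′ x
        into (inj₁ u~x , x≢v) x≢u = u≢v , x≢v , x≢u ∘ sym , inj₁ u~x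
        into (inj₂ v~x , x≢v) x≢u = u≢v , x≢v , x≢u ∘ sym , inj₂ (inj₁ (refl , v~x))

      -- Only a common neighbour loses a neighbour. If x is adjacent to v but not to u, then ρ
      -- replaces v by u injectively.
      degree-other : ∀ {x} → x ≢ u → x ≢ v → degreeOf G x ≤ degreeOf G′ x + common-row x
      degree-other {x} x≢u x≢v with v ~? x
      degree-other {x} x≢u x≢v | no v≁x = ℕ.≤-trans
        (count-⊆ (x ~?_) (x ~?′_) λ x~y → x≢v , (λ { refl → v≁x (~-sym x~y) }) ,
          (λ x≡y → ~-irrefl x≡y x~y) , inj₁ x~y)
        (ℕ.m≤m+n _ _)
      degree-other {x} x≢u x≢v | yes v~x with u ~? x
      ... | yes u~x = ℕ.≤-trans
        (count-insert (x ~?_) (x ~?′_) {v} λ x~y y≢v → x≢v , y≢v , (λ x≡y → ~-irrefl x≡y x~y) , inj₁ x~y)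
        (ℕ.≤-reflexive (ℕ.+-comm 1 _))
      ... | no  u≁x = ℕ.≤-trans
        (count-≤ (x ~?_) (x ~?′_) (λ {y} _ → ρ y) into injective)
        (ℕ.m≤m+n _ _)
        where
        into : ∀ {y} → x ~ y → x ~′ ρ y
        into {y} x~y with y Fin.≟ v
        ... | yes refl = x≢v , u≢v , x≢u , inj₂ (inj₂ (refl , x~y))
        ... | no  y≢v  = x≢v , y≢v , (λ x≡y → ~-irrefl x≡y x~y) , inj₁ x~y
        injective : ∀ {y z} → x ~ y → x ~ z → ρ y ≡ ρ z → y ≡ z
        injective {y} {z} x~y x~z eq with y Fin.≟ v | z Fin.≟ v
        ... | yes refl | yes refl = refl
        ... | yes _ | no _ with refl ← eq = contradiction (~-sym x~z) u≁x
        ... | no _ | yes _ with refl ← eq = contradiction (~-sym x~y) u≁x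
        ... | no _ | no _ = eq

      -- The degree lost at the isolated v is charged to u: the terms with δ let the estimate be
      -- summed vertex by vertex, and `degreeOf G v` cancels afterwards.
      pointwise : ∀ x → degreeOf G x + δ u x * degreeOf G v ≤
                  degreeOf G′ x + common-row x + (δ u x * (common G u v + 2) + δ v x * degreeOf G v)
      pointwise x = cases (x Fin.≟ u) (x Fin.≟ v)
        where
        c = common G u v + 2
        cases : Dec (x ≡ u) → Dec (x ≡ v) → degreeOf G x + δ u x * degreeOf G v ≤
                degreeOf G′ x + common-row x + (δ u x * c + δ v x * degreeOf G v)
        cases (yes refl) (yes u≡v) = contradiction u≡v u≢v
        cases (yes refl) (no _) = begin
          degreeOf G u + δ u u * degreeOf G v ≡⟨ cong (λ k → degreeOf G u + k * degreeOf G v)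
              (𝟏-yes (u Fin.≟ u) refl) ⟩
          degreeOf G u + 1 * degreeOf G v        ≡⟨ cong (degreeOf G u +_) (ℕ.*-identityˡ _) ⟩
          degreeOf G u + degreeOf G v            ≤⟨ degree-u ⟩
          degreeOf G′ u + c ≤⟨ ℕ.+-mono-≤ (ℕ.m≤m+n (degreeOf G′ u) (common-row u))
              (ℕ.≤-reflexive (sym (ℕ.*-identityˡ c))) ⟩
          degreeOf G′ u + common-row u + 1 * c ≡⟨ cong (λ k → degreeOf G′ u + common-row u + k * c)
              (𝟏-yes (u Fin.≟ u) refl) ⟨
          degreeOf G′ u + common-row u + δ u u * c
              ≤⟨ ℕ.+-monoʳ-≤ (degreeOf G′ u + common-row u) (ℕ.m≤m+n (δ u u * c) _) ⟩
          degreeOf G′ u + common-row u + (δ u u * c + δ v u * degreeOf G v) ∎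
        cases (no v≢u) (yes refl) = begin
          degreeOf G v + δ u v * degreeOf G v ≡⟨ cong (λ k → degreeOf G v + k * degreeOf G v)
              (𝟏-no (v Fin.≟ u) v≢u) ⟩
          degreeOf G v + 0                       ≡⟨ ℕ.+-comm (degreeOf G v) 0 ⟩
          degreeOf G v                           ≡⟨ ℕ.*-identityˡ _ ⟨
          1 * degreeOf G v                       ≡⟨ cong (_* degreeOf G v) (𝟏-yes (v Fin.≟ v) refl) ⟨
          δ v v * degreeOf G v                   ≤⟨ ℕ.m≤n+m _ (degreeOf G′ v + common-row v + δ u v * c) ⟩
          degreeOf G′ v + common-row v + δ u v * c + δ v v * degreeOf G v
            ≡⟨ ℕ.+-assoc (degreeOf G′ v + common-row v) _ _ ⟩
          degreeOf G′ v + common-row v + (δ u v * c + δ v v * degreeOf G v) ∎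
        cases (no x≢u) (no x≢v) = begin
          degreeOf G x + δ u x * degreeOf G v ≡⟨ cong (λ k → degreeOf G x + k * degreeOf G v)
              (𝟏-no (x Fin.≟ u) x≢u) ⟩
          degreeOf G x + 0                       ≡⟨ ℕ.+-identityʳ _ ⟩
          degreeOf G x                           ≤⟨ degree-other x≢u x≢v ⟩
          degreeOf G′ x + common-row x           ≤⟨ ℕ.m≤m+n _ _ ⟩
          degreeOf G′ x + common-row x + (δ u x * c + δ v x * degreeOf G v) ∎

    -- The edges lost are u v itself and one of the two edges to each common neighbour.
    contract-degreeSum : degreeSum G ≤ degreeSum (contract G u v) + (2 * common G u v + 2)
    contract-degreeSum = ℕ.+-cancelʳ-≤ (degreeOf G v) _ _ (begin
      degreeSum G + degreeOf G v
        ≡⟨ cong (degreeSum G +_) (sum-δ u (degreeOf G v)) ⟨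
      degreeSum G + sum (λ x → δ u x * degreeOf G v)
        ≡⟨ ∑-distrib-+ (degreeOf G) _ ⟨
      sum (λ x → degreeOf G x + δ u x * degreeOf G v)
        ≤⟨ sum-mono pointwise ⟩
      sum (λ x → degreeOf G′ x + common-row x + (δ u x * (c + 2) + δ v x * degreeOf G v))
        ≡⟨ trans (∑-distrib-+ (λ x → degreeOf G′ x + common-row x) _)
             (cong₂ _+_ (∑-distrib-+ (degreeOf G′) common-row) (∑-distrib-+ (λ x → δ u x * (c + 2)) _)) ⟩
      degreeSum G′ + c + (sum (λ x → δ u x * (c + 2)) + sum (λ x → δ v x * degreeOf G v))
        ≡⟨ cong (degreeSum G′ + c +_) (cong₂ _+_ (sum-δ u (c + 2)) (sum-δ v (degreeOf G v))) ⟩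
      degreeSum G′ + c + (c + 2 + degreeOf G v)
        ≡⟨ solve 3 (λ s c d → s :+ c :+ (c :+ con 2 :+ d) := s :+ (con 2 :* c :+ con 2) :+ d)
             refl (degreeSum G′) c (degreeOf G v) ⟩
      degreeSum G′ + (2 * c + 2) + degreeOf G v ∎)
      where
      c = common G u v

  -- Vertices of degree at most seven

  -- The apex u is the additional branch set; it is adjacent to every branch set of the link because
  -- 2 ≤ r makes these nonempty.
  cone-model : (G : Graph n) (u : Fin n) (ι : Fin m → Fin n) → (∀ {i j} → ι i ≡ ι j → i ≡ j) →
               (∀ i → Adjacent G u (ι i)) → 2 ≤ r → Model r (pullback ι G) → Model (suc r) G
  cone-model {n} {m} {r} G u ι ι-inj u~ι 2≤r M = record
    { branch = branch′ ; connected = connected′ ; joined = joined′ }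
    where
    open Graph G
    open Model M
    branch′ : Fin n → Maybe (Fin (suc r))
    branch′ x with x Fin.≟ u | Fin.any? (λ i → ι i Fin.≟ x)
    ... | yes _ | _           = just zero
    ... | no _  | yes (i , _) = Maybe.map suc (branch i)
    ... | no _  | no _        = nothing
    branch-u : branch′ u ≡ just zero
    branch-u with u Fin.≟ u
    ... | yes _   = refl
    ... | no u≢u = contradiction refl u≢u
    branch-ι : ∀ i → branch′ (ι i) ≡ Maybe.map suc (branch i)
    branch-ι i with ι i Fin.≟ u | Fin.any? (λ j → ι j Fin.≟ ι i)
    ... | yes eq | _ = contradiction (u~ι i) (~-irrefl (sym eq))
    ... | no _ | yes (j , eq) = cong (Maybe.map suc ∘ branch) (ι-inj eq)
    ... | no _ | no none = contradiction (i , refl) none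
    data View (x : Fin n) : Fin (suc r) → Set where
      apex : x ≡ u → View x zero
      base : ∀ {c} i → ι i ≡ x → branch i ≡ just c → View x (suc c)
    view : ∀ {x c} → branch′ x ≡ just c → View x c
    view {x} eq with x Fin.≟ u | Fin.any? (λ i → ι i Fin.≟ x)
    view refl | yes x≡u | _ = apex x≡u
    view eq   | no _ | yes (i , ιi≡x) with branch i in bi
    view refl | no _ | yes (i , ιi≡x) | just c = base i ιi≡x bi
    up : ∀ {i c} → branch i ≡ just c → branch′ (ι i) ≡ just (suc c)
    up {i} bi = trans (branch-ι i) (cong (Maybe.map suc) bi)
    lift : ∀ {c i j} → Star (λ a b → ι a ~ ι b × branch b ≡ just c) i j →
           Star (λ a b → a ~ b × branch′ b ≡ just (suc c)) (ι i) (ι j)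
    lift ε = ε
    lift ((e , b) ◅ s) = (e , up b) ◅ lift s
    connected′ : ∀ {c x y} → branch′ x ≡ just c → branch′ y ≡ just c →
                 Star (λ a b → a ~ b × branch′ b ≡ just c) x y
    connected′ {x = x} {y} bx by with view {x} bx | view {y} by
    ... | apex refl | apex refl = ε
    ... | base i refl bi | base j refl bj = lift (connected bi bj)
    nonempty : (c : Fin r) → ∃ λ i → branch i ≡ just c
    nonempty c with other 2≤r c
    ... | d , c≢d = let i , _ , bi , _ = joined c≢d in i , bi
    joined′ : ∀ {c d} → c ≢ d → ∃₂ λ x y → branch′ x ≡ just c × branch′ y ≡ just d × x ~ y
    joined′ {zero}  {zero}  c≢d = contradiction refl c≢d
    joined′ {zero}  {suc d} _ = let i , bi = nonempty d in u , ι i , branch-u , up bi , u~ι i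
    joined′ {suc c} {zero}  _ = let i , bi = nonempty c in ι i , u , up bi , branch-u , ~-sym (u~ι i)
    joined′ {suc c} {suc d} c≢d = let i , j , bi , bj , e = joined (c≢d ∘ cong suc) in
      ι i , ι j , up bi , up bj , e

  -- A vertex of degree at least 4 has at most m - 4 nonneighbours including itself, which is the
  -- cap of the certificates.
  link-outcome : 5 ≤ m → m ≤ 7 → (L : Graph m) → (∀ x → 4 ≤ degreeOf L x) → Outcome L
  link-outcome {m} 5≤m m≤7 L deg = cases m 5≤m m≤7 L (λ x → ℕ.+-cancelˡ-≤ 4 _ _ (begin
    4 + count (λ y → ¬? (Graph._~?_ L x y))           ≤⟨ ℕ.+-monoˡ-≤ _ (deg x) ⟩
    degreeOf L x + count (λ y → ¬? (Graph._~?_ L x y)) ≡⟨ count-complement (Graph._~?_ L x) ⟩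
    m                                                 ≡⟨ ℕ.m+[n∸m]≡n (ℕ.≤-trans (ℕ.n≤1+n 4) 5≤m) ⟨
    4 + (m ∸ 4) ∎))
    where
    cases : ∀ m → 5 ≤ m → m ≤ 7 → (L : Graph m) →
            (∀ x → count (λ y → ¬? (Graph._~?_ L x y)) ≤ m ∸ 4) → Outcome L
    cases 5 _ _ L = outcome₅ L
    cases 6 _ _ L = outcome₆ L
    cases 7 _ _ L = outcome₇ L
    cases 0 () _
    cases 1 (s≤s ()) _
    cases 2 (s≤s (s≤s ())) _
    cases 3 (s≤s (s≤s (s≤s ()))) _
    cases 4 (s≤s (s≤s (s≤s (s≤s ())))) _
    cases (suc (suc (suc (suc (suc (suc (suc (suc _)))))))) _
      (s≤s (s≤s (s≤s (s≤s (s≤s (s≤s (s≤s ())))))))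

  -- Components, and pieces cut off along a clique

  record Component (G : Graph n) (R : Pred (Fin n) 0ℓ) (w : Fin n) : Set₁ where
    open Graph G
    field
      member     : Pred (Fin n) 0ℓ
      member?    : Decidable member
      root       : member w
      inside     : ∀ {x} → member x → R x
      closed     : ∀ {x y} → member x → x ~ y → R y → member y
      reach      : ∀ {x} → member x → Star (λ a b → a ~ b × member b) w x

  -- Vertices of R adjacent to the set reached so far are added until there are none; each addition
  -- lowers the number of vertices outside, which `fuel` bounds.
  component : (G : Graph n) {R : Pred (Fin n) 0ℓ} → Decidable R → ∀ {w} → R w → Component G R w
  component {n} G {R} R? {w} Rw =
    grow (suc (count (λ x → ¬? (x Fin.≟ w)))) (Fin._≟ w) refl (λ { refl → Rw }) (λ { refl → ε }) ℕ.≤-refl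
    where
    open Graph G
    grow : ∀ fuel {C : Pred (Fin n) 0ℓ} (C? : Decidable C) → C w → (∀ {x} → C x → R x) →
           (∀ {x} → C x → Star (λ a b → a ~ b × C b) w x) → count (¬? ∘ C?) < fuel → Component G R w
    grow (suc fuel) {C} C? Cw C⊆R reach (s≤s bound)
      with Fin.any? (λ x → Fin.any? λ y → C? x ×-dec (x ~? y) ×-dec R? y ×-dec ¬? (C? y))
    ... | no none = record
      { member = C ; member? = C? ; root = Cw ; inside = C⊆R ; reach = reach
      ; closed = λ {x} {y} Cx x~y Ry →
          decidable-stable (C? y) λ ¬Cy → none (x , y , Cx , x~y , Ry , ¬Cy)
      }
    ... | yes (x , y , Cx , x~y , Ry , ¬Cy) =
      grow fuel {λ z → C z ⊎ z ≡ y} (λ z → C? z ⊎-dec (z Fin.≟ y)) (inj₁ Cw)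
        (λ { (inj₁ Cz) → C⊆R Cz ; (inj₂ refl) → Ry })
        (λ { (inj₁ Cz) → wider (reach Cz) ; (inj₂ refl) → wider (reach Cx) ◅◅ (x~y , inj₂ refl) ◅ ε })
        (ℕ.<-≤-trans (count-⊂ (λ z → ¬? (C? z ⊎-dec (z Fin.≟ y))) (¬? ∘ C?) (_∘ inj₁) ¬Cy
            (λ ¬C → ¬C (inj₂ refl)))
          bound)
      where
      wider : ∀ {a b} → Star (λ a b → a ~ b × C b) a b → Star (λ a b → a ~ b × (C b ⊎ b ≡ y)) a b
      wider ε = ε
      wider ((e , Cb) ◅ s) = (e , inj₁ Cb) ◅ wider s

  module _ {G : Graph n} {R : Pred (Fin n) 0ℓ} {w : Fin n} (K : Component G R w) where
    open Graph G
    open Component K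

    reverse : ∀ {x y} → member x → Star (λ a b → a ~ b × member b) x y → Star (λ a b → a ~ b × member b) y x
    reverse Cx ε = ε
    reverse Cx ((e , Ca) ◅ s) = reverse Ca s ◅◅ (~-sym e , Cx) ◅ ε

    between : ∀ {x y} → member x → member y → Star (λ a b → a ~ b × member b) x y
    between Cx Cy = reverse root (reach Cx) ◅◅ reach Cy

  component-sym : {G : Graph n} {R : Pred (Fin n) 0ℓ} {w q : Fin n}
                  (K : Component G R w) (L : Component G R q) → Component.member K q → Component.member L w
  component-sym {G = G} K L q∈K = go (Component.root L) (reverse K (Component.root K) (Component.reach K q∈K))
    where
    go : ∀ {a b} → Component.member L a → Star (λ a b → Adjacent G a b × Component.member K b) a b →
         Component.member L b
    go La ε = La
    go La ((e , Kb) ◅ s) = go (Component.closed L La e (Component.inside K Kb)) s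

  -- Edges inside Q are exempt because their triangles may have used vertices on the other side of
  -- the clique, which were cut off.
  record Dense (G : Graph n) (Q : Pred (Fin n) 0ℓ) : Set where
    open Graph G
    field
      clique    : ∀ {x y} → Q x → Q y → x ≢ y → x ~ y
      triangles : ∀ {x y} → x ~ y → ¬ (Q x × Q y) → 4 ≤ common G x y

  -- Q is the clique along which the piece has been cut off from a larger graph.
  PieceClaim : ℕ → ℕ → Set₁
  PieceClaim n a = (G : Graph n) {A Q : Pred (Fin n) 0ℓ} (A? : Decidable A) (Q? : Decidable Q) →
    count A? ≤ a → (∀ {x y} → Adjacent G x y → A x) → count Q? ≤ 3 → Dense G Q →
    ∀ {x y} → Adjacent G x y → ¬ (Q x × Q y) → Model 6 G

  module _ (G : Graph n) {A Q : Pred (Fin n) 0ℓ} (A? : Decidable A) (Q? : Decidable Q)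
           (alive : ∀ {x y} → Adjacent G x y → A x) (dense : Dense G Q)
           (smaller : ∀ {a} → a < count A? → PieceClaim n a)
           {u : Fin n} (u∉Q : ¬ Q u) where
    open Graph G
    open Dense dense

    private
      u≁u : ¬ u ~ u
      u≁u = ~-irrefl refl

      open Enumeration (enumerate (u ~?_))
        renaming (elem to ι; injective to ι-injective; sound to u~ι; index to ι-index)

      d = degreeOf G u

      L = pullback ι G

      -- The degree in the link counts the common neighbours with u, and an edge at u does not lie
      -- inside Q.
      link-degree : ∀ i → 4 ≤ degreeOf L i
      link-degree i = ℕ.≤-trans (triangles (u~ι i) (u∉Q ∘ proj₁))
        (count-≤ (λ z → (u ~? z) ×-dec (ι i ~? z)) (λ j → ι i ~? ι j) (λ (u~z , _) → proj₁ (ι-index u~z))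
          (λ (u~z , e) → subst (ι i ~_) (sym (proj₂ (ι-index u~z))) e)
          (λ (p , _) (q , _) eq → trans (sym (proj₂ (ι-index p))) (trans (cong ι eq) (proj₂ (ι-index q)))))

      R : Pred (Fin n) 0ℓ
      R x = ¬ u ~ x × u ≢ x × A x
      R? : Decidable R
      R? x = ¬? (u ~? x) ×-dec ¬? (u Fin.≟ x) ×-dec A? x

      module Exc (5≤d : 5 ≤ d) (d≤7 : d ≤ 7) (e : Exceptional (adjacency L)) where
        open Exceptional e

        Touches : Pred (Fin n) 0ℓ → Fin n → Set
        Touches C z = ∃ λ x → C x × z ~ x

        touches? : ∀ {C} → Decidable C → ∀ z → Dec (Touches C z)
        touches? C? z = Fin.any? λ x → C? x ×-dec (z ~? x)

        -- Contracting the component into ι i creates the missing edge of the link, which then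
        -- lies in too many triangles of the link for the latter to stay exceptional.
        shortcut : ∀ {w} (K : Component G R w) → let open Component K in
                   ∀ {i j} → i ≢ j → ¬ ι i ~ ι j → Touches member (ι i) → Touches member (ι j) → Model 6 G
        shortcut K {i} {j} i≢j i≁j (x , Cx , i~x) (y , Cy , j~y) = quotient-model ρ lifts fibre model
          where
          open Component K
          ι∉ : ∀ k → ¬ member (ι k)
          ι∉ k m = proj₁ (inside m) (u~ι k)
          u∉ : ¬ member u
          u∉ m = proj₁ (proj₂ (inside m)) refl
          H : Graph n
          H = record
            { _~_      = λ x y → (x ~ y × ¬ member x × ¬ member y) ⊎
                           (x ≡ ι i × y ≡ ι j) ⊎ (x ≡ ι j × y ≡ ι i)
            ; _~?_     = λ x y → ((x ~? y) ×-dec ¬? (member? x) ×-dec ¬? (member? y)) ⊎-dec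
                           ((x Fin.≟ ι i) ×-dec (y Fin.≟ ι j)) ⊎-dec ((x Fin.≟ ι j) ×-dec (y Fin.≟ ι i))
            ; ~-sym    = λ { (inj₁ (e , p , q)) → inj₁ (~-sym e , q , p)
                           ; (inj₂ (inj₁ (p , q))) → inj₂ (inj₂ (q , p))
                           ; (inj₂ (inj₂ (p , q))) → inj₂ (inj₁ (q , p)) }
            ; ~-irrefl = λ { refl (inj₁ (e , _)) → ~-irrefl refl e
                           ; refl (inj₂ (inj₁ (p , q))) → i≢j (ι-injective (trans (sym p) q))
                           ; refl (inj₂ (inj₂ (p , q))) → i≢j (ι-injective (trans (sym q) p)) }
            }
          open Graph H using () renaming (_~_ to _~ʰ_; _~?_ to _~ʰ?_)
          L⁺ = pullback ι H
          keep : ∀ {k l} → ι k ~ ι l → ι k ~ʰ ι l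
          keep e = inj₁ (e , ι∉ _ , ι∉ _)
          model : Model 6 H
          model with link-outcome 5≤d d≤7 L⁺ (λ k → ℕ.≤-trans (link-degree k)
                       (count-⊆ (λ l → ι k ~? ι l) (λ l → ι k ~ʰ? ι l) keep))
          ... | inj₁ M = cone-model H u ι ι-injective (λ k → inj₁ (u~ι k , u∉ , ι∉ k)) (s≤s (s≤s z≤n)) M
          ... | inj₂ e⁺ = contradiction
            (ℕ.≤-trans (nonadjacent-common i j i≢j (i≁j ∘ toWitness))
              (ℕ.≤-trans (count-⊆ (common? (adjacency L) i j) (common? (adjacency L⁺) i j)
                (λ (p , q) → fromWitness (keep (toWitness p)) , fromWitness (keep (toWitness q))))
              (Exceptional.adjacent-common e⁺ i j (fromWitness (inj₂ (inj₁ (refl , refl)))))))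
            λ { (s≤s (s≤s ())) }
          ρ : Fin n → Fin n
          ρ x with member? x
          ... | yes _ = ι i
          ... | no  _ = x
          ρ-member : ∀ {x} → member x → ρ x ≡ ι i
          ρ-member {x} m with member? x
          ... | yes _ = refl
          ... | no ¬m = contradiction m ¬m
          ρ-other : ∀ {x} → ¬ member x → ρ x ≡ x
          ρ-other {x} ¬m with member? x
          ... | yes m = contradiction m ¬m
          ... | no _  = refl
          lifts : ∀ {x y} → x ~ʰ y → ∃₂ λ x′ y′ → ρ x′ ≡ x × ρ y′ ≡ y × x′ ~ y′
          lifts (inj₁ (e , p , q)) = _ , _ , ρ-other p , ρ-other q , e
          -- The component is collapsed onto `ι i`, so its edge to `ι j` becomes the new edge.
          lifts (inj₂ (inj₁ (refl , refl))) = y , ι j , ρ-member Cy , ρ-other (ι∉ j) , ~-sym j~y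
          lifts (inj₂ (inj₂ (refl , refl))) = ι j , y , ρ-other (ι∉ j) , ρ-member Cy , j~y
          inner : ∀ {a b} → member a → Star (λ a b → a ~ b × member b) a b → Star
              (λ a b → a ~ b × ρ a ≡ ρ b) a b
          inner ma ε = ε
          inner ma ((e , mb) ◅ s) = (e , trans (ρ-member ma) (sym (ρ-member mb))) ◅ inner mb s
          ρx≡ρi : ρ x ≡ ρ (ι i)
          ρx≡ρi = trans (ρ-member Cx) (sym (ρ-other (ι∉ i)))
          fibre : ∀ {a b} → ρ a ≡ ρ b → Star (λ a b → a ~ b × ρ a ≡ ρ b) a b
          fibre {a} {b} eq with member? a | member? b
          ... | yes ma | yes mb = inner ma (between K ma mb)
          ... | yes ma | no _ with refl ← eq = inner ma (between K ma Cx) ◅◅ (~-sym i~x , ρx≡ρi) ◅ ε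
          ... | no _ | yes mb with refl ← eq = (i~x , sym ρx≡ρi) ◅ inner Cx (between K Cx mb)
          ... | no _ | no _ with refl ← eq = ε

        link-adjacent : ∀ {x y} → u ~ x → u ~ y → ∃₂ λ i j → ι i ≡ x × ι j ≡ y
        link-adjacent p q = proj₁ (ι-index p) , proj₁ (ι-index q) , proj₂ (ι-index p) , proj₂ (ι-index q)

        -- If the component K touches two nonadjacent vertices of the link, `shortcut` applies.
        -- Otherwise the link vertices it touches form a clique Q′, of size at most 3 since the
        -- exceptional link has no K₄. Every neighbour of K lies in K or Q′, so the edges with an
        -- end in K keep all their triangles, and the piece on K and Q′ is smaller because it omits
        -- u.
        descend : ∀ {w} (K : Component G R w) → let open Component K in
                  (∀ {x} → member x → ¬ Q x) → ∀ {i} → w ~ ι i → Model 6 G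
        descend {w} K C∩Q=∅ {i} w~i
          with Fin.any? (λ j → Fin.any? λ k → ¬? (j Fin.≟ k) ×-dec ¬? (ι j ~? ι k) ×-dec
                 touches? (Component.member? K) (ι j) ×-dec touches? (Component.member? K) (ι k))
        ... | yes (j , k , j≢k , j≁k , tj , tk) = shortcut K j≢k j≁k tj tk
        ... | no  none = model-⊆ {H = H} proj₁
          (smaller (count-⊂ A′? A? (λ { (_ , Ax) → Ax }) (alive (u~ι i)) u∉A′)
            H A′? Q′? ℕ.≤-refl (λ (_ , A′x , _) → A′x) Q′≤3
            (record { clique = clique′ ; triangles = triangles′ })
            {w} {ι i} (w~i , A′w , A′i) (λ (Q′w , _) → member⇒¬Q′ root Q′w))
          where
          open Component K
          Q′ : Pred (Fin n) 0ℓ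
          Q′ x = u ~ x × Touches member x
          Q′? : Decidable Q′
          Q′? x = (u ~? x) ×-dec touches? member? x
          A′ : Pred (Fin n) 0ℓ
          A′ x = (member x ⊎ Q′ x) × A x
          A′? : Decidable A′
          A′? x = (member? x ⊎-dec Q′? x) ×-dec A? x
          u∉A′ : ¬ A′ u
          u∉A′ (inj₁ m , _) = proj₁ (proj₂ (inside m)) refl
          u∉A′ (inj₂ (u~u , _) , _) = u≁u u~u
          A′w : A′ w
          A′w = inj₁ root , alive w~i
          A′i : A′ (ι i)
          A′i = inj₂ (u~ι i , w , root , ~-sym w~i) , alive (~-sym w~i)
          member⇒¬Q′ : ∀ {x} → member x → ¬ Q′ x
          member⇒¬Q′ m (u~x , _) = proj₁ (inside m) u~x
          H : Graph n
          H = record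
            { _~_      = λ x y → x ~ y × A′ x × A′ y
            ; _~?_     = λ x y → (x ~? y) ×-dec A′? x ×-dec A′? y
            ; ~-sym    = λ (e , p , q) → ~-sym e , q , p
            ; ~-irrefl = λ x≡y (e , _) → ~-irrefl x≡y e
            }
          adjacent : ∀ {j k} → j ≢ k → Q′ (ι j) → Q′ (ι k) → ι j ~ ι k
          adjacent {j} {k} j≢k (_ , tj) (_ , tk) =
            decidable-stable (ι j ~? ι k) λ j≁k → none (j , k , j≢k , j≁k , tj , tk)
          Q′⊆A : ∀ {x} → Q′ x → A x
          Q′⊆A (_ , _ , _ , e) = alive e
          clique′ : ∀ {x y} → Q′ x → Q′ y → x ≢ y → Adjacent H x y
          clique′ Q′x Q′y x≢y with link-adjacent (proj₁ Q′x) (proj₁ Q′y)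
          ... | j , k , refl , refl =
            adjacent (x≢y ∘ cong ι) Q′x Q′y , (inj₂ Q′x , Q′⊆A Q′x) , (inj₂ Q′y , Q′⊆A Q′y)
          Q′≤3 : count Q′? ≤ 3
          Q′≤3 = ℕ.≮⇒≥ λ 3<q → four 3<q (enumerate Q′?)
            where
            four : ∀ {q} → 3 < q → Enumeration q Q′ → ⊥
            four (s≤s (s≤s (s≤s (s≤s _)))) E =
              no-K₄ (k 0F) (k 1F) (a λ ()) (k 2F) (a (λ ()) , a λ ()) (k 3F) (a (λ ()) , a (λ ()) , a λ ())
              where
              open Enumeration E
              k : _ → Fin d
              k i = proj₁ (ι-index (proj₁ (sound i)))
              ιk : ∀ i → ι (k i) ≡ elem i
              ιk i = proj₂ (ι-index (proj₁ (sound i)))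
              a : ∀ {i j} → i ≢ j → T (adjacency L (k i) (k j))
              a {i} {j} i≢j = fromWitness (adjacent
                (λ eq → i≢j (injective (trans (sym (ιk i)) (trans (cong ι eq) (ιk j)))))
                (subst Q′ (sym (ιk i)) (sound i)) (subst Q′ (sym (ιk j)) (sound j)))
          neighbour : ∀ {x z} → member x → x ~ z → A′ z
          neighbour {x} {z} m x~z with u ~? z
          ... | yes u~z = inj₂ (u~z , x , m , ~-sym x~z) , alive (~-sym x~z)
          ... | no  u≁z = inj₁ (closed m x~z (u≁z , (λ { refl → proj₁ (inside m) (~-sym x~z) }) , Az)) , Az
            where Az = alive (~-sym x~z)
          triangles′ : ∀ {x y} → Adjacent H x y → ¬ (Q′ x × Q′ y) → 4 ≤ common H x y
          triangles′ {x} {y} (e , A′x@(inj₁ m , _) , A′y) _ =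
            ℕ.≤-trans (triangles e (C∩Q=∅ m ∘ proj₁))
              (count-⊆ (λ z → (x ~? z) ×-dec (y ~? z)) (λ z → Graph._~?_ H x z ×-dec Graph._~?_ H y z)
                λ (p , q) → (p , A′x , neighbour m p) , (q , A′y , neighbour m p))
          triangles′ {x} {y} (e , A′x , A′y@(inj₁ m , _)) _ =
            ℕ.≤-trans (triangles e (C∩Q=∅ m ∘ proj₂))
              (count-⊆ (λ z → (x ~? z) ×-dec (y ~? z)) (λ z → Graph._~?_ H x z ×-dec Graph._~?_ H y z)
                λ (p , q) → (p , A′x , neighbour m q) , (q , A′y , neighbour m q))
          triangles′ (_ , (inj₂ Q′x , _) , (inj₂ Q′y , _)) ¬Q′ = contradiction (Q′x , Q′y) ¬Q′

        -- What is needed to start `descend` next to `ι i`: edges at `ι i` must have their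
        -- triangles, and every component adjacent to it must avoid the old clique.
        Free : Fin d → Set₁
        Free i = ¬ Q (ι i) × (∀ {w} → ι i ~ w → R w → (K : Component G R w) → ∀ {x} → Component.member K x →
            ¬ Q x)

        -- Any vertex of the link would do.
        pole : Fin d
        pole = subst Fin (ℕ.m+[n∸m]≡n (ℕ.≤-trans (s≤s z≤n) 5≤d)) zero

        -- If the clique Q meets R at all, it meets a single component of R, that of q. Of two
        -- nonadjacent vertices of the link, either both touch it and `shortcut` applies, or one
        -- does not and is free. If Q does not meet R, a vertex fails to be free only by lying in Q,
        -- and two nonadjacent ones cannot both do so.
        free : Model 6 G ⊎ ∃ Free
        free with nonadjacent pole | Fin.any? (λ q → Q? q ×-dec R? q)
        ... | j , i≢j , i≁j | yes (q , Qq , Rq) = choose (touches? member? (ι pole)) (touches? member? (ι j))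
          where
          K = component G R? Rq
          open Component K
          untouched : ∀ {i} → ¬ Touches member (ι i) → Free i
          untouched {i} ¬t = (λ Qi → ¬t (q , root , clique Qi Qq λ { refl → proj₁ Rq (u~ι i) })) ,
            λ {w} i~w Rw K′ {x} K′x Qx → ¬t (w , component-sym K′ K (meets K′ K′x Qx) , i~w)
            where
            meets : ∀ {w} (K′ : Component G R w) {x} → Component.member K′ x → Q x → Component.member K′ q
            meets K′ {x} K′x Qx with x Fin.≟ q
            ... | yes refl = K′x
            ... | no  x≢q  = Component.closed K′ K′x (clique Qx Qq x≢q) Rq
          choose : Dec (Touches member (ι pole)) → Dec (Touches member (ι j)) → Model 6 G ⊎ ∃ Free
          choose (no ¬t)  _       = inj₂ (pole , untouched ¬t)
          choose (yes _) (no ¬t) = inj₂ (j , untouched ¬t)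
          choose (yes t) (yes t′) = inj₁ (shortcut K i≢j (i≁j ∘ fromWitness) t t′)
        ... | j , i≢j , i≁j | no none = inj₂ (choose (Q? (ι pole)) (Q? (ι j)))
          where
          choose : Dec (Q (ι pole)) → Dec (Q (ι j)) → ∃ Free
          choose (no ¬Q) _ = pole , ¬Q , λ _ _ K m Qx → none (_ , Qx , Component.inside K m)
          choose _ (no ¬Q) = j , ¬Q , λ _ _ K m Qx → none (_ , Qx , Component.inside K m)
          choose (yes Qi) (yes Qj) =
            contradiction (clique Qi Qj (i≢j ∘ ι-injective)) (i≁j ∘ fromWitness)

        -- The edge from a free `ι i` to `ι j` has at least 4 common neighbours, of which at most 2
        -- lie in the exceptional link and one is u. A further one lies in R, and its component is
        -- the one to descend into.
        exceptional-model : Model 6 G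
        exceptional-model with free
        ... | inj₁ M = M
        ... | inj₂ (i , i∉Q , fresh) with count-some (λ j → ι i ~? ι j) (ℕ.≤-trans (s≤s z≤n) (link-degree i))
        ...   | j , i~j with Fin.any? (λ w → ((ι i ~? w) ×-dec (ι j ~? w)) ×-dec R? w)
        ...     | yes (w , (i~w , j~w) , Rw) =
          let K = component G R? Rw in descend K (fresh i~w Rw K) (~-sym i~w)
        ...     | no none = contradiction (ℕ.≤-trans (triangles i~j (i∉Q ∘ proj₁)) few) λ { (s≤s (s≤s (s≤s ()))) }
          where
          few : common G (ι i) (ι j) ≤ 3
          few = ℕ.≤-trans
            (count-insert (λ z → (ι i ~? z) ×-dec (ι j ~? z))
                (λ z → ((ι i ~? z) ×-dec (ι j ~? z)) ×-dec (u ~? z)) {u}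
              λ {z} (p , q) z≢u → (p , q) , decidable-stable (u ~? z) λ u≁z →
                none (z , (p , q) , u≁z , (z≢u ∘ sym) , alive (~-sym p)))
            (s≤s (ℕ.≤-trans
              (count-≤ (λ z → ((ι i ~? z) ×-dec (ι j ~? z)) ×-dec (u ~? z)) (common? (adjacency L) i j)
                (λ (_ , u~z) → proj₁ (ι-index u~z))
                (λ ((p , q) , u~z) → fromWitness (subst (ι i ~_) (sym (proj₂ (ι-index u~z))) p) ,
                                     fromWitness (subst (ι j ~_) (sym (proj₂ (ι-index u~z))) q))
                (λ (_ , p) (_ , q) eq → trans (sym (proj₂ (ι-index p)))
                    (trans (cong ι eq) (proj₂ (ι-index q)))))
              (adjacent-common i j (fromWitness i~j))))

    low-degree-model : ∀ {a} → u ~ a → degreeOf G u < 8 → Model 6 G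
    low-degree-model {a} u~a (s≤s d≤7) = conclude (link-outcome 5≤d d≤7 L link-degree)
      where
      5≤d : 5 ≤ d
      -- The neighbours of u include a and the at least 4 common neighbours of u and a.
      5≤d = ℕ.≤-trans (s≤s (triangles u~a (u∉Q ∘ proj₁)))
        (count-⊂ (λ z → (u ~? z) ×-dec (a ~? z)) (u ~?_) proj₁ u~a (~-irrefl refl ∘ proj₂))
      conclude : Outcome L → Model 6 G
      conclude (inj₁ M) = cone-model G u ι ι-injective u~ι (s≤s (s≤s z≤n)) M
      conclude (inj₂ e) = Exc.exceptional-model 5≤d d≤7 e

  -- Mader's bound and its consequence for triangles

  -- In terms of the number e of edges, the last hypothesis reads e ≥ 4 ∣A∣ − 9.
  MaderClaim : ℕ → ℕ → Set₁
  MaderClaim n a = (G : Graph n) {A : Pred (Fin n) 0ℓ} (A? : Decidable A) →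
    count A? ≤ a → (∀ {x y} → Adjacent G x y → A x) → 4 ≤ count A? →
    8 * count A? ≤ degreeSum G + 18 → Model 6 G

  sum-scaled : (f : Fin n → ℕ) (k : ℕ) → sum (λ x → f x * k) ≡ sum f * k
  sum-scaled {zero}  f k = refl
  sum-scaled {suc n} f k = trans (cong (f zero * k +_) (sum-scaled (f ∘ suc) k))
      (sym (ℕ.*-distribʳ-+ k (f zero) (sum (f ∘ suc))))

  delete-edge : Graph n → Fin n → Fin n → Graph n
  delete-edge G u v = record
    { _~_      = λ x y → x ~ y × ¬ ((x ≡ u × y ≡ v) ⊎ (x ≡ v × y ≡ u))
    ; _~?_     = λ x y → (x ~? y) ×-dec ¬? (((x Fin.≟ u) ×-dec (y Fin.≟ v)) ⊎-dec ((x Fin.≟ v) ×-dec (y Fin.≟ u)))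
    ; ~-sym    = λ (e , ¬uv) → ~-sym e , λ { (inj₁ (p , q)) → ¬uv (inj₂ (q , p)) ; (inj₂ (p , q)) → ¬uv (inj₁ (q , p)) }
    ; ~-irrefl = λ x≡y (e , _) → ~-irrefl x≡y e
    } where open Graph G

  module _ (G : Graph n) {u v : Fin n} (u~v : Adjacent G u v) where
    open Graph G
    private
      H = delete-edge G u v
      open Graph H using () renaming (_~?_ to _~ʰ?_)

    delete-edge-degreeSum : degreeSum G ≤ degreeSum H + 2
    delete-edge-degreeSum = begin
      degreeSum G
        ≤⟨ sum-mono pointwise ⟩
      sum (λ x → degreeOf H x + (𝟏 (x Fin.≟ u) * 1 + 𝟏 (x Fin.≟ v) * 1))
        ≡⟨ trans (∑-distrib-+ (degreeOf H) _) (cong (degreeSum H +_)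
             (trans (∑-distrib-+ (λ x → 𝟏 (x Fin.≟ u) * 1) _) (cong₂ _+_ (sum-δ u 1) (sum-δ v 1)))) ⟩
      degreeSum H + 2 ∎
      where
      pointwise : ∀ x → degreeOf G x ≤ degreeOf H x + (𝟏 (x Fin.≟ u) * 1 + 𝟏 (x Fin.≟ v) * 1)
      pointwise x = cases (x Fin.≟ u) (x Fin.≟ v)
        where
        cases : (p : Dec (x ≡ u)) (q : Dec (x ≡ v)) → degreeOf G x ≤ degreeOf H x + (𝟏 p * 1 + 𝟏 q * 1)
        cases (yes refl) (yes refl) = contradiction u~v (~-irrefl refl)
        cases (yes refl) (no x≢v) = ℕ.≤-trans
          (count-insert (x ~?_) (x ~ʰ?_) {v} λ e y≢v → e , λ { (inj₁ (_ , y≡v)) → y≢v y≡v ; (inj₂ (x≡v , _)) → x≢v x≡v })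
          (ℕ.≤-reflexive (ℕ.+-comm 1 (degreeOf H x)))
        cases (no x≢u) (yes refl) = ℕ.≤-trans
          (count-insert (x ~?_) (x ~ʰ?_) {u} λ e y≢u → e , λ { (inj₁ (x≡u , _)) → x≢u x≡u ; (inj₂ (_ , y≡u)) → y≢u y≡u })
          (ℕ.≤-reflexive (ℕ.+-comm 1 (degreeOf H x)))
        cases (no x≢u) (no x≢v) = ℕ.≤-trans
          (count-⊆ (x ~?_) (x ~ʰ?_) λ e → e , λ { (inj₁ (x≡u , _)) → x≢u x≡u ; (inj₂ (x≡v , _)) → x≢v x≡v })
          (ℕ.m≤m+n (degreeOf H x) 0)

    delete-edge-< : degreeSum H < degreeSum G
    delete-edge-< = sum-mono-< (λ x → count-⊆ (x ~ʰ?_) (x ~?_) proj₁) u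
      (count-⊂ (u ~ʰ?_) (u ~?_) proj₁ u~v λ (_ , ¬uv) → ¬uv (inj₁ (refl , refl)))

  remove-count : {A : Pred (Fin n) 0ℓ} (A? : Decidable A) {v : Fin n} → A v →
                 count A? ≡ suc (count (λ x → A? x ×-dec ¬? (x Fin.≟ v)))
  remove-count A? {v} Av = ℕ.≤-antisym (count-insert A? (λ x → A? x ×-dec ¬? (x Fin.≟ v)) {v} _,_)
    (count-⊂ (λ x → A? x ×-dec ¬? (x Fin.≟ v)) A? proj₁ Av λ (_ , v≢v) → v≢v refl)

  -- Contracting an edge with at most 3 common neighbours lowers the degree sum by at most 8 and
  -- removes one vertex, so the bound persists. Without such an edge, edges are deleted as long as
  -- the bound can afford it, by the inner recursion on the degree sum. When it no longer can, the
  -- average degree is below 8, so some live vertex has degree less than 8; it is either isolated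
  -- and dropped, or `low-degree-model` applies with Q empty.
  mader-step : ∀ a → (∀ {b} → b < a → MaderClaim n b × PieceClaim n b) → MaderClaim n a
  mader-step {n} a ih = λ G A? → go (suc (degreeSum G)) G A? ℕ.≤-refl
    where
    go : ∀ s (G : Graph n) {A : Pred (Fin n) 0ℓ} (A? : Decidable A) → degreeSum G < s →
         count A? ≤ a → (∀ {x y} → Adjacent G x y → A x) → 4 ≤ count A? →
         8 * count A? ≤ degreeSum G + 18 → Model 6 G
    go (suc s) G {A} A? (s≤s S≤s) |A|≤a alive 4≤|A| many with ℕ.m≤n⇒m<n∨m≡n 4≤|A|
    -- Four vertices have degree sum at most 12, while the hypothesis asks for 32 - 18 = 14.
    ... | inj₂ 4≡|A| = contradiction (ℕ.≤-trans many (ℕ.+-monoˡ-≤ 18 S≤12))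
        (subst (λ k → ¬ (8 * k ≤ 30)) 4≡|A| (ℕ.<⇒≱ (ℕ.m≤m+n 31 1)))
      where
      open Graph G
      degree≤ : ∀ x → degreeOf G x ≤ 𝟏 (A? x) * 3
      degree≤ x with A? x
      ... | yes Ax = ℕ.≤-pred (subst (degreeOf G x <_) (sym 4≡|A|)
                      (count-⊂ (x ~?_) A? (alive ∘ ~-sym) Ax (~-irrefl refl)))
      ... | no ¬Ax = ℕ.≤-reflexive (count-none (x ~?_) (¬Ax ∘ alive))
      S≤12 : degreeSum G ≤ 12
      S≤12 = ℕ.≤-trans (sum-mono degree≤) (ℕ.≤-reflexive
        (trans (sum-scaled (λ x → 𝟏 (A? x)) 3) (cong (_* 3) (sym 4≡|A|))))
    ... | inj₁ 5≤|A| with Fin.any? (λ u → Fin.any? λ v → Graph._~?_ G u v ×-dec (common G u v ℕ.<? 4))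
    ...   | yes (u , v , u~v , s≤s c≤3) = contract-model G u~v
        (proj₁ (ih smaller) (contract G u v) A′? ℕ.≤-refl alive′ 4≤|A′| many′)
      where
      open Graph G
      A′? = λ x → A? x ×-dec ¬? (x Fin.≟ v)
      |A|≡ : count A? ≡ suc (count A′?)
      |A|≡ = remove-count A? (alive (~-sym u~v))
      smaller : count A′? < a
      smaller = subst (_≤ a) |A|≡ |A|≤a
      4≤|A′| : 4 ≤ count A′?
      4≤|A′| = ℕ.≤-pred (subst (5 ≤_) |A|≡ 5≤|A|)
      alive′ : ∀ {x y} → Adjacent (contract G u v) x y → A x × x ≢ v
      alive′ (x≢v , _ , _ , inj₁ e) = alive e , x≢v
      alive′ (x≢v , _ , _ , inj₂ (inj₁ (refl , _))) = alive u~v , x≢v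
      alive′ (x≢v , _ , _ , inj₂ (inj₂ (_ , e))) = alive e , x≢v
      many′ : 8 * count A′? ≤ degreeSum (contract G u v) + 18
      many′ = ℕ.+-cancelʳ-≤ 8 _ _ (begin
        8 * count A′? + 8                                         ≡⟨ ℕ.+-comm _ 8 ⟩
        8 + 8 * count A′?                                         ≡⟨ ℕ.*-suc 8 (count A′?) ⟨
        8 * suc (count A′?)                                       ≡⟨ cong (8 *_) |A|≡ ⟨
        8 * count A?                                              ≤⟨ many ⟩
        degreeSum G + 18                                          ≤⟨ ℕ.+-monoˡ-≤ 18 (contract-degreeSum G u~v) ⟩
        degreeSum (contract G u v) + (2 * common G u v + 2) + 18
            ≤⟨ ℕ.+-monoˡ-≤ 18 (ℕ.+-monoʳ-≤ (degreeSum (contract G u v)) (ℕ.+-monoˡ-≤ 2 (ℕ.*-monoʳ-≤ 2 c≤3))) ⟩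
        degreeSum (contract G u v) + 8 + 18 ≡⟨ solve 1 (λ x → x :+ con 8 :+ con 18 := x :+ con 18 :+ con 8)
            refl (degreeSum (contract G u v)) ⟩
        degreeSum (contract G u v) + 18 + 8                       ∎)
    ...   | no dense with 8 * count A? ℕ.≤? degreeSum G + 16
    ...     | yes more = conclude edge?
      where
      open Graph G
      edge? : Dec (∃₂ λ u v → u ~ v)
      edge? = Fin.any? λ u → Fin.any? λ v → u ~? v
      conclude : Dec (∃₂ λ u v → u ~ v) → Model 6 G
      conclude (yes (u , v , u~v)) = model-⊆ {H = delete-edge G u v} proj₁
        (go s (delete-edge G u v) A? (ℕ.<-≤-trans (delete-edge-< G u~v) S≤s) |A|≤a (alive ∘ proj₁) 4≤|A|
          (ℕ.≤-trans more (ℕ.≤-trans (ℕ.+-monoˡ-≤ 16 (delete-edge-degreeSum G u~v))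
            (ℕ.≤-reflexive (ℕ.+-assoc (degreeSum (delete-edge G u v)) 2 16)))))
      conclude (no edgeless) = contradiction (ℕ.≤-trans (ℕ.*-monoʳ-≤ 8 5≤|A|)
          (ℕ.≤-trans more (ℕ.≤-reflexive (cong (_+ 16) S≡0)))) (ℕ.<⇒≱ (ℕ.m≤m+n 17 23))
        where
        S≡0 : degreeSum G ≡ 0
        S≡0 = trans (sum-cong-≗ λ x → trans (count-none (x ~?_) λ {y} e → edgeless (x , y , e)) (sym (ℕ.*-zeroʳ 0)))
                (trans (sum-scaled {n} (λ _ → 0) 0) (ℕ.*-zeroʳ (sum {n} (λ _ → 0))))
    ...     | no few with Fin.any? (λ u → A? u ×-dec (degreeOf G u ℕ.<? 8))
    ...       | no none = contradiction (begin
        8 * count A?                ≡⟨ ℕ.*-comm 8 (count A?) ⟩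
        count A? * 8                ≡⟨ sum-scaled (λ x → 𝟏 (A? x)) 8 ⟨
        sum (λ x → 𝟏 (A? x) * 8)    ≤⟨ sum-mono pointwise ⟩
        degreeSum G                 ≤⟨ ℕ.m≤m+n _ 16 ⟩
        degreeSum G + 16 ∎) few
      where
      pointwise : ∀ x → 𝟏 (A? x) * 8 ≤ degreeOf G x
      pointwise x with A? x
      ... | yes Ax = ℕ.≮⇒≥ λ d<8 → none (x , Ax , d<8)
      ... | no _   = z≤n
    ...       | yes (u , Au , d<8) with Fin.any? (Graph._~?_ G u)
    ...         | yes (b , u~b) = low-degree-model G {Q = λ _ → ⊥} A? (λ _ → no id) alive
        (record { clique = λ () ; triangles = λ {x} {y} e _ → ℕ.≮⇒≥ λ c<4 → dense (x , y , e , c<4) })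
        (λ b<|A| → proj₂ (ih (ℕ.<-≤-trans b<|A| |A|≤a))) id u~b d<8
    ...         | no isolated = proj₁ (ih smaller) G A′? ℕ.≤-refl alive′ 4≤|A′|
        (ℕ.≤-trans (ℕ.*-monoʳ-≤ 8 (subst (count A′? ≤_) (sym |A|≡) (ℕ.n≤1+n _))) many)
      where
      open Graph G
      A′? = λ x → A? x ×-dec ¬? (x Fin.≟ u)
      |A|≡ : count A? ≡ suc (count A′?)
      |A|≡ = remove-count A? Au
      smaller : count A′? < a
      smaller = subst (_≤ a) |A|≡ |A|≤a
      4≤|A′| : 4 ≤ count A′?
      4≤|A′| = ℕ.≤-pred (subst (5 ≤_) |A|≡ 5≤|A|)
      alive′ : ∀ {x y} → x ~ y → A x × x ≢ u
      alive′ e = alive e , λ { refl → isolated (_ , e) }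

  -- Without a nonisolated vertex of small degree outside Q, Mader's bound holds on the set N of
  -- nonisolated vertices. It may be invoked at the same a, because there it rests on smaller cases
  -- only.
  piece-step : ∀ a → MaderClaim n a → (∀ {b} → b < a → PieceClaim n b) → PieceClaim n a
  piece-step {n} a mader ih G {A} {Q} A? Q? |A|≤a alive |Q|≤3 dense {x₀} {y₀} x₀~y₀ ¬Q
    with Fin.any? (λ u → ¬? (Q? u) ×-dec Fin.any? (Graph._~?_ G u) ×-dec (degreeOf G u ℕ.<? 8))
  ... | yes (u , u∉Q , (b , u~b) , d<8) =
    low-degree-model G A? Q? alive dense (λ b<|A| → ih (ℕ.<-≤-trans b<|A| |A|≤a)) u∉Q u~b d<8
  ... | no none = mader G N? (ℕ.≤-trans (count-⊆ N? A? (λ (_ , e) → alive e)) |A|≤a)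
      (λ e → _ , e) 4≤|N| many
    where
    open Graph G
    open Dense dense
    N : Pred (Fin n) 0ℓ
    N x = ∃ λ y → x ~ y
    N? : Decidable N
    N? x = Fin.any? (x ~?_)
    q : ℕ
    q = count Q?
    high : ∀ {x} → ¬ Q x → N x → 8 ≤ degreeOf G x
    high x∉Q Nx = ℕ.≮⇒≥ λ d<8 → none (_ , x∉Q , Nx , d<8)
    highVertex : ∃ λ x → 8 ≤ degreeOf G x
    highVertex with Q? x₀
    ... | no  x∉Q = x₀ , high x∉Q (_ , x₀~y₀)
    ... | yes x∈Q = y₀ , high (λ y∈Q → ¬Q (x∈Q , y∈Q)) (_ , ~-sym x₀~y₀)
    4≤|N| : 4 ≤ count N?
    4≤|N| = let x , 8≤d = highVertex in
      ℕ.≤-trans (ℕ.m≤m+n 4 4) (ℕ.≤-trans 8≤d (count-⊆ (x ~?_) N? λ e → _ , ~-sym e))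
    clique-degree : ∀ {x} → Q x → q ≤ degreeOf G x + 1
    clique-degree {x} Qx = ℕ.≤-trans (count-insert Q? (x ~?_) {x} λ Qy y≢x → clique Qx Qy (y≢x ∘ sym))
      (ℕ.≤-reflexive (ℕ.+-comm 1 _))
    -- A vertex of Q has degree at least q - 1 and thus falls short of 8 by at most 9 - q.
    pointwise : ∀ x → 𝟏 (N? x) * 8 ≤ degreeOf G x + 𝟏 (Q? x) * (9 ∸ q)
    pointwise x with N? x | Q? x
    ... | no _   | _      = z≤n
    ... | yes Nx | no x∉Q = ℕ.≤-trans (high x∉Q Nx) (ℕ.m≤m+n _ _)
    ... | yes Nx | yes Qx = ℕ.≤-pred (begin
      9                                 ≡⟨ ℕ.m+[n∸m]≡n (ℕ.≤-trans |Q|≤3 (ℕ.m≤m+n 3 6)) ⟨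
      q + (9 ∸ q)                       ≤⟨ ℕ.+-monoˡ-≤ (9 ∸ q) (clique-degree Qx) ⟩
      degreeOf G x + 1 + (9 ∸ q) ≡⟨ solve 2 (λ d k → d :+ con 1 :+ k := con 1 :+ (d :+ (k :+ con 0))) refl
          (degreeOf G x) (9 ∸ q) ⟩
      suc (degreeOf G x + (9 ∸ q + 0)) ∎)
    -- Equality holds at 3, while 4 would give 20: this is why only cliques of at most three
    -- vertices can be cut along.
    deficit : ∀ k → k ≤ 3 → k * (9 ∸ k) ≤ 18
    deficit 0 _ = z≤n
    deficit 1 _ = ℕ.m≤m+n 8 10
    deficit 2 _ = ℕ.m≤m+n 14 4
    deficit 3 _ = ℕ.≤-refl
    deficit (suc (suc (suc (suc _)))) (s≤s (s≤s (s≤s ())))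
    many : 8 * count N? ≤ degreeSum G + 18
    many = begin
      8 * count N?                                              ≡⟨ ℕ.*-comm 8 (count N?) ⟩
      count N? * 8                                              ≡⟨ sum-scaled (λ x → 𝟏 (N? x)) 8 ⟨
      sum (λ x → 𝟏 (N? x) * 8)                                  ≤⟨ sum-mono pointwise ⟩
      sum (λ x → degreeOf G x + 𝟏 (Q? x) * (9 ∸ q))             ≡⟨ ∑-distrib-+ (degreeOf G) _ ⟩
      degreeSum G + sum (λ x → 𝟏 (Q? x) * (9 ∸ q))
          ≡⟨ cong (degreeSum G +_) (sum-scaled (λ x → 𝟏 (Q? x)) (9 ∸ q)) ⟩
      degreeSum G + q * (9 ∸ q)                                 ≤⟨ ℕ.+-monoʳ-≤ (degreeSum G) (deficit q |Q|≤3) ⟩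
      degreeSum G + 18 ∎

  claims : ∀ a → MaderClaim n a × PieceClaim n a
  claims {n} = <-rec (λ a → MaderClaim n a × PieceClaim n a) λ a ih →
    let mader = mader-step a ih in mader , piece-step a mader (λ b<a → proj₂ (ih b<a))

  -- Triangles on every edge force a complete minor

  Triangulated⇒Minor : ℕ → Set₁
  Triangulated⇒Minor r = ∀ {n} (G : Graph n) → (∀ {x y} → Adjacent G x y → r ∸ 2 ≤ common G x y) →
                         ∀ {x y} → Adjacent G x y → Model r G

  triangulated-6 : Triangulated⇒Minor 6
  triangulated-6 {n} G triangles x~y =
    proj₂ (claims _) G {λ _ → ⊤} {λ _ → ⊥} (λ _ → yes tt) (λ _ → no id) ℕ.≤-refl (λ _ → tt)
      (ℕ.≤-trans (ℕ.≤-reflexive (count-none {n} {λ _ → ⊥} (λ _ → no id) id)) z≤n)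
      (record { clique = λ () ; triangles = λ e _ → triangles e }) x~y proj₁

  -- The apex is joined only to vertices that have a neighbour: an edge to an isolated vertex would
  -- lie in no triangle.
  coned : Graph n → Graph (suc n)
  coned {n} G = record { _~_ = _≈_ ; _~?_ = _≈?_ ; ~-sym = λ {x} {y} → ≈-sym x y ; ~-irrefl = λ {x} {y} → ≈-irrefl x y }
    where
    open Graph G
    _≈_ : Fin (suc n) → Fin (suc n) → Set
    zero  ≈ zero  = ⊥
    zero  ≈ suc y = ∃ (y ~_)
    suc x ≈ zero  = ∃ (x ~_)
    suc x ≈ suc y = x ~ y
    _≈?_ : ∀ x y → Dec (x ≈ y)
    zero  ≈? zero  = no id
    zero  ≈? suc y = Fin.any? (y ~?_)
    suc x ≈? zero  = Fin.any? (x ~?_)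
    suc x ≈? suc y = x ~? y
    ≈-sym : ∀ x y → x ≈ y → y ≈ x
    ≈-sym zero    (suc y) e = e
    ≈-sym (suc x) zero    e = e
    ≈-sym (suc x) (suc y) e = ~-sym e
    ≈-irrefl : ∀ x y → x ≡ y → ¬ x ≈ y
    ≈-irrefl zero    zero    eq ()
    ≈-irrefl (suc x) (suc y) eq e = ~-irrefl (Fin.suc-injective eq) e

  -- Drop the branch set of the apex, or an arbitrary one if the apex is unused.
  coned-model : {G : Graph n} → Model (suc r) (coned G) → Model r G
  coned-model {n} {r} {G} M = record
    { branch = λ x → lower (branch (suc x))
    ; connected = λ {i} bx by → descend (connected (raise bx) (raise by))
    ; joined = λ {i} {j} i≢j → joined′ (joined (λ eq → i≢j (Fin.punchIn-injective apex i j eq)))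
    }
    where
    open Model M
    open Graph G
    apexOf : Maybe (Fin (suc r)) → Fin (suc r)
    apexOf (just i) = i
    apexOf nothing  = zero
    apex : Fin (suc r)
    apex = apexOf (branch zero)
    lower : Maybe (Fin (suc r)) → Maybe (Fin r)
    lower nothing  = nothing
    lower (just i) with apex Fin.≟ i
    ... | yes _ = nothing
    ... | no a≢i = just (punchOut a≢i)
    raise : ∀ {b i} → lower b ≡ just i → b ≡ just (punchIn apex i)
    raise {just i} eq with apex Fin.≟ i
    raise {just i} refl | no a≢i = cong just (sym (Fin.punchIn-punchOut a≢i))
    lower-≡ : ∀ {b i} → b ≡ just (punchIn apex i) → lower b ≡ just i
    lower-≡ {i = i} refl with apex Fin.≟ punchIn apex i
    ... | yes eq = contradiction (sym eq) (Fin.punchInᵢ≢i apex i)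
    ... | no  _  = cong just (Fin.punchOut-punchIn apex)
    apex∉ : ∀ {i} → branch zero ≢ just (punchIn apex i)
    apex∉ {i} eq = Fin.punchInᵢ≢i apex i (sym (cong apexOf eq))
    descend : ∀ {i x y} →
      Star (λ a b → Adjacent (coned G) a b × branch b ≡ just (punchIn apex i)) (suc x) (suc y) →
      Star (λ a b → a ~ b × lower (branch (suc b)) ≡ just i) x y
    descend ε = ε
    descend (_◅_ {j = zero}  (_ , b) s) = contradiction b apex∉
    descend (_◅_ {j = suc z} (e , b) s) = (e , lower-≡ b) ◅ descend s
    joined′ : ∀ {i j} →
      (∃₂ λ x y → branch x ≡ just (punchIn apex i) × branch y ≡ just (punchIn apex j) × Adjacent (coned G) x
          y) →
      ∃₂ λ x y → lower (branch (suc x)) ≡ just i × lower (branch (suc y)) ≡ just j × x ~ y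
    joined′ (zero , _ , b , _) = contradiction b apex∉
    joined′ (suc x , zero , _ , b , _) = contradiction b apex∉
    joined′ (suc x , suc y , bx , by , e) = x , y , lower-≡ bx , lower-≡ by , e

  -- Each old edge gains the apex as a common neighbour. The ends of an edge from the apex to x have
  -- all neighbours of x in common, and these comprise some y together with the common neighbours of
  -- x and y.
  triangulated-pred : 2 ≤ r → Triangulated⇒Minor (suc r) → Triangulated⇒Minor r
  triangulated-pred {suc (suc k)} (s≤s (s≤s _)) claim {n} G triangles {x₀} {y₀} x₀~y₀ =
    coned-model (claim (coned G) (λ {x} {y} → triangles′ x y) {suc x₀} {suc y₀} x₀~y₀)
    where
    open Graph G
    open Graph (coned G) using () renaming (_~_ to _≈_; _~?_ to _≈?_)
    edge-triangles : ∀ x y → x ~ y → suc k ≤ common (coned G) (suc x) (suc y)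
    edge-triangles x y e with Fin.any? (x ~?_) | Fin.any? (y ~?_)
    ... | yes _   | yes _   = s≤s (triangles e)
    ... | no none | _       = contradiction (y , e) none
    ... | yes _   | no none = contradiction (x , ~-sym e) none
    apex-triangles : ∀ x → ∃ (x ~_) → suc k ≤ count (λ z → Fin.any? (z ~?_) ×-dec (x ~? z))
    apex-triangles x (y , x~y) = ℕ.≤-trans (s≤s (triangles x~y))
      (count-⊂ (λ z → (x ~? z) ×-dec (y ~? z)) (λ z → Fin.any? (z ~?_) ×-dec (x ~? z))
        (λ (p , _) → (x , ~-sym p) , p) {y} ((x , ~-sym x~y) , x~y) (~-irrefl refl ∘ proj₂))
    triangles′ : ∀ x y → x ≈ y → suc k ≤ common (coned G) x y
    triangles′ zero (suc y) e = apex-triangles y e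
    triangles′ (suc x) zero e = ℕ.≤-trans (apex-triangles x e)
      (ℕ.≤-trans
        (count-⊆ (λ z → Fin.any? (z ~?_) ×-dec (x ~? z)) (λ z → (x ~? z) ×-dec Fin.any? (z ~?_))
            (λ (p , q) → q , p))
        (ℕ.m≤n+m _ (𝟏 ((suc x ≈? zero) ×-dec (zero ≈? zero)))))
    triangles′ (suc x) (suc y) e = edge-triangles x y e

  triangulated : 2 ≤ r → r ≤ 6 → Triangulated⇒Minor r
  triangulated {r} 2≤r r≤6 = down (6 ∸ r) r 2≤r (ℕ.m∸n+n≡m r≤6)
    where
    down : ∀ k r → 2 ≤ r → k + r ≡ 6 → Triangulated⇒Minor r
    down zero    _ _   refl = triangulated-6
    down (suc k) r 2≤r eq   =
      triangulated-pred 2≤r (down k (suc r) (ℕ.m≤n⇒m≤1+n 2≤r) (trans (ℕ.+-suc k r) eq))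

  -- Reduction to an edgeless graph

  data Reducible (d : ℕ) {n} (G : Graph n) : Set₁ where
    edgeless    : (∀ {x y} → ¬ Adjacent G x y) → Reducible d G
    -- The strict inequality leaves room for one condition besides those of the common neighbours,
    -- that of the edge u v.
    contraction : ∀ {u v} → Adjacent G u v → common G u v < d →
                  Reducible d (contract G u v) → Reducible d G

  -- If no edge has fewer than r - 2 common neighbours, `triangulated` gives the model; otherwise
  -- contraction isolates v and the number of live vertices drops.
  model-or-reducible : 2 ≤ r → r ≤ 6 → (G : Graph n) → Model r G ⊎ Reducible (r ∸ 2) G
  model-or-reducible {r} {n} 2≤r r≤6 G =
    go _ G {λ _ → ⊤} (λ _ → yes tt) (λ _ → tt) ℕ.≤-refl
    where
    go : ∀ a (G : Graph n) {A : Pred (Fin n) 0ℓ} (A? : Decidable A) → (∀ {x y} → Adjacent G x y → A x) →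
         count A? ≤ a → Model r G ⊎ Reducible (r ∸ 2) G
    go a G A? alive |A|≤a with Fin.any? (λ u → Fin.any? λ v → Graph._~?_ G u v)
    ... | no none = inj₂ (edgeless λ {x} {y} e → none (x , y , e))
    ... | yes (x , y , x~y)
      with Fin.any? (λ u → Fin.any? λ v → Graph._~?_ G u v ×-dec (common G u v ℕ.<? r ∸ 2))
    ...   | no none = inj₁ (triangulated 2≤r r≤6 G (λ {u} {v} e → ℕ.≮⇒≥ λ c<d → none (u , v , e , c<d)) x~y)
    go zero G A? alive |A|≤a | _ | yes (u , v , u~v , c<d) with () ←
      subst (_≤ 0) (remove-count A? (alive u~v)) |A|≤a
    go (suc a) G A? alive |A|≤a | _ | yes (u , v , u~v , c<d)
      with go a (contract G u v) (λ x → A? x ×-dec ¬? (x Fin.≟ v))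
             (λ { (x≢v , _ , _ , inj₁ e) → alive e , x≢v
                ; (x≢v , _ , _ , inj₂ (inj₁ (refl , _))) → alive u~v , x≢v
                ; (x≢v , _ , _ , inj₂ (inj₂ (_ , e))) → alive e , x≢v })
             (ℕ.≤-pred (subst (_≤ suc a) (remove-count A? (alive (Graph.~-sym G u~v))) |A|≤a))
    ... | inj₁ M = inj₁ (contract-model G u~v M)
    ... | inj₂ R = inj₂ (contraction u~v c<d R)

module Algebra {c ℓ₁ ℓ₂} (k : HeytingField c ℓ₁ ℓ₂) (char0 : CharacteristicZero k) where

  open import Level using (_⊔_; 0ℓ)
  open import Algebra.Apartness.Properties.HeytingCommutativeRing (HeytingField.heytingCommutativeRing k)
    using (1#0)
  open import Algebra.Bundles using (CommutativeRing; CommutativeMonoid; Semiring)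
  open import Algebra.Core using (Op₂)
  import Algebra.Properties.CommutativeSemigroup as CommutativeSemigroupProperties
  import Algebra.Properties.Ring as RingProperties
  import Algebra.Properties.Semiring.Mult as SemiringMult
  import Algebra.Properties.Semiring.Sum as SemiringSum
  import Algebra.Solver.Ring as RingSolver
  open import Algebra.Solver.Ring.AlmostCommutativeRing using (fromCommutativeRing; _-Raw-AlmostCommutative⟶_)
  open import Data.Bool.Base using (true; false; if_then_else_)
  open import Data.Fin.Base using (Fin; zero; suc; toℕ; fromℕ<; combine; remQuot)
    renaming (_<_ to _<ᶠ_; _≤_ to _≤ᶠ_)
  open import Data.Fin.Patterns
  import Data.Fin.Properties as Fin
  open import Data.Fin.Subset using (Subset; inside; _∈_; _∪_; ⁅_⁆; ∣_∣)
  open import Data.Fin.Subset.Properties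
    using (_∈?_; x∈⁅x⁆; x∈⁅y⁆⇒x≡y; x∈p∪q⁻; x∈p∪q⁺; ∣⊥∣≡0; ∣⁅x⁆∣≡1; ∉⊥; ∪-identityˡ; ∪-comm)
  open import Data.Integer.Base as ℤ using (ℤ; +_; -[1+_])
  import Data.Integer.Properties as ℤ
  open import Data.List.Base using (List; []; _∷_; _++_; map; foldr; filter; length; tabulate)
  import Data.List.Properties as List
  import Data.List.Relation.Unary.All.Properties as All
  open import Data.Maybe.Base using (Maybe; just; nothing)
  open import Data.Nat.Base as ℕ using (ℕ; zero; suc; _≤_; _∸_; z≤n; s≤s)
  import Data.Nat.Properties as ℕ
  open import Data.Product.Base using (∃; ∃₂; _×_; _,_; proj₁; proj₂; uncurry)
  open import Data.Rational.Base as ℚ using (ℚ; mkℚ; toℚᵘ)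
  import Data.Rational.Properties as ℚ
  open import Data.Rational.Unnormalised.Base as ℚᵘ using (ℚᵘ; mkℚᵘ; *≡*)
  open import Data.Sum.Base using (_⊎_; inj₁; inj₂; [_,_]′)
  open import Data.Unit.Base using (⊤; tt)
  open import Data.Vec.Base using ([]; _∷_; lookup)
  import Data.Vec.Properties as Vec
  open import Function.Base using (_∘_; id)
  open import Function.Bundles using (mk⇔; Equivalence)
  open import Relation.Binary.Core using (Rel)
  open import Relation.Binary.Definitions using (DecidableEquality; tri<; tri≈; tri>)
  open import Relation.Binary.PropositionalEquality as ≡ using (_≡_; _≢_)
  import Relation.Binary.Reasoning.Setoid as SetoidReasoning
  open import Relation.Nullary.Decidable using (Dec; yes; no; does; _×-dec_; _⊎-dec_)
  open import Relation.Nullary.Negation using (¬_; contradiction)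
  open import Relation.Unary using (Pred; Decidable)
  open Combinatorics
    using (count; count-insert; Enumeration; enumerate; contract; common; Reducible; edgeless; contraction)

  private variable
    a b d m n : ℕ

  open HeytingField k using (_#_; #⇒invertible; tight)
  open CommutativeRing (ring k) hiding (zero; ring)
  open RingProperties (CommutativeRing.ring (ring k))
    using (-0#≈0#; -‿distribˡ-*; -‿distribʳ-*; -‿involutive; -‿+-comm; -1*x≈-x)
  open SemiringMult (CommutativeRing.semiring (ring k)) using (×-homo-+; ×1-homo-*)
  open SemiringSum (CommutativeRing.semiring (ring k))
    using (sum; sum-cong-≋; ∑-distrib-+; ∑-comm; *-distribˡ-sum)
  open SetoidReasoning setoid

  -- The rational numbers in the field

  _>>=_ : ∀ {p q} {A : Set p} {B : Set q} → ¬ ¬ A → (A → ¬ ¬ B) → ¬ ¬ B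
  (m >>= f) ¬b = m λ a → f a ¬b

  pure : ∀ {p} {A : Set p} → A → ¬ ¬ A
  pure a ¬a = ¬a a

  x-0≈x : ∀ x → x - 0# ≈ x
  x-0≈x x = trans (+-congˡ -0#≈0#) (+-identityʳ x)

  inverse : ∀ {x} → x # 0# → ∃ λ y → x * y ≈ 1#
  inverse {x} x#0 = let y , _ , eq = #⇒invertible x#0 in y , trans (*-congʳ (sym (x-0≈x x))) eq

  #⇒≉ : ∀ {x} → x # 0# → ¬ x ≈ 0#
  #⇒≉ x#0 x≈0 = proj₂ (tight _ _) x≈0 x#0

  ≉⇒¬¬# : ∀ {x} → ¬ x ≈ 0# → ¬ ¬ x # 0#
  ≉⇒¬¬# x≉0 ¬x#0 = x≉0 (proj₁ (tight _ _) ¬x#0)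

  *-cancelʳ-# : ∀ {x y z} → z # 0# → x * z ≈ y * z → x ≈ y
  *-cancelʳ-# {x} {y} {z} z#0 eq = let w , zw≈1 = inverse z#0 in begin
    x             ≈⟨ *-identityʳ x ⟨
    x * 1#        ≈⟨ *-congˡ zw≈1 ⟨
    x * (z * w)   ≈⟨ *-assoc x z w ⟨
    x * z * w     ≈⟨ *-congʳ eq ⟩
    y * z * w     ≈⟨ *-assoc y z w ⟩
    y * (z * w)   ≈⟨ *-congˡ zw≈1 ⟩
    y * 1#        ≈⟨ *-identityʳ y ⟩
    y             ∎

  fℕ : ℕ → Carrier
  fℕ = fromℕ k

  fℤ : ℤ → Carrier
  fℤ = fromℤ k

  fℤ-⊖ : ∀ m n → fℤ (m ℤ.⊖ n) ≈ fℕ m - fℕ n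
  fℤ-⊖ zero    zero    = sym (x-0≈x 0#)
  fℤ-⊖ zero    (suc n) = sym (+-identityˡ _)
  fℤ-⊖ (suc m) zero    = sym (x-0≈x _)
  fℤ-⊖ (suc m) (suc n) = begin
    fℤ (suc m ℤ.⊖ suc n)             ≡⟨ ≡.cong fℤ (ℤ.[1+m]⊖[1+n]≡m⊖n m n) ⟩
    fℤ (m ℤ.⊖ n)                     ≈⟨ fℤ-⊖ m n ⟩
    fℕ m - fℕ n                    ≈⟨ +-identityˡ _ ⟨
    0# + (fℕ m - fℕ n)             ≈⟨ +-congʳ (-‿inverseʳ 1#) ⟨
    (1# - 1#) + (fℕ m - fℕ n)      ≈⟨ +-assoc 1# (- 1#) _ ⟩
    1# + (- 1# + (fℕ m - fℕ n))    ≈⟨ +-congˡ (+-congˡ (+-comm _ _)) ⟩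
    1# + (- 1# + (- fℕ n + fℕ m))  ≈⟨ +-congˡ (+-assoc _ _ _) ⟨
    1# + ((- 1# - fℕ n) + fℕ m)    ≈⟨ +-congˡ (+-congʳ (-‿+-comm 1# (fℕ n))) ⟩
    1# + (- (1# + fℕ n) + fℕ m)    ≈⟨ +-congˡ (+-comm _ _) ⟩
    1# + (fℕ m - (1# + fℕ n))      ≈⟨ +-assoc _ _ _ ⟨
    (1# + fℕ m) - (1# + fℕ n)      ∎

  fℤ-neg : ∀ i → fℤ (ℤ.- i) ≈ - fℤ i
  fℤ-neg (+ zero)  = sym -0#≈0#
  fℤ-neg (+ suc n) = refl
  fℤ-neg -[1+ n ]  = sym (-‿involutive _)

  fℤ-+ : ∀ i j → fℤ (i ℤ.+ j) ≈ fℤ i + fℤ j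
  fℤ-+ (+ m)    (+ n)    = ×-homo-+ 1# m n
  fℤ-+ (+ m)    -[1+ n ] = fℤ-⊖ m (suc n)
  fℤ-+ -[1+ m ] (+ n)    = trans (fℤ-⊖ n (suc m)) (+-comm _ _)
  fℤ-+ -[1+ m ] -[1+ n ] = begin
    - fℕ (suc (suc (m ℕ.+ n)))      ≡⟨ ≡.cong (λ l → - fℕ (suc l)) (≡.sym (ℕ.+-suc m n)) ⟩
    - fℕ (suc m ℕ.+ suc n)          ≈⟨ -‿cong (×-homo-+ 1# (suc m) (suc n)) ⟩
    - (fℕ (suc m) + fℕ (suc n))     ≈⟨ -‿+-comm _ _ ⟨
    - fℕ (suc m) - fℕ (suc n)       ∎

  fℤ-pos-* : ∀ m j → fℤ (+ m ℤ.* j) ≈ fℕ m * fℤ j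
  fℤ-pos-* m (+ n)    = trans (reflexive (≡.cong fℤ (≡.sym (ℤ.pos-* m n)))) (×1-homo-* m n)
  fℤ-pos-* m -[1+ n ] = begin
    fℤ (+ m ℤ.* -[1+ n ])            ≡⟨ ≡.cong fℤ (≡.sym (ℤ.neg-distribʳ-* (+ m) (+ suc n))) ⟩
    fℤ (ℤ.- (+ m ℤ.* + suc n))       ≈⟨ fℤ-neg (+ m ℤ.* + suc n) ⟩
    - fℤ (+ m ℤ.* + suc n)           ≈⟨ -‿cong (fℤ-pos-* m (+ suc n)) ⟩
    - (fℕ m * fℕ (suc n))            ≈⟨ -‿distribʳ-* _ _ ⟩
    fℕ m * - fℕ (suc n)              ∎

  fℤ-* : ∀ i j → fℤ (i ℤ.* j) ≈ fℤ i * fℤ j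
  fℤ-* (+ m)    j = fℤ-pos-* m j
  fℤ-* -[1+ m ] j = begin
    fℤ (-[1+ m ] ℤ.* j)              ≡⟨ ≡.cong fℤ (≡.sym (ℤ.neg-distribˡ-* (+ suc m) j)) ⟩
    fℤ (ℤ.- (+ suc m ℤ.* j))         ≈⟨ fℤ-neg (+ suc m ℤ.* j) ⟩
    - fℤ (+ suc m ℤ.* j)             ≈⟨ -‿cong (fℤ-pos-* (suc m) j) ⟩
    - (fℕ (suc m) * fℤ j)            ≈⟨ -‿distribˡ-* _ _ ⟩
    - fℕ (suc m) * fℤ j              ∎

  fℤ-homo : ℤ.+-*-rawRing -Raw-AlmostCommutative⟶ fromCommutativeRing (ring k)
  fℤ-homo = record
    { ⟦_⟧ = fℤ ; +-homo = fℤ-+ ; *-homo = fℤ-* ; -‿homo = fℤ-neg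
    ; 0-homo = refl ; 1-homo = +-identityʳ 1# }

  fℤ-≈? : ∀ i j → Maybe (fℤ i ≈ fℤ j)
  fℤ-≈? i j with i ℤ.≟ j
  ... | yes ≡.refl = just refl
  ... | no _       = nothing

  module Solver = RingSolver ℤ.+-*-rawRing (fromCommutativeRing (ring k))
    fℤ-homo
    fℤ-≈?

  open Solver using (solve; con; _:=_; _:+_; _:*_; _:-_; :-_)

  denominator : ℕ → Carrier
  denominator d = fℕ (suc d)

  -- Sums and products in `ℚ` are normalised, which hides numerators and denominators. The
  -- homomorphism laws are therefore proved for unnormalised fractions, and `val-cong` makes the
  -- value independent of the representation.
  val : ℚᵘ → Carrier
  val (mkℚᵘ p d) = fℤ p * proj₁ (#⇒invertible (char0 d))

  val-spec : ∀ p d → val (mkℚᵘ p d) * denominator d ≈ fℤ p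
  val-spec p d = let i , i*d≈1 , _ = #⇒invertible (char0 d) in begin
    fℤ p * i * denominator d           ≈⟨ *-assoc _ _ _ ⟩
    fℤ p * (i * denominator d)         ≈⟨ *-congˡ (*-congˡ (x-0≈x _)) ⟨
    fℤ p * (i * (denominator d - 0#))  ≈⟨ *-congˡ i*d≈1 ⟩
    fℤ p * 1#                          ≈⟨ *-identityʳ _ ⟩
    fℤ p                               ∎

  val-unique : ∀ p d {x} → x * denominator d ≈ fℤ p → val (mkℚᵘ p d) ≈ x
  val-unique p d eq = *-cancelʳ-# (char0 d) (trans (val-spec p d) (sym eq))

  val-cong : ∀ {p q} → p ℚᵘ.≃ q → val p ≈ val q
  val-cong {mkℚᵘ p d} {mkℚᵘ q e} (*≡* eq) = val-unique p d (*-cancelʳ-# (char0 e) (begin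
    val (mkℚᵘ q e) * D * E      ≈⟨ solve 3 (λ v d e → v :* d :* e := v :* e :* d) refl (val (mkℚᵘ q e)) D E ⟩
    val (mkℚᵘ q e) * E * D      ≈⟨ *-congʳ (val-spec q e) ⟩
    fℤ q * D                    ≈⟨ fℤ-* q (+ suc d) ⟨
    fℤ (q ℤ.* + suc d)          ≡⟨ ≡.cong fℤ (≡.sym eq) ⟩
    fℤ (p ℤ.* + suc e)          ≈⟨ fℤ-* p (+ suc e) ⟩
    fℤ p * E                    ∎))
    where
    D = denominator d
    E = denominator e

  val-+ : ∀ p q → val (p ℚᵘ.+ q) ≈ val p + val q
  val-+ (mkℚᵘ p d) (mkℚᵘ q e) = val-unique (p ℤ.* + suc e ℤ.+ q ℤ.* + suc d) (e ℕ.+ d ℕ.* suc e) (begin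
    (v + w) * fℕ (suc d ℕ.* suc e)                        ≈⟨ *-congˡ (×1-homo-* (suc d) (suc e)) ⟩
    (v + w) * (D * E) ≈⟨ solve 4 (λ v w d e → (v :+ w) :* (d :* e) := v :* d :* e :+ w :* e :* d) refl v w D E ⟩
    v * D * E + w * E * D ≈⟨ +-cong (*-congʳ (val-spec p d)) (*-congʳ (val-spec q e)) ⟩
    fℤ p * E + fℤ q * D                                   ≈⟨ +-cong (fℤ-* p (+ suc e)) (fℤ-* q (+ suc d)) ⟨
    fℤ (p ℤ.* + suc e) + fℤ (q ℤ.* + suc d)               ≈⟨ fℤ-+ (p ℤ.* + suc e) (q ℤ.* + suc d) ⟨
    fℤ (p ℤ.* + suc e ℤ.+ q ℤ.* + suc d)                  ∎)
    where
    v = val (mkℚᵘ p d)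
    w = val (mkℚᵘ q e)
    D = denominator d
    E = denominator e

  val-* : ∀ p q → val (p ℚᵘ.* q) ≈ val p * val q
  val-* (mkℚᵘ p d) (mkℚᵘ q e) = val-unique (p ℤ.* q) (e ℕ.+ d ℕ.* suc e) (begin
    (v * w) * fℕ (suc d ℕ.* suc e)     ≈⟨ *-congˡ (×1-homo-* (suc d) (suc e)) ⟩
    (v * w) * (D * E) ≈⟨ solve 4 (λ v w d e → (v :* w) :* (d :* e) := (v :* d) :* (w :* e)) refl v w D E ⟩
    (v * D) * (w * E)                  ≈⟨ *-cong (val-spec p d) (val-spec q e) ⟩
    fℤ p * fℤ q                        ≈⟨ fℤ-* p q ⟨
    fℤ (p ℤ.* q)                       ∎)
    where
    v = val (mkℚᵘ p d)
    w = val (mkℚᵘ q e)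
    D = denominator d
    E = denominator e

  fℚ : ℚ → Carrier
  fℚ = fromℚ k char0

  fℚ-val : ∀ q → fℚ q ≡ val (toℚᵘ q)
  fℚ-val (mkℚ _ _ _) = ≡.refl

  fℚ-+ : ∀ p q → fℚ (p ℚ.+ q) ≈ fℚ p + fℚ q
  fℚ-+ p q = begin
    fℚ (p ℚ.+ q)                    ≡⟨ fℚ-val (p ℚ.+ q) ⟩
    val (toℚᵘ (p ℚ.+ q))            ≈⟨ val-cong (ℚ.toℚᵘ-homo-+ p q) ⟩
    val (toℚᵘ p ℚᵘ.+ toℚᵘ q)        ≈⟨ val-+ (toℚᵘ p) (toℚᵘ q) ⟩
    val (toℚᵘ p) + val (toℚᵘ q)     ≡⟨ ≡.cong₂ _+_ (fℚ-val p) (fℚ-val q) ⟨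
    fℚ p + fℚ q                     ∎

  fℚ-* : ∀ p q → fℚ (p ℚ.* q) ≈ fℚ p * fℚ q
  fℚ-* p q = begin
    fℚ (p ℚ.* q)                    ≡⟨ fℚ-val (p ℚ.* q) ⟩
    val (toℚᵘ (p ℚ.* q))            ≈⟨ val-cong (ℚ.toℚᵘ-homo-* p q) ⟩
    val (toℚᵘ p ℚᵘ.* toℚᵘ q)        ≈⟨ val-* (toℚᵘ p) (toℚᵘ q) ⟩
    val (toℚᵘ p) * val (toℚᵘ q)     ≡⟨ ≡.cong₂ _*_ (fℚ-val p) (fℚ-val q) ⟨
    fℚ p * fℚ q                     ∎

  fℚ-0 : fℚ ℚ.0ℚ ≈ 0#
  fℚ-0 = zeroˡ _

  fℚ-1 : fℚ ℚ.1ℚ ≈ 1#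
  fℚ-1 = val-unique (+ 1) 0 (*-identityˡ _)

  fℚ-neg : ∀ q → fℚ (ℚ.- q) ≈ - fℚ q
  fℚ-neg q = begin
    fℚ (ℚ.- q)                         ≈⟨ solve 2 (λ x y → x := x :+ y :- y) refl (fℚ (ℚ.- q)) (fℚ q) ⟩
    fℚ (ℚ.- q) + fℚ q - fℚ q           ≈⟨ +-congʳ (fℚ-+ (ℚ.- q) q) ⟨
    fℚ (ℚ.- q ℚ.+ q) - fℚ q            ≡⟨ ≡.cong (λ z → fℚ z - fℚ q) (ℚ.+-inverseˡ q) ⟩
    fℚ ℚ.0ℚ - fℚ q                     ≈⟨ +-congʳ fℚ-0 ⟩
    0# - fℚ q                          ≈⟨ +-identityˡ _ ⟩
    - fℚ q                             ∎

  -- Polynomials at a generic point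

  module Pairing {r₁ r₂} (R : CommutativeRing r₁ r₂)
    {B : Set} (_≟_ : DecidableEquality B) (_·_ : Op₂ B) (ε : B)
    (ψ : CommutativeRing.Carrier R → Carrier)
    (ψ-cong : ∀ {x y} → CommutativeRing._≈_ R x y → ψ x ≈ ψ y)
    (ψ-0 : ψ (CommutativeRing.0# R) ≈ 0#)
    (ψ-1 : ψ (CommutativeRing.1# R) ≈ 1#)
    (ψ-+ : ∀ x y → ψ (CommutativeRing._+_ R x y) ≈ ψ x + ψ y)
    (ψ-* : ∀ x y → ψ (CommutativeRing._*_ R x y) ≈ ψ x * ψ y) where

    private module R = CommutativeRing R
    open MonoidAlgebra R _≟_ _·_ ε

    -- The linear extension of φ from monomials to formal sums. With φ the evaluation of monomials
    -- it is the value of a polynomial; with φ arbitrary it separates elements, so that identities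
    -- can be checked without handling coefficients.
    ⟨_,_⟩ : Alg → (B → Carrier) → Carrier
    ⟨ p , φ ⟩ = foldr (λ (a , b) s → ψ a * φ b + s) 0# p

    pair-cong : ∀ p {φ χ} → (∀ b → φ b ≈ χ b) → ⟨ p , φ ⟩ ≈ ⟨ p , χ ⟩
    pair-cong []            eq = refl
    pair-cong ((a , b) ∷ p) eq = +-cong (*-congˡ (eq b)) (pair-cong p eq)

    pair-⊕ : ∀ p q {φ} → ⟨ p ⊕ q , φ ⟩ ≈ ⟨ p , φ ⟩ + ⟨ q , φ ⟩
    pair-⊕ []            q = sym (+-identityˡ _)
    pair-⊕ ((a , b) ∷ p) q = trans (+-congˡ (pair-⊕ p q)) (sym (+-assoc _ _ _))

    pair-⊙ : ∀ a p {φ} → ⟨ a ⊙ p , φ ⟩ ≈ ψ a * ⟨ p , φ ⟩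
    pair-⊙ a []                = sym (zeroʳ _)
    pair-⊙ a ((a′ , b) ∷ p) {φ} = begin
      ψ (a R.* a′) * φ b + ⟨ a ⊙ p , φ ⟩ ≈⟨ +-cong (trans (*-congʳ (ψ-* a a′)) (*-assoc _ _ _)) (pair-⊙ a p) ⟩
      ψ a * (ψ a′ * φ b) + ψ a * ⟨ p , φ ⟩     ≈⟨ distribˡ _ _ _ ⟨
      ψ a * (ψ a′ * φ b + ⟨ p , φ ⟩)           ∎

    pair-monomial : ∀ b {φ} → ⟨ monomial b , φ ⟩ ≈ φ b
    pair-monomial b = trans (+-identityʳ _) (trans (*-congʳ ψ-1) (*-identityˡ _))

    private
      pair-shift : ∀ a b q {φ} →
        ⟨ map (λ (a′ , b′) → a R.* a′ , b · b′) q , φ ⟩ ≈ ψ a * ⟨ q , (λ b′ → φ (b · b′)) ⟩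
      pair-shift a b []                = sym (zeroʳ _)
      pair-shift a b ((a′ , b′) ∷ q) {φ} = begin
        ψ (a R.* a′) * φ (b · b′) + _ ≈⟨ +-cong (trans (*-congʳ (ψ-* a a′)) (*-assoc _ _ _))
            (pair-shift a b q) ⟩
        ψ a * (ψ a′ * φ (b · b′)) + ψ a * ⟨ q , (λ b′ → φ (b · b′)) ⟩  ≈⟨ distribˡ _ _ _ ⟨
        ψ a * ⟨ (a′ , b′) ∷ q , (λ b′ → φ (b · b′)) ⟩   ∎

    pair-⊛ : ∀ p q {φ} → ⟨ p ⊛ q , φ ⟩ ≈ ⟨ p , (λ b → ⟨ q , (λ b′ → φ (b · b′)) ⟩) ⟩
    pair-⊛ []            q = refl
    pair-⊛ ((a , b) ∷ p) q = trans (pair-⊕ (map _ q) (p ⊛ q)) (+-cong (pair-shift a b q) (pair-⊛ p q))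

    pair-linear : ∀ {n} (b : Fin n → B) v {φ} → ⟨ linear b v , φ ⟩ ≈ sum (λ j → ψ (v j) * φ (b j))
    pair-linear {zero}  b v = refl
    pair-linear {suc n} b v = +-congˡ (pair-linear (b ∘ suc) (v ∘ suc))

    pair-*ʳ : ∀ p {φ} x → ⟨ p , (λ b → φ b * x) ⟩ ≈ ⟨ p , φ ⟩ * x
    pair-*ʳ []            x = sym (zeroˡ x)
    pair-*ʳ ((a , b) ∷ p) x = trans (+-cong (sym (*-assoc _ _ _)) (pair-*ʳ p x)) (sym (distribʳ x _ _))

    pair-*ˡ : ∀ p {φ} x → ⟨ p , (λ b → x * φ b) ⟩ ≈ x * ⟨ p , φ ⟩
    pair-*ˡ p x = trans (pair-cong p (λ b → *-comm x _)) (trans (pair-*ʳ p x) (*-comm _ x))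

    private
      remove : B → Alg → Alg
      remove b []             = []
      remove b ((a , b′) ∷ p) = if does (b′ ≟ b) then remove b p else (a , b′) ∷ remove b p

      remove-length : ∀ b p → length (remove b p) ≤ length p
      remove-length b []             = z≤n
      remove-length b ((a , b′) ∷ p) with b′ ≟ b
      ... | yes _ = ℕ.m≤n⇒m≤1+n (remove-length b p)
      ... | no _  = s≤s (remove-length b p)

      pair-remove : ∀ b p {φ} → ⟨ p , φ ⟩ ≈ ψ (coeff p b) * φ b + ⟨ remove b p , φ ⟩
      pair-remove b []             = sym (trans (+-congʳ (trans (*-congʳ ψ-0) (zeroˡ _))) (+-identityˡ _))
      pair-remove b ((a , b′) ∷ p) {φ} with b′ ≟ b
      ... | yes ≡.refl = begin
        ψ a * φ b + ⟨ p , φ ⟩                                       ≈⟨ +-congˡ (pair-remove b p) ⟩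
        ψ a * φ b + (ψ (coeff p b) * φ b + ⟨ remove b p , φ ⟩)      ≈⟨ +-assoc _ _ _ ⟨
        ψ a * φ b + ψ (coeff p b) * φ b + ⟨ remove b p , φ ⟩        ≈⟨ +-congʳ (distribʳ _ _ _) ⟨
        (ψ a + ψ (coeff p b)) * φ b + ⟨ remove b p , φ ⟩            ≈⟨ +-congʳ (*-congʳ (ψ-+ _ _)) ⟨
        ψ (a R.+ coeff p b) * φ b + ⟨ remove b p , φ ⟩              ∎
      ... | no _ = begin
        ψ a * φ b′ + ⟨ p , φ ⟩                                      ≈⟨ +-congˡ (pair-remove b p) ⟩
        ψ a * φ b′ + (ψ (coeff p b) * φ b + ⟨ remove b p , φ ⟩)
            ≈⟨ solve 3 (λ x y z → x :+ (y :+ z) := y :+ (x :+ z)) refl _ _ _ ⟩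
        ψ (coeff p b) * φ b + (ψ a * φ b′ + ⟨ remove b p , φ ⟩)     ∎

      coeff-remove : ∀ b p b′ → coeff (remove b p) b′ ≡ (if does (b ≟ b′) then R.0# else coeff p b′)
      coeff-remove b [] b′ with b ≟ b′
      ... | yes _ = ≡.refl
      ... | no _  = ≡.refl
      coeff-remove b ((a , b″) ∷ p) b′ with b″ ≟ b
      ... | yes ≡.refl with b″ ≟ b′ | coeff-remove b″ p b′
      ...   | yes _ | eq = eq
      ...   | no _  | eq = eq
      coeff-remove b ((a , b″) ∷ p) b′ | no b″≢b with b″ ≟ b′ | b ≟ b′ | coeff-remove b p b′
      ... | yes ≡.refl | yes ≡.refl | _  = contradiction ≡.refl b″≢b
      ... | yes _      | no _       | eq = ≡.cong (a R.+_) eq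
      ... | no _       | yes _      | eq = eq
      ... | no _       | no _       | eq = eq

      -- The terms of one monomial may be scattered over the list. Those of the first monomial are
      -- collected; their total coefficient vanishes, and the shorter remainder still has zero
      -- coefficients.
      vanish : ∀ s p {φ} → length p ≤ s → p ≋ 𝟘 → ⟨ p , φ ⟩ ≈ 0#
      vanish _       []            _         _    = refl
      vanish (suc s) ((a , b) ∷ p) (s≤s p≤s) zero≋ = trans (pair-remove b ((a , b) ∷ p))
        (trans (+-cong (trans (*-congʳ (trans (ψ-cong (zero≋ b)) ψ-0)) (zeroˡ _)) rest) (+-identityʳ 0#))
        where
        shorter : length (remove b ((a , b) ∷ p)) ≤ s
        shorter with b ≟ b
        ... | yes _   = ℕ.≤-trans (remove-length b p) p≤s
        ... | no b≢b = contradiction ≡.refl b≢b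
        rest = vanish s (remove b ((a , b) ∷ p)) shorter λ b′ →
          R.trans (R.reflexive (coeff-remove b ((a , b) ∷ p) b′)) (zero-if b′)
          where
          zero-if : ∀ b′ → (if does (b ≟ b′) then R.0# else coeff ((a , b) ∷ p) b′) R.≈ R.0#
          zero-if b′ with b ≟ b′
          ... | yes _ = R.refl
          ... | no b≢b′ with b ≟ b′ | zero≋ b′
          ...   | yes b≡b′ | _ = contradiction b≡b′ b≢b′
          ...   | no _     | z = z

    pair-vanishes : ∀ p {φ} → p ≋ 𝟘 → ⟨ p , φ ⟩ ≈ 0#
    pair-vanishes p = vanish (length p) p ℕ.≤-refl

  infixl 6 _⟨+⟩_
  infixl 7 _⟨*⟩_

  -- Polynomials in the matrix entries as syntax, so that the same expression can be evaluated at
  -- the generic matrix and at any special one.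
  data Expr (n : ℕ) : Set where
    X         : Fin n → Fin n → Expr n
    ⟨0⟩ ⟨1⟩     : Expr n
    _⟨+⟩_ _⟨*⟩_ : Expr n → Expr n → Expr n
    ⟨-⟩_       : Expr n → Expr n

  Point : ℕ → Set c
  Point n = Fin n → Fin n → Carrier

  ⟦_⟧ : ∀ {n} → Expr n → Point n → Carrier
  ⟦ X i u ⟧   P = P i u
  ⟦ ⟨0⟩ ⟧     P = 0#
  ⟦ ⟨1⟩ ⟧     P = 1#
  ⟦ e ⟨+⟩ f ⟧ P = ⟦ e ⟧ P + ⟦ f ⟧ P
  ⟦ e ⟨*⟩ f ⟧ P = ⟦ e ⟧ P * ⟦ f ⟧ P
  ⟦ ⟨-⟩ e ⟧   P = - ⟦ e ⟧ P

  module _ {n : ℕ} where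
    private
      module Poly = Polynomial ℚ.+-*-commutativeRing (n ℕ.* n)
      open Poly using (Alg; monomial; _⊕_; _⊙_; _⊛_; 𝟘; 𝟙; _≋_)
      fℚ-cong : ∀ {p q} → p ≡ q → fℚ p ≈ fℚ q
      fℚ-cong ≡.refl = refl

      module Ev = Pairing ℚ.+-*-commutativeRing {B = Exponent (n ℕ.* n)} (Vec.≡-dec ℕ._≟_) _+ᵉ_ 0ᵉ fℚ
        fℚ-cong fℚ-0 fℚ-1 fℚ-+ fℚ-*

      polynomial : Expr n → Alg
      polynomial (X i u)   = monomial (var (combine i u))
      polynomial ⟨0⟩       = 𝟘
      polynomial ⟨1⟩       = 𝟙
      polynomial (e ⟨+⟩ f) = polynomial e ⊕ polynomial f
      polynomial (e ⟨*⟩ f) = polynomial e ⊛ polynomial f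
      polynomial (⟨-⟩ e)   = (ℚ.- ℚ.1ℚ) ⊙ polynomial e

      flatten : Point n → Fin (n ℕ.* n) → Carrier
      flatten P i = uncurry P (remQuot n i)

      open import Algebra.Definitions.RawSemiring (Semiring.rawSemiring semiring) using (_^_)

      ^-+ : ∀ x a b → x ^ (a ℕ.+ b) ≈ x ^ a * x ^ b
      ^-+ x zero    b = sym (*-identityˡ _)
      ^-+ x (suc a) b = trans (*-congˡ (^-+ x a b)) (sym (*-assoc _ _ _))

      evalMon : ∀ {m} → (Fin m → Carrier) → Exponent m → Carrier
      evalMon = evaluateMonomial k char0

      evalMon-+ : ∀ {m} (a : Fin m → Carrier) e f → evalMon a (e +ᵉ f) ≈ evalMon a e * evalMon a f
      evalMon-+ {zero}  a e f = sym (*-identityˡ _)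
      evalMon-+ {suc m} a (x ∷ e) (y ∷ f) = begin
        a zero ^ (x ℕ.+ y) * evalMon (a ∘ suc) (e +ᵉ f) ≈⟨ *-cong (^-+ (a zero) x y) (evalMon-+ (a ∘ suc) e f) ⟩
        (a zero ^ x * a zero ^ y) * (evalMon (a ∘ suc) e * evalMon (a ∘ suc) f)
          ≈⟨ solve 4 (λ p q r s → (p :* q) :* (r :* s) := (p :* r) :* (q :* s)) refl _ _ _ _ ⟩
        (a zero ^ x * evalMon (a ∘ suc) e) * (a zero ^ y * evalMon (a ∘ suc) f) ∎

      evalMon-0 : ∀ {m} (a : Fin m → Carrier) → evalMon a 0ᵉ ≈ 1#
      evalMon-0 {zero}  a = refl
      evalMon-0 {suc m} a = trans (*-identityˡ _) (evalMon-0 (a ∘ suc))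

      evalMon-var : ∀ {m} (a : Fin m → Carrier) j → evalMon a (var j) ≈ a j
      evalMon-var a zero    = trans (*-cong (*-identityʳ _) (evalMon-0 (a ∘ suc))) (*-identityʳ _)
      evalMon-var a (suc j) = trans (*-identityˡ _) (evalMon-var (a ∘ suc) j)

      polynomial-eval : ∀ P e → evaluate k char0 (flatten P) (polynomial e) ≈ ⟦ e ⟧ P
      polynomial-eval P (X i u)   = trans (Ev.pair-monomial (var (combine i u)) {evalMon (flatten P)})
          (trans (evalMon-var (flatten P) (combine i u))
        (reflexive (≡.cong (uncurry P) (Fin.remQuot-combine i u))))
      polynomial-eval P ⟨0⟩       = refl
      polynomial-eval P ⟨1⟩       = trans (Ev.pair-monomial 0ᵉ {evalMon (flatten P)}) (evalMon-0 (flatten P))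
      polynomial-eval P (e ⟨+⟩ f) = trans (Ev.pair-⊕ (polynomial e) (polynomial f))
        (+-cong (polynomial-eval P e) (polynomial-eval P f))
      polynomial-eval P (e ⟨*⟩ f) = begin
        Ev.⟨ polynomial e ⊛ polynomial f , φ ⟩ ≈⟨ Ev.pair-⊛ (polynomial e) (polynomial f) ⟩
        Ev.⟨ polynomial e , (λ b → Ev.⟨ polynomial f , (λ b′ → φ (b +ᵉ b′)) ⟩) ⟩
          ≈⟨ Ev.pair-cong (polynomial e) (λ b → trans
              (Ev.pair-cong (polynomial f) (evalMon-+ (flatten P) b)) (Ev.pair-*ˡ (polynomial f) (φ b))) ⟩
        Ev.⟨ polynomial e , (λ b → φ b * Ev.⟨ polynomial f , φ ⟩) ⟩         ≈⟨ Ev.pair-*ʳ (polynomial e) _ ⟩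
        Ev.⟨ polynomial e , φ ⟩ * Ev.⟨ polynomial f , φ ⟩
            ≈⟨ *-cong (polynomial-eval P e) (polynomial-eval P f) ⟩
        ⟦ e ⟧ P * ⟦ f ⟧ P                                                   ∎
        where
        φ = evalMon (flatten P)
      polynomial-eval P (⟨-⟩ e)   = begin
        Ev.⟨ (ℚ.- ℚ.1ℚ) ⊙ polynomial e , evalMon (flatten P) ⟩   ≈⟨ Ev.pair-⊙ (ℚ.- ℚ.1ℚ) (polynomial e) ⟩
        fℚ (ℚ.- ℚ.1ℚ) * _ ≈⟨ *-cong (trans (fℚ-neg ℚ.1ℚ) (-‿cong fℚ-1)) (polynomial-eval P e) ⟩
        - 1# * ⟦ e ⟧ P                                           ≈⟨ -1*x≈-x _ ⟩
        - ⟦ e ⟧ P                                                ∎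

    -- Algebraic independence makes the polynomial of `e` zero, hence its value zero at every point.
    generic-zero : ∀ {A : Point n} → Generic k char0 A → ∀ e → ⟦ e ⟧ A ≈ 0# → ∀ P → ⟦ e ⟧ P ≈ 0#
    generic-zero {A} gen e eA≈0 P = trans (sym (polynomial-eval P e))
      (Ev.pair-vanishes (polynomial e) (gen (polynomial e) (trans (polynomial-eval A e) eA≈0)))

    generic-nonzero : ∀ {A : Point n} → Generic k char0 A → ∀ e P → ¬ ⟦ e ⟧ P ≈ 0# → ¬ ¬ ⟦ e ⟧ A # 0#
    generic-nonzero gen e P eP≉0 = ≉⇒¬¬# λ eA≈0 → eP≉0 (generic-zero gen e eA≈0 P)

  -- Transferring solvability from a special to a generic point

  ¬¬-finite : ∀ {p} {P : Fin n → Set p} → (∀ i → ¬ ¬ P i) → ¬ ¬ (∀ i → P i)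
  ¬¬-finite {zero}  _ = pure λ ()
  ¬¬-finite {suc n} f = f zero >>= λ p₀ → ¬¬-finite (f ∘ suc) >>= λ ps →
    pure λ { zero → p₀ ; (suc i) → ps i }

  Vanishes : (Fin n → Carrier) → Set ℓ₁
  Vanishes f = ∀ i → f i ≈ 0#

  vanishes-or-# : (f : Fin n → Carrier) → ¬ ¬ (Vanishes f ⊎ ∃ λ i → f i # 0#)
  vanishes-or-# {zero}  f = pure (inj₁ λ ())
  vanishes-or-# {suc n} f ¬r = vanishes-or-# (f ∘ suc) λ
    { (inj₂ (i , fi#0)) → ¬r (inj₂ (suc i , fi#0))
    ; (inj₁ rest) → ≉⇒¬¬# (λ f0≈0 → ¬r (inj₁ λ { zero → f0≈0 ; (suc i) → rest i }))
                      (λ f0#0 → ¬r (inj₂ (zero , f0#0))) }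

  sum-zero : {f : Fin n → Carrier} → (∀ i → f i ≈ 0#) → sum f ≈ 0#
  sum-zero {zero}  z = refl
  sum-zero {suc n} z = trans (+-cong (z zero) (sum-zero (z ∘ suc))) (+-identityˡ 0#)

  sum-cong : {f g : Fin n → Carrier} → (∀ i → f i ≈ g i) → sum f ≈ sum g
  sum-cong = sum-cong-≋

  sum-+ : (f g : Fin n → Carrier) → sum (λ i → f i + g i) ≈ sum f + sum g
  sum-+ = ∑-distrib-+

  sum-*ˡ : ∀ x (f : Fin n → Carrier) → sum (λ i → x * f i) ≈ x * sum f
  sum-*ˡ x f = sym (*-distribˡ-sum x f)

  sum-neg : (f : Fin n → Carrier) → sum (λ i → - f i) ≈ - sum f
  sum-neg {n} f = trans (sum-cong {n} λ i → sym (-1*x≈-x (f i))) (trans (sum-*ˡ (- 1#) f) (-1*x≈-x _))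

  sum-single : ∀ (j : Fin n) {f : Fin n → Carrier} → (∀ i → i ≢ j → f i ≈ 0#) → sum f ≈ f j
  sum-single zero    {f} z = trans (+-congˡ (sum-zero λ i → z (suc i) λ ())) (+-identityʳ _)
  sum-single (suc j) {f} z = trans (+-cong (z zero λ ()) (sum-single j λ i i≢j → z (suc i)
      (i≢j ∘ Fin.suc-injective))) (+-identityˡ _)

  Array : ℕ → ℕ → Set c
  Array a b = Fin a → Fin b → Carrier

  dot : Array a b → Array a b → Carrier
  dot M w = sum λ u → sum λ i → M u i * w u i

  dot-cong : {M N w v : Array a b} → (∀ u i → M u i ≈ N u i) → (∀ u i → w u i ≈ v u i) → dot M w ≈ dot N v
  dot-cong {a} {b} M≈N w≈v = sum-cong {a} λ u → sum-cong {b} λ i → *-cong (M≈N u i) (w≈v u i)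

  dot-+ʳ : (M w v : Array a b) → dot M (λ u i → w u i + v u i) ≈ dot M w + dot M v
  dot-+ʳ {a} {b} M w v = trans
    (sum-cong {a} λ u → trans (sum-cong {b} λ i → distribˡ (M u i) (w u i) (v u i))
      (sum-+ (λ i → M u i * w u i) λ i → M u i * v u i))
    (sum-+ (λ u → sum λ i → M u i * w u i) λ u → sum λ i → M u i * v u i)

  dot-*ʳ : ∀ x (M w : Array a b) → dot M (λ u i → x * w u i) ≈ x * dot M w
  dot-*ʳ {a} {b} x M w = trans (sum-cong {a} λ u → trans (sum-cong {b} λ i → swap (M u i) (w u i))
      (sum-*ˡ x (λ i → M u i * w u i)))
    (sum-*ˡ x (λ u → sum λ i → M u i * w u i))
    where
    swap : ∀ p q → p * (x * q) ≈ x * (p * q)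
    swap p q = solve 3 (λ x p q → p :* (x :* q) := x :* (p :* q)) refl x p q

  dot-comm : (M w : Array a b) → dot M w ≈ dot w M
  dot-comm {a} {b} M w = sum-cong {a} λ u → sum-cong {b} λ i → *-comm (M u i) (w u i)

  dot-+ˡ : (M N w : Array a b) → dot (λ u i → M u i + N u i) w ≈ dot M w + dot N w
  dot-+ˡ M N w = trans (dot-comm (λ u i → M u i + N u i) w)
      (trans (dot-+ʳ w M N) (+-cong (dot-comm w M) (dot-comm w N)))

  dot-*ˡ : ∀ x (M w : Array a b) → dot (λ u i → x * M u i) w ≈ x * dot M w
  dot-*ˡ x M w = trans (dot-comm (λ u i → x * M u i) w) (trans (dot-*ʳ x w M) (*-congˡ (dot-comm w M)))

  unit : Fin a → Fin b → Carrier → Array a b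
  unit u₀ i₀ x u i with u Fin.≟ u₀ | i Fin.≟ i₀
  ... | yes _ | yes _ = x
  ... | _     | _     = 0#

  dot-unit : ∀ (M : Array a b) u₀ i₀ x → dot M (unit u₀ i₀ x) ≈ M u₀ i₀ * x
  dot-unit M u₀ i₀ x = trans
    (sum-single u₀ λ u u≢ → sum-zero λ i → trans (*-congˡ (off₁ u i u≢)) (zeroʳ (M u i)))
    (trans (sum-single i₀ λ i i≢ → trans (*-congˡ (off₂ i i≢)) (zeroʳ (M u₀ i))) (*-congˡ on))
    where
    off₁ : ∀ u i → u ≢ u₀ → unit u₀ i₀ x u i ≈ 0#
    off₁ u i u≢ with u Fin.≟ u₀ | i Fin.≟ i₀
    ... | yes u≡ | _     = contradiction u≡ u≢
    ... | no _   | yes _ = refl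
    ... | no _   | no _  = refl
    off₂ : ∀ i → i ≢ i₀ → unit u₀ i₀ x u₀ i ≈ 0#
    off₂ i i≢ with u₀ Fin.≟ u₀ | i Fin.≟ i₀
    ... | _     | yes i≡ = contradiction i≡ i≢
    ... | yes _ | no _   = refl
    ... | no _  | no _   = refl
    on : unit u₀ i₀ x u₀ i₀ ≈ x
    on with u₀ Fin.≟ u₀ | i₀ Fin.≟ i₀
    ... | yes _ | yes _ = refl
    ... | no u≢ | _     = contradiction ≡.refl u≢
    ... | yes _ | no i≢ = contradiction ≡.refl i≢

  -- Linear independence of the active rows, expressed without determinants. Inactive rows allow the
  -- index set to remain all of `Fin m`.
  Solvable : (Fin m → Set) → (Fin m → Array a b) → Set (c ⊔ ℓ₁)
  Solvable Active M = ∀ (t : Fin _ → Carrier) → ∃ λ w → ∀ i → Active i → dot (M i) w ≈ t i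

  at : (Fin m → Fin a → Fin b → Expr n) → Point n → Fin m → Array a b
  at M P r u i = ⟦ M r u i ⟧ P

  module _ {A : Point n} (generic : Generic k char0 A) where

    -- Fraction-free elimination on the polynomial matrix, with pivots that are nonzero at P and
    -- therefore also at A.
    transfer : ∀ {m a b} {Active : Fin m → Set} → (∀ i → Dec (Active i)) →
               (M : Fin m → Fin a → Fin b → Expr n) (P : Point n) →
               Solvable Active (at M P) → ¬ ¬ Solvable Active (at M A)
    transfer {zero} _ M P _ = pure λ t → (λ _ _ → 0#) , λ ()
    transfer {suc m} {a} {b} {Active} active? M P solvable with active? zero
    ... | no inactive = transfer (active? ∘ suc) (M ∘ suc) P tail >>= λ solve → pure λ t →
        let w , eqs = solve (t ∘ suc) in
        w , λ { zero act → contradiction act inactive ; (suc i) act → eqs i act }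
      where
      tail : Solvable (Active ∘ suc) (at (M ∘ suc) P)
      tail t = let w , eqs = solvable (λ { zero → 0# ; (suc i) → t i }) in w , λ i → eqs (suc i)
    ... | yes active₀ = pivot >>= λ (u₀ , i₀ , M₀#0) →
        generic-nonzero generic (M zero u₀ i₀) P (#⇒≉ M₀#0) >>= λ piv#0 →
        transfer (active? ∘ suc) (eliminated u₀ i₀) P (eliminated-solvable u₀ i₀ M₀#0) >>= λ solve →
        pure (back-substitute u₀ i₀ piv#0 solve)
      where
      -- If row zero vanished at P, the right-hand side 1 in that row would have no solution.
      pivot : ¬ ¬ ∃₂ λ u i → ⟦ M zero u i ⟧ P # 0#
      pivot = ¬¬-finite (λ u → vanishes-or-# λ i → ⟦ M zero u i ⟧ P) >>= λ rows ¬p →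
        let w , eqs = solvable (λ { zero → 1# ; (suc i) → 0# }) in
        #⇒≉ 1#0 (trans (sym (eqs zero active₀)) (sum-zero {a} λ u → sum-zero {b} λ i →
          trans (*-congʳ (vanishing ¬p u (rows u) i)) (zeroˡ (w u i))))
        where
        vanishing : ¬ (∃₂ λ u i → ⟦ M zero u i ⟧ P # 0#) →
                    ∀ u → Vanishes (λ i → ⟦ M zero u i ⟧ P) ⊎ (∃ λ i → ⟦ M zero u i ⟧ P # 0#) →
                    Vanishes (λ i → ⟦ M zero u i ⟧ P)
        vanishing ¬p u (inj₁ z) = z
        vanishing ¬p u (inj₂ (i , #0)) = contradiction (u , i , #0) ¬p

      module _ (u₀ : Fin a) (i₀ : Fin b) where
        eliminated : Fin m → Fin a → Fin b → Expr n
        eliminated r u i = M zero u₀ i₀ ⟨*⟩ M (suc r) u i ⟨+⟩ ⟨-⟩ (M (suc r) u₀ i₀) ⟨*⟩ M zero u i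

        dot-eliminated : ∀ Q r w → dot (at eliminated Q r) w ≈
          ⟦ M zero u₀ i₀ ⟧ Q * dot (at M Q (suc r)) w + - ⟦ M (suc r) u₀ i₀ ⟧ Q * dot (at M Q zero) w
        dot-eliminated Q r w = trans (dot-+ˡ (λ u i → ⟦ M zero u₀ i₀ ⟧ Q * ⟦ M (suc r) u i ⟧ Q)
            (λ u i → - ⟦ M (suc r) u₀ i₀ ⟧ Q * ⟦ M zero u i ⟧ Q) w)
          (+-cong (dot-*ˡ _ (at M Q (suc r)) w) (dot-*ˡ _ (at M Q zero) w))

        eliminated-solvable : ⟦ M zero u₀ i₀ ⟧ P # 0# → Solvable (Active ∘ suc) (at eliminated P)
        eliminated-solvable piv#0 t = w , λ r act → begin
            dot (at eliminated P r) w                                             ≈⟨ dot-eliminated P r w ⟩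
            p * dot (at M P (suc r)) w + - ⟦ M (suc r) u₀ i₀ ⟧ P * dot (at M P zero) w
              ≈⟨ +-cong (*-congˡ (eqs (suc r) act)) (*-congˡ (eqs zero active₀)) ⟩
            p * (p⁻¹ * t r) + - ⟦ M (suc r) u₀ i₀ ⟧ P * 0#
                ≈⟨ solve 4 (λ p q t m → p :* (q :* t) :+ :- m :* con (+ 0) := (p :* q) :* t) refl p p⁻¹
                (t r) _ ⟩
            (p * p⁻¹) * t r                                                       ≈⟨ *-congʳ pp⁻¹≈1 ⟩
            1# * t r                                                              ≈⟨ *-identityˡ _ ⟩
            t r                                                                   ∎
          where
          p = ⟦ M zero u₀ i₀ ⟧ P
          p⁻¹ = proj₁ (inverse piv#0)
          pp⁻¹≈1 = proj₂ (inverse piv#0)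
          -- The right-hand side 0 in the pivot row removes its contribution to the eliminated rows,
          -- and `p⁻¹` undoes their factor `p`.
          solution = solvable (λ { zero → 0# ; (suc r) → p⁻¹ * t r })
          w = proj₁ solution
          eqs = proj₂ solution

        back-substitute : ⟦ M zero u₀ i₀ ⟧ A # 0# → Solvable (Active ∘ suc) (at eliminated A) →
                          Solvable Active (at M A)
        back-substitute piv#0 solve′ t = w , λ { zero _ → first ; (suc r) act → other r act }
          where
          p = ⟦ M zero u₀ i₀ ⟧ A
          p⁻¹ = proj₁ (inverse piv#0)
          pp⁻¹≈1 = proj₂ (inverse piv#0)
          q : Fin m → Carrier
          q r = ⟦ M (suc r) u₀ i₀ ⟧ A
          -- The right-hand sides undergo the same elimination as the rows; afterwards `v` is
          -- corrected at the pivot position alone, which settles row zero.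
          solution = solve′ (λ r → p * t (suc r) - q r * t zero)
          v = proj₁ solution
          D₀ = dot (at M A zero) v
          x = p⁻¹ * (t zero - D₀)
          w : Array a b
          w u i = v u i + unit u₀ i₀ x u i
          row : ∀ r → dot (at M A r) w ≈ dot (at M A r) v + ⟦ M r u₀ i₀ ⟧ A * x
          row r = trans (dot-+ʳ (at M A r) v (unit u₀ i₀ x)) (+-congˡ (dot-unit (at M A r) u₀ i₀ x))
          px : p * x ≈ t zero - D₀
          px = trans (sym (*-assoc _ _ _)) (trans (*-congʳ pp⁻¹≈1) (*-identityˡ _))
          first : dot (at M A zero) w ≈ t zero
          first = begin
            dot (at M A zero) w       ≈⟨ row zero ⟩
            D₀ + p * x                ≈⟨ +-congˡ px ⟩
            D₀ + (t zero - D₀)        ≈⟨ solve 2 (λ d t → d :+ (t :- d) := t) refl D₀ (t zero) ⟩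
            t zero                    ∎
          other : ∀ r → Active (suc r) → dot (at M A (suc r)) w ≈ t (suc r)
          other r act = *-cancelʳ-# piv#0 (begin
            dot (at M A (suc r)) w * p     ≈⟨ *-congʳ (row (suc r)) ⟩
            (D + q r * x) * p ≈⟨ solve 4 (λ D q x p → (D :+ q :* x) :* p := p :* D :+ q :* (p :* x)) refl D
                (q r) x p ⟩
            p * D + q r * (p * x)          ≈⟨ +-congˡ (*-congˡ px) ⟩
            p * D + q r * (t zero - D₀) ≈⟨ solve 5
                (λ p D q t d → p :* D :+ q :* (t :- d) := (p :* D :+ :- q :* d) :+ q :* t) refl p D (q r)
                (t zero) D₀ ⟩
            (p * D + - q r * D₀) + q r * t zero          ≈⟨ +-congʳ (dot-eliminated A r v) ⟨
            dot (at eliminated A r) v + q r * t zero     ≈⟨ +-congʳ (proj₂ solution r act) ⟩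
            p * t (suc r) - q r * t zero + q r * t zero
                ≈⟨ solve 4 (λ p t q s → p :* t :- q :* s :+ q :* s := t :* p) refl p (t (suc r)) (q r)
                (t zero) ⟩
            t (suc r) * p                                ∎)
            where D = dot (at M A (suc r)) v

  -- Edge systems and contractions

  ip : (Fin d → Carrier) → (Fin d → Carrier) → Carrier
  ip f g = sum λ i → f i * g i

  ip-cong : {f f′ g g′ : Fin d → Carrier} → (∀ i → f i ≈ f′ i) → (∀ i → g i ≈ g′ i) → ip f g ≈ ip f′ g′
  ip-cong {d} p q = sum-cong {d} λ i → *-cong (p i) (q i)

  ip-+ʳ : (f g h : Fin d → Carrier) → ip f (λ i → g i + h i) ≈ ip f g + ip f h
  ip-+ʳ {d} f g h = trans (sum-cong {d} λ i → distribˡ (f i) (g i) (h i))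
      (sum-+ (λ i → f i * g i) λ i → f i * h i)

  ip-*ˡ : ∀ x (f g : Fin d → Carrier) → ip (λ i → x * f i) g ≈ x * ip f g
  ip-*ˡ {d} x f g = trans (sum-cong {d} λ i → *-assoc x (f i) (g i)) (sum-*ˡ x λ i → f i * g i)

  ip-neg : (f g : Fin d → Carrier) → ip (λ i → - f i) g ≈ - ip f g
  ip-neg {d} f g = trans (sum-cong {d} λ i → sym (-‿distribˡ-* (f i) (g i))) (sum-neg λ i → f i * g i)

  ip-- : (f g h : Fin d → Carrier) → ip (λ i → f i - g i) h ≈ ip f h - ip g h
  ip-- {d} f g h = begin
    ip (λ i → f i - g i) h                ≈⟨ sum-cong {d} (λ i → distribʳ (h i) (f i) (- g i)) ⟩
    sum (λ i → f i * h i + - g i * h i)   ≈⟨ sum-+ (λ i → f i * h i) (λ i → - g i * h i) ⟩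
    ip f h + ip (λ i → - g i) h           ≈⟨ +-congˡ (ip-neg g h) ⟩
    ip f h - ip g h                       ∎

  Coefficients : ℕ → ℕ → Set c
  Coefficients n d = Fin n → Fin n → Fin d → Carrier

  -- The equation of the edge x y in the unknown vectors w. The transposes of the hyperconnectivity
  -- matrix (s = −1) and of the rigidity matrix (s = 1) are the systems of this form used below.
  row : Coefficients n d → Coefficients n d → Fin n → Fin n → Array n d → Carrier
  row α β x y w = ip (α x y) (w y) - ip (β x y) (w x)

  row-cong : {α α′ β β′ : Coefficients n d} {w w′ : Array n d} {x y : Fin n} →
             (∀ i → α x y i ≈ α′ x y i) → (∀ i → β x y i ≈ β′ x y i) →
             (∀ i → w x i ≈ w′ x i) → (∀ i → w y i ≈ w′ y i) →
             row α β x y w ≈ row α′ β′ x y w′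
  row-cong p q r s = +-cong (ip-cong p s) (-‿cong (ip-cong q r))

  Symmetry : Carrier → (Fin n → Fin n → Carrier) → Set ℓ₁
  Symmetry s t = ∀ x y → t y x ≈ s * t x y

  -- Together with s² = 1 this makes the equation of y x the s-fold of that of x y, so an undirected
  -- edge imposes a single condition.
  Swap : Carrier → Coefficients n d → Coefficients n d → Set ℓ₁
  Swap s α β = ∀ x y i → α y x i ≈ - (s * β x y i)

  module _ {s : Carrier} (s*s : s * s ≈ 1#) where

    row-swap : {α β : Coefficients n d} → Swap s α β → ∀ x y w → row α β y x w ≈ s * row α β x y w
    row-swap {d = d} {α} {β} swap x y w = begin
      ip (α y x) (w x) - ip (β y x) (w y)
        ≈⟨ +-cong (trans (ip-cong (swap x y) (λ _ → refl))
            (trans (ip-neg (λ i → s * β x y i) (w x)) (-‿cong (ip-*ˡ s (β x y) (w x)))))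
                  (-‿cong (trans (ip-cong swap′ (λ _ → refl))
                      (trans (ip-neg (λ i → s * α x y i) (w y)) (-‿cong (ip-*ˡ s (α x y) (w y)))))) ⟩
      - (s * ip (β x y) (w x)) - - (s * ip (α x y) (w y))
        ≈⟨ solve 3 (λ s p q → :- (s :* p) :- :- (s :* q) := s :* (q :- p)) refl s _ _ ⟩
      s * row α β x y w ∎
      where
      swap′ : ∀ i → β y x i ≈ - (s * α x y i)
      swap′ i = begin
        β y x i                   ≈⟨ *-identityˡ _ ⟨
        1# * β y x i              ≈⟨ *-congʳ s*s ⟨
        s * s * β y x i           ≈⟨ solve 2 (λ s b → s :* s :* b := :- (s :* :- (s :* b))) refl s (β y x i) ⟩
        - (s * - (s * β y x i))   ≈⟨ -‿cong (*-congˡ (swap y x i)) ⟨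
        - (s * α x y i)           ∎

    -- Both orientations of an edge are listed; restricting to `Symmetry s t` keeps their right-hand
    -- sides compatible.
    System : Rel (Fin n) 0ℓ → Coefficients n d → Coefficients n d → Set (c ⊔ ℓ₁)
    System {n} E α β = ∀ t → Symmetry {n} s t → ∃ λ w → ∀ x y → E x y → row α β x y w ≈ t x y

    module _ {A : Point n} (generic : Generic k char0 A)
             {E : Rel (Fin n) 0ℓ} (E? : ∀ x y → Dec (E x y)) (E-sym : ∀ {x y} → E x y → E y x)
             (loops : ∀ {x} → E x x → s ≈ 1#)
             (α β : Fin n → Fin n → Fin d → Expr n) where

      private
        _‼_ : (Fin n → Fin n → Fin d → Expr n) → Point n → Coefficients n d
        (γ ‼ P) x y i = ⟦ γ x y i ⟧ P

        pick : Fin n → (Fin d → Expr n) → Fin n → Fin d → Expr n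
        pick y e u i with u Fin.≟ y
        ... | yes _ = e i
        ... | no _  = ⟨0⟩

        matrix : Fin n → Fin n → Fin n → Fin d → Expr n
        matrix x y u i = pick y (α x y) u i ⟨+⟩ ⟨-⟩ pick x (β x y) u i

        dot-pick : ∀ P y e w → dot (λ u i → ⟦ pick y e u i ⟧ P) w ≈ ip (λ i → ⟦ e i ⟧ P) (w y)
        dot-pick P y e w = trans (sum-single y {λ u → sum λ i → ⟦ pick y e u i ⟧ P * w u i} off)
          (ip-cong on (λ _ → refl))
          where
          off : ∀ u → u ≢ y → sum (λ i → ⟦ pick y e u i ⟧ P * w u i) ≈ 0#
          off u u≢y with u Fin.≟ y
          ... | yes u≡y = contradiction u≡y u≢y
          ... | no _    = sum-zero {d} λ i → zeroˡ (w u i)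
          on : ∀ i → ⟦ pick y e y i ⟧ P ≈ ⟦ e i ⟧ P
          on i with y Fin.≟ y
          ... | yes _   = refl
          ... | no y≢y = contradiction ≡.refl y≢y

        dot-matrix : ∀ P x y w → dot (λ u i → ⟦ matrix x y u i ⟧ P) w ≈ row (α ‼ P) (β ‼ P) x y w
        dot-matrix P x y w = trans (dot-+ˡ (λ u i → ⟦ pick y (α x y) u i ⟧ P)
            (λ u i → - ⟦ pick x (β x y) u i ⟧ P) w)
          (+-cong (dot-pick P y (α x y) w)
            (trans (dot-cong {M = λ u i → - ⟦ pick x (β x y) u i ⟧ P}
                {λ u i → - 1# * ⟦ pick x (β x y) u i ⟧ P} {w} {w}
                      (λ u i → sym (-1*x≈-x _)) (λ _ _ → refl))
              (trans (dot-*ˡ (- 1#) (λ u i → ⟦ pick x (β x y) u i ⟧ P) w)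
                (trans (-1*x≈-x _) (-‿cong (dot-pick P x (β x y) w))))))

        Active : Fin (n ℕ.* n) → Set
        Active r = let x , y = remQuot n r in x ≤ᶠ y × E x y

        rows : Fin (n ℕ.* n) → Fin n → Fin d → Expr n
        rows r = let x , y = remQuot n r in matrix x y

        -- There is one row for each pair x ≤ y. An arbitrary right-hand side on these is extended
        -- by symmetry to `t̂`; on the diagonal this is consistent because a loop forces s = 1, and
        -- 0 stands where there is no loop.
        system⇒solvable : ∀ P → System E (α ‼ P) (β ‼ P) → Solvable Active (at rows P)
        system⇒solvable P system t = w , λ r (x≤y , e) → let x , y = remQuot n r in
          trans (dot-matrix P x y w) (trans (eqs x y e)
              (trans (t̂-≤ x≤y e) (reflexive (≡.cong t (Fin.combine-remQuot {n} n r)))))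
          where
          t̂ : Fin n → Fin n → Carrier
          t̂ x y with Fin.<-cmp x y | E? x y
          ... | tri< _ _ _ | _     = t (combine x y)
          ... | tri≈ _ _ _ | yes _ = t (combine x y)
          ... | tri≈ _ _ _ | no _  = 0#
          ... | tri> _ _ _ | _     = s * t (combine y x)
          t̂-≤ : ∀ {x y} → x ≤ᶠ y → E x y → t̂ x y ≈ t (combine x y)
          t̂-≤ {x} {y} x≤y e with Fin.<-cmp x y | E? x y
          ... | tri< _ _ _   | _     = refl
          ... | tri≈ _ _ _   | yes _ = refl
          ... | tri≈ _ _ _   | no ¬e = contradiction e ¬e
          ... | tri> _ _ y<x | _     = contradiction y<x (ℕ.≤⇒≯ x≤y)
          t̂-sym : Symmetry s t̂
          t̂-sym x y with Fin.<-cmp x y | Fin.<-cmp y x | E? x y | E? y x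
          ... | tri< x<y _ _ | tri< _ _ x≯y | _ | _ = contradiction x<y x≯y
          ... | tri< _ x≢y _ | tri≈ _ y≡x _ | _ | _ = contradiction (≡.sym y≡x) x≢y
          ... | tri< _ _ _ | tri> _ _ _ | _ | _ = refl
          ... | tri≈ _ x≡y _ | tri< _ y≢x _ | _ | _ = contradiction (≡.sym x≡y) y≢x
          ... | tri≈ _ ≡.refl _ | tri≈ _ _ _ | yes e | yes _ = sym (trans (*-congʳ (loops e)) (*-identityˡ _))
          ... | tri≈ _ ≡.refl _ | tri≈ _ _ _ | no _ | no _ = sym (zeroʳ s)
          ... | tri≈ _ ≡.refl _ | tri≈ _ _ _ | yes e | no ¬e = contradiction e ¬e
          ... | tri≈ _ ≡.refl _ | tri≈ _ _ _ | no ¬e | yes e = contradiction e ¬e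
          ... | tri≈ _ x≡y _ | tri> _ y≢x _ | _ | _ = contradiction (≡.sym x≡y) y≢x
          ... | tri> _ _ _ | tri< _ _ _ | _ | _ = trans (sym (*-identityˡ _))
              (trans (*-congʳ (sym s*s)) (*-assoc _ _ _))
          ... | tri> _ x≢y _ | tri≈ _ y≡x _ | _ | _ = contradiction (≡.sym y≡x) x≢y
          ... | tri> _ _ y<x | tri> y≮x _ _ | _ | _ = contradiction y<x y≮x
          solution = system t̂ t̂-sym
          w = proj₁ solution
          eqs = proj₂ solution

        solvable⇒system : ∀ P → Swap s (α ‼ P) (β ‼ P) → Solvable Active (at rows P) →
                          System E (α ‼ P) (β ‼ P)
        solvable⇒system P swap solvable t t-sym = w , eqs
          where
          solution = solvable (λ r → uncurry t (remQuot n r))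
          w = proj₁ solution
          ordered : ∀ x y → x ≤ᶠ y → E x y → row (α ‼ P) (β ‼ P) x y w ≈ t x y
          ordered x y x≤y e = trans (sym (dot-matrix P x y w)) (≡.subst
            (λ p → proj₁ p ≤ᶠ proj₂ p × E (proj₁ p) (proj₂ p) →
                   dot (λ u i → ⟦ matrix (proj₁ p) (proj₂ p) u i ⟧ P) w ≈ t (proj₁ p) (proj₂ p))
            (Fin.remQuot-combine {n} {n} x y) (proj₂ solution (combine x y)) (x≤y , e))
          eqs : ∀ x y → E x y → row (α ‼ P) (β ‼ P) x y w ≈ t x y
          eqs x y e with ℕ.≤-total (toℕ x) (toℕ y)
          ... | inj₁ x≤y = ordered x y x≤y e
          ... | inj₂ y≤x = trans (row-swap swap y x w)
              (trans (*-congˡ (ordered y x y≤x (E-sym e))) (sym (t-sym y x)))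

      system-transfer : (∀ P → Swap s (λ x y i → ⟦ α x y i ⟧ P) (λ x y i → ⟦ β x y i ⟧ P)) → ∀ P →
                        System E (λ x y i → ⟦ α x y i ⟧ P) (λ x y i → ⟦ β x y i ⟧ P) →
                        ¬ ¬ System E (λ x y i → ⟦ α x y i ⟧ A) (λ x y i → ⟦ β x y i ⟧ A)
      system-transfer swap P system =
        transfer generic (λ r → let x , y = remQuot n r in (x Fin.≤? y) ×-dec E? x y) rows P (system⇒solvable P system)
        >>= λ solvable → pure (solvable⇒system A (swap A) solvable)

    -- Look for a solution with w v = w u + z: the equations at u and v of a common neighbour x
    -- differ by a condition on z alone, and so does the equation of the edge u v.
    contraction-system : (G : Graph n) {u v : Fin n} → Adjacent G u v →
      {α β α′ β′ : Coefficients n d} → Swap s α β →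
      (∀ {x y} → x ≢ v → y ≢ v → ∀ i → α x y i ≈ α′ x y i × β x y i ≈ β′ x y i) →
      (∀ {x} → x ≢ u → x ≢ v → ∀ i → α x v i ≈ α x u i × β x v i ≈ β x u i) →
      (∀ i → α u v i ≈ β u v i) →
      (∀ τ → ∃ λ z → ip (α u v) z ≈ τ u × (∀ x → Adjacent G u x → Adjacent G v x → ip (α x u) z ≈ τ x)) →
      System (Adjacent (contract G u v)) α′ β′ → System (Adjacent G) α β
    contraction-system {n} {d} G {u} {v} u~v {α} {β} {α′} {β′} swap agree coincide edge-row solve-z system t
        t-sym =
      w , eqs
      where
      open Graph G
      u≢v : u ≢ v
      u≢v u≡v = ~-irrefl u≡v u~v
      -- The right-hand sides of the conditions on z, with the index u standing for the edge u v.
      difference : Fin n → Carrier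
      difference x with x Fin.≟ u
      ... | yes _ = t u v
      ... | no _  = t x v - t x u
      z-solution = solve-z difference
      z = proj₁ z-solution
      z-edge : ip (α u v) z ≈ t u v
      z-edge = trans (proj₁ (proj₂ z-solution)) (reflexive difference-u)
        where
        difference-u : difference u ≡ t u v
        difference-u with u Fin.≟ u
        ... | yes _   = ≡.refl
        ... | no u≢u = contradiction ≡.refl u≢u
      z-common : ∀ {x} → u ~ x → v ~ x → ip (α x u) z ≈ t x v - t x u
      z-common {x} u~x v~x = trans (proj₂ (proj₂ z-solution) x u~x v~x) (reflexive difference-x)
        where
        difference-x : difference x ≡ t x v - t x u
        difference-x with x Fin.≟ u
        ... | yes ≡.refl = contradiction u~x (~-irrefl ≡.refl)
        ... | no _       = ≡.refl
      -- For x adjacent to v but not to u, the contracted edge x u gets the value that makes the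
      -- equation of x v come out right once z is added.
      τ : Fin n → Carrier
      τ x with x ~? u
      ... | yes _ = t x u
      ... | no _  = t x v - ip (α x u) z
      τ-adjacent : ∀ {x} → x ~ u → τ x ≡ t x u
      τ-adjacent {x} x~u with x ~? u
      ... | yes _   = ≡.refl
      ... | no x≁u = contradiction x~u x≁u
      τ-v : ∀ {x} → x ~ v → τ x + ip (α x u) z ≈ t x v
      τ-v {x} x~v with x ~? u
      ... | yes x~u = trans (+-congˡ (z-common (~-sym x~u) (~-sym x~v)))
          (solve 2 (λ a b → b :+ (a :- b) := a) refl (t x v) (t x u))
      ... | no _    = solve 2 (λ a b → a :- b :+ b := a) refl (t x v) (ip (α x u) z)
      t′ : Fin n → Fin n → Carrier
      t′ x y with x Fin.≟ u | y Fin.≟ u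
      ... | yes _ | yes _ = 0#
      ... | yes _ | no _  = s * τ y
      ... | no _  | yes _ = τ x
      ... | no _  | no _  = t x y
      t′-sym : Symmetry s t′
      t′-sym x y with x Fin.≟ u | y Fin.≟ u
      ... | yes _ | yes _ = sym (zeroʳ s)
      ... | yes _ | no _  = trans (sym (*-identityˡ _)) (trans (*-congʳ (sym s*s)) (*-assoc _ _ _))
      ... | no _  | yes _ = refl
      ... | no _  | no _  = t-sym x y
      solution = system t′ t′-sym
      w′ = proj₁ solution
      w : Array n d
      w x i with x Fin.≟ v
      ... | yes _ = w′ u i + z i
      ... | no _  = w′ x i
      w-v : ∀ i → w v i ≈ w′ u i + z i
      w-v i with v Fin.≟ v
      ... | yes _   = refl
      ... | no v≢v = contradiction ≡.refl v≢v
      w-other : ∀ {x} → x ≢ v → ∀ i → w x i ≈ w′ x i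
      w-other {x} x≢v i with x Fin.≟ v
      ... | yes x≡v = contradiction x≡v x≢v
      ... | no _    = refl
      E′ = Adjacent (contract G u v)
      inner : ∀ {x y} → E′ x y → row α β x y w′ ≈ t′ x y
      inner {x} {y} e@(x≢v , y≢v , _) = trans
        (row-cong {α = α} {α′} {β} {β′} {w′} {w′} (λ i → proj₁ (agree x≢v y≢v i))
            (λ i → proj₂ (agree x≢v y≢v i)) (λ _ → refl) (λ _ → refl))
        (proj₂ solution x y e)
      inner-u : ∀ {x} → x ≢ u → E′ x u → row α β x u w′ ≈ τ x
      inner-u {x} x≢u e = trans (inner e) (reflexive t′-u)
        where
        t′-u : t′ x u ≡ τ x
        t′-u with x Fin.≟ u | u Fin.≟ u
        ... | yes x≡u | _       = contradiction x≡u x≢u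
        ... | no _    | yes _   = ≡.refl
        ... | no _    | no u≢u = contradiction ≡.refl u≢u
      to-v : ∀ x → x ~ v → row α β x v w ≈ t x v
      to-v x x~v with x Fin.≟ u
      ... | yes ≡.refl = begin
        ip (α u v) (w v) - ip (β u v) (w u)
          ≈⟨ +-cong (trans (ip-cong (λ _ → refl) w-v) (ip-+ʳ (α u v) (w′ u) z))
                    (-‿cong (ip-cong (λ i → sym (edge-row i)) (w-other u≢v))) ⟩
        ip (α u v) (w′ u) + ip (α u v) z - ip (α u v) (w′ u)
          ≈⟨ solve 2 (λ a b → a :+ b :- a := b) refl (ip (α u v) (w′ u)) (ip (α u v) z) ⟩
        ip (α u v) z   ≈⟨ z-edge ⟩
        t u v          ∎
      ... | no x≢u = begin
        ip (α x v) (w v) - ip (β x v) (w x)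
          ≈⟨ +-cong (trans (ip-cong (λ i → proj₁ (coincide x≢u x≢v i)) w-v) (ip-+ʳ (α x u) (w′ u) z))
                    (-‿cong (ip-cong (λ i → proj₂ (coincide x≢u x≢v i)) (w-other x≢v))) ⟩
        ip (α x u) (w′ u) + ip (α x u) z - ip (β x u) (w′ x)
          ≈⟨ solve 3 (λ a b c → a :+ b :- c := a :- c :+ b) refl (ip (α x u) (w′ u)) (ip (α x u) z)
              (ip (β x u) (w′ x)) ⟩
        row α β x u w′ + ip (α x u) z
          ≈⟨ +-congʳ (inner-u x≢u (x≢v , u≢v , x≢u , inj₂ (inj₂ (≡.refl , x~v)))) ⟩
        τ x + ip (α x u) z   ≈⟨ τ-v x~v ⟩
        t x v                ∎
        where
        x≢v : x ≢ v
        x≢v x≡v = ~-irrefl x≡v x~v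
      row-w : ∀ {x y} → x ≢ v → y ≢ v → row α β x y w ≈ row α β x y w′
      row-w x≢v y≢v = row-cong {α = α} {α} {β} {β} {w} {w′} (λ _ → refl) (λ _ → refl) (w-other x≢v)
          (w-other y≢v)
      to-u : ∀ {x} → x ≢ u → x ≢ v → x ~ u → row α β x u w ≈ t x u
      to-u x≢u x≢v x~u = trans (row-w x≢v u≢v)
        (trans (inner-u x≢u (x≢v , u≢v , x≢u , inj₁ x~u)) (reflexive (τ-adjacent x~u)))
      flip : ∀ {x y} → row α β y x w ≈ t y x → row α β x y w ≈ t x y
      flip {x} {y} eq = trans (row-swap swap y x w) (trans (*-congˡ eq) (sym (t-sym y x)))
      eqs : ∀ x y → x ~ y → row α β x y w ≈ t x y
      eqs x y x~y = cases (x Fin.≟ v) (y Fin.≟ v) (x Fin.≟ u) (y Fin.≟ u)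
        where
        cases : Dec (x ≡ v) → Dec (y ≡ v) → Dec (x ≡ u) → Dec (y ≡ u) → row α β x y w ≈ t x y
        cases _ (yes ≡.refl) _ _ = to-v x x~y
        cases (yes ≡.refl) (no _) _ _ = flip (to-v y (~-sym x~y))
        cases (no x≢v) (no y≢v) (yes ≡.refl) (yes ≡.refl) = contradiction x~y (~-irrefl ≡.refl)
        cases (no x≢v) (no y≢v) (no x≢u) (yes ≡.refl) = to-u x≢u x≢v x~y
        cases (no x≢v) (no y≢v) (yes ≡.refl) (no y≢u) = flip (to-u y≢u y≢v (~-sym x~y))
        cases (no x≢v) (no y≢v) (no x≢u) (no y≢u) = trans (row-w x≢v y≢v)
          (trans (inner (x≢v , y≢v , (λ x≡y → ~-irrefl x≡y x~y) , inj₁ x~y)) (reflexive t′-xy))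
          where
          t′-xy : t′ x y ≡ t x y
          t′-xy with x Fin.≟ u | y Fin.≟ u
          ... | yes x≡u | _       = contradiction x≡u x≢u
          ... | no _    | yes y≡u = contradiction y≡u y≢u
          ... | no _    | no _    = ≡.refl

  -- The hyperconnectivity and rigidity systems

  1*1≈1 : 1# * 1# ≈ 1#
  1*1≈1 = *-identityˡ 1#

  -1*-1≈1 : - 1# * - 1# ≈ 1#
  -1*-1≈1 = trans (-1*x≈-x (- 1#)) (-‿involutive 1#)

  -- Distinct active vertices get distinct standard basis vectors, which is possible since there are
  -- at most d; this is the special point that witnesses generic independence.
  module Basis {Active : Fin n → Set} (Active? : ∀ x → Dec (Active x)) (few : count Active? ℕ.≤ d) where
    open Enumeration (enumerate Active?)

    rank : Fin n → ℕ
    rank x with Active? x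
    ... | yes p = toℕ (proj₁ (index p))
    -- Out of range, so an inactive vertex gets the zero vector.
    ... | no _  = d

    rank-< : ∀ {x} → Active x → rank x ℕ.< d
    rank-< {x} p with Active? x
    ... | yes q = ℕ.<-≤-trans (Fin.toℕ<n _) few
    ... | no ¬p = contradiction p ¬p

    rank-injective : ∀ {x y} → Active x → Active y → rank x ≡ rank y → x ≡ y
    rank-injective {x} {y} p q eq with Active? x | Active? y
    ... | no ¬p | _     = contradiction p ¬p
    ... | yes _ | no ¬q = contradiction q ¬q
    ... | yes p | yes q = ≡.trans (≡.sym (proj₂ (index p)))
      (≡.trans (≡.cong elem (Fin.toℕ-injective eq)) (proj₂ (index q)))

    basis : Fin n → Fin d → Carrier
    basis x i with toℕ i ℕ.≟ rank x
    ... | yes _ = 1#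
    ... | no _  = 0#

    basis-solvable : ∀ τ → ∃ λ z → ∀ x → Active x → ip (basis x) z ≈ τ x
    basis-solvable τ = z , solves
      where
      z : Fin d → Carrier
      z i with Fin.any? (λ x → Active? x ×-dec (rank x ℕ.≟ toℕ i))
      ... | yes (x , _) = τ x
      ... | no _        = 0#
      solves : ∀ x → Active x → ip (basis x) z ≈ τ x
      solves x p = trans (sum-single i₀ off) (trans (*-cong on z≈τ) (*-identityˡ _))
        where
        i₀ = fromℕ< (rank-< p)
        toℕ-i₀ : toℕ i₀ ≡ rank x
        toℕ-i₀ = Fin.toℕ-fromℕ< (rank-< p)
        off : ∀ i → i ≢ i₀ → basis x i * z i ≈ 0#
        off i i≢i₀ with toℕ i ℕ.≟ rank x
        ... | yes eq = contradiction (Fin.toℕ-injective (≡.trans eq (≡.sym toℕ-i₀))) i≢i₀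
        ... | no _   = zeroˡ (z i)
        on : basis x i₀ ≈ 1#
        on with toℕ i₀ ℕ.≟ rank x
        ... | yes _  = refl
        ... | no neq = contradiction toℕ-i₀ neq
        z≈τ : z i₀ ≈ τ x
        z≈τ with Fin.any? (λ y → Active? y ×-dec (rank y ℕ.≟ toℕ i₀))
        ... | yes (y , q , eq) = reflexive (≡.cong τ (rank-injective q p (≡.trans eq toℕ-i₀)))
        ... | no none = contradiction (x , p , ≡.sym toℕ-i₀) none

    -- It is enough that `F` specialises to the basis vectors at one point; the conditions on z are
    -- then transferred to A as a system with a single block of unknowns.
    generic-independent : {A : Point n} → Generic k char0 A → (F : Fin n → Fin d → Expr n) (P : Point n) →
      (∀ x → Active x → ∀ i → ⟦ F x i ⟧ P ≈ basis x i) →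
      ¬ ¬ (∀ τ → ∃ λ z → ∀ x → Active x → ip (λ i → ⟦ F x i ⟧ A) z ≈ τ x)
    generic-independent generic F P at-P =
      transfer generic {a = 1} Active? (λ x _ → F x) P
        (λ τ → let z , eqs = basis-solvable τ in (λ _ → z) ,
          λ x p → trans (+-identityʳ _) (trans (ip-cong (at-P x p) (λ _ → refl)) (eqs x p)))
      >>= λ solve → pure λ τ → let w , eqs = solve τ in w zero , λ x p → trans (sym (+-identityʳ _)) (eqs x p)

  module Generically {n : ℕ} {A : Point n} (generic : Generic k char0 A) where

    module _ {d} (κ : Fin d → Fin n) (κ-injective : ∀ {i j} → κ i ≡ κ j → i ≡ j) where

      extend : (Fin n → Fin d → Carrier) → Point n
      extend f j x with Fin.any? (λ i → κ i Fin.≟ j)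
      ... | yes (i , _) = f x i
      ... | no _        = 0#

      extend-κ : ∀ f i x → extend f (κ i) x ≡ f x i
      extend-κ f i x with Fin.any? (λ j → κ j Fin.≟ κ i)
      ... | yes (j , eq) = ≡.cong (f x) (κ-injective eq)
      ... | no none      = contradiction (i , ≡.refl) none

      module _ {s : Carrier} (s*s : s * s ≈ 1#) where
        edgeless-system : ∀ {G : Graph n} {α β : Coefficients n d} → (∀ {x y} → ¬ Adjacent G x y) →
                          System s*s (Adjacent G) α β
        edgeless-system none t _ = (λ _ _ → 0#) , λ x y e → contradiction e none

      module _ (G : Graph n) {u v : Fin n} (u~v : Adjacent G u v) (c<d : common G u v ℕ.< d) where
        open Graph G

        u≢v : u ≢ v
        u≢v u≡v = ~-irrefl u≡v u~v

        -- The indices of the conditions on z in `contraction-system`: u for the edge itself and one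
        -- for each common neighbour, hence at most d in all.
        Relevant : Fin n → Set
        Relevant x = x ≡ u ⊎ (u ~ x × v ~ x)

        relevant? : ∀ x → Dec (Relevant x)
        relevant? x = (x Fin.≟ u) ⊎-dec ((u ~? x) ×-dec (v ~? x))

        few : count relevant? ℕ.≤ d
        few = ℕ.≤-trans (count-insert relevant? (λ x → (u ~? x) ×-dec (v ~? x)) {u}
          λ { (inj₁ x≡u) x≢u → contradiction x≡u x≢u ; (inj₂ p) _ → p }) c<d

        open Basis {d = d} relevant? few public

      αᵉ βᵉ : Fin n → Fin n → Fin d → Expr n
      αᵉ x y i = X (κ i) x
      βᵉ x y i = X (κ i) y

      ExteriorSystem : Graph n → Set _
      ExteriorSystem G = System -1*-1≈1 (Adjacent G) (λ x y i → A (κ i) x) (λ x y i → A (κ i) y)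

      exterior-swap : ∀ P → Swap (- 1#) (λ x y i → ⟦ αᵉ x y i ⟧ P) (λ x y i → ⟦ βᵉ x y i ⟧ P)
      exterior-swap P x y i = sym (trans (-‿cong (-1*x≈-x _)) (-‿involutive _))

      -- P is A with the point of v moved to that of u, so the coefficients at v agree with those at
      -- u and `contraction-system` applies. Transferring back to A after each contraction makes the
      -- result usable in the next one.
      exterior-system : ∀ {G} → Reducible d G → ¬ ¬ ExteriorSystem G
      exterior-system {G} (edgeless none) = pure (edgeless-system -1*-1≈1 {G} none)
      exterior-system {G} (contraction {u} {v} u~v c<d R) =
        exterior-system R >>= λ system →
        generic-independent G u~v c<d {A = A} generic (λ x i → X (κ i) x) (extend (basis G u~v c<d))
          (λ x _ i → reflexive (extend-κ _ i x)) >>= λ independent →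
        system-transfer -1*-1≈1 {A = A} generic _~?_ ~-sym (λ e → contradiction e (~-irrefl ≡.refl)) αᵉ βᵉ
            exterior-swap P
          (contraction-system -1*-1≈1 G u~v (exterior-swap P)
            (λ x≢v y≢v i → reflexive (P-other (κ i) x≢v) , reflexive (P-other (κ i) y≢v))
            (λ _ _ i → refl , reflexive (≡.trans (P-v (κ i)) (≡.sym (P-other (κ i) (u≢v G u~v c<d)))))
            (λ i → reflexive (≡.trans (P-other (κ i) (u≢v G u~v c<d)) (≡.sym (P-v (κ i)))))
            (λ τ → let z , eqs = independent τ in z ,
              trans (ip-cong (λ i → reflexive (P-other (κ i) (u≢v G u~v c<d))) (λ _ → refl))
                  (eqs u (inj₁ ≡.refl)) ,
              λ x u~x v~x → trans (ip-cong (λ i → reflexive (P-other (κ i) λ { ≡.refl → ~-irrefl ≡.refl v~x })) (λ _ → refl))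
                (eqs x (inj₂ (u~x , v~x))))
            system)
        where
        open Graph G
        P : Point n
        P j x with x Fin.≟ v
        ... | yes _ = A j u
        ... | no _  = A j x
        P-v : ∀ j → P j v ≡ A j u
        P-v j with v Fin.≟ v
        ... | yes _   = ≡.refl
        ... | no v≢v = contradiction ≡.refl v≢v
        P-other : ∀ j {x} → x ≢ v → P j x ≡ A j x
        P-other j {x} x≢v with x Fin.≟ v
        ... | yes x≡v = contradiction x≡v x≢v
        ... | no _    = ≡.refl

      -- The rigidity matrix

      αʳ : Fin n → Fin n → Fin d → Expr n
      αʳ x y i = X (κ i) x ⟨+⟩ ⟨-⟩ X (κ i) y

      RigiditySystem : Graph n → Set _
      RigiditySystem G = System 1*1≈1 (Adjacent G) (λ x y i → A (κ i) x - A (κ i) y)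
          (λ x y i → A (κ i) x - A (κ i) y)

      difference-swap : ∀ a b → b - a ≈ - (1# * (a - b))
      difference-swap a b = trans (solve 2 (λ a b → b :- a := :- (a :- b)) refl a b)
          (-‿cong (sym (*-identityˡ _)))

      module _ (η : Fin n) (κ≢η : ∀ i → κ i ≢ η) where

        -- Both endpoints of the contracted edge collapse to the same point as ε = X η η tends to 0.
        module Collapse (G : Graph n) {u v : Fin n} (u~v : Adjacent G u v) (c<d : common G u v ℕ.< d) where
          open Graph G
          private
            u≢v′ = u≢v G u~v c<d

          placed : Fin n → Fin d → Expr n
          placed x i with x Fin.≟ v
          ... | yes _ = X (κ i) u ⟨+⟩ X η η ⟨*⟩ X (κ i) v
          ... | no _  = X (κ i) x

          -- The difference of the placed points, except that for the edge u v it is divided by ε: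
          -- at ε = 0 the undivided row would vanish and its equation could not be solved for a
          -- nonzero right-hand side.
          α̃ : Fin n → Fin n → Fin d → Expr n
          α̃ x y i with (x Fin.≟ u) ×-dec (y Fin.≟ v) | (x Fin.≟ v) ×-dec (y Fin.≟ u)
          ... | yes _ | _     = ⟨-⟩ X (κ i) v
          ... | no _  | yes _ = X (κ i) v
          ... | no _  | no _  = placed x i ⟨+⟩ ⟨-⟩ placed y i

          α̃-edge : ∀ i → α̃ u v i ≡ ⟨-⟩ X (κ i) v
          α̃-edge i with (u Fin.≟ u) ×-dec (v Fin.≟ v) | (u Fin.≟ v) ×-dec (v Fin.≟ u)
          ... | yes _ | _ = ≡.refl
          ... | no ¬p | _ = contradiction (≡.refl , ≡.refl) ¬p

          α̃-edge′ : ∀ i → α̃ v u i ≡ X (κ i) v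
          α̃-edge′ i with (v Fin.≟ u) ×-dec (u Fin.≟ v) | (v Fin.≟ v) ×-dec (u Fin.≟ u)
          ... | yes (v≡u , _) | _ = contradiction (≡.sym v≡u) u≢v′
          ... | no _ | yes _ = ≡.refl
          ... | no _ | no ¬p = contradiction (≡.refl , ≡.refl) ¬p

          α̃-other : ∀ {x y} → ¬ (x ≡ u × y ≡ v) → ¬ (x ≡ v × y ≡ u) → ∀ i → α̃ x y i ≡ placed x i ⟨+⟩ ⟨-⟩
              placed y i
          α̃-other {x} {y} ¬p ¬q i with (x Fin.≟ u) ×-dec (y Fin.≟ v) | (x Fin.≟ v) ×-dec (y Fin.≟ u)
          ... | yes p | _     = contradiction p ¬p
          ... | no _  | yes q = contradiction q ¬q
          ... | no _  | no _  = ≡.refl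

          placed-v : ∀ i → placed v i ≡ X (κ i) u ⟨+⟩ X η η ⟨*⟩ X (κ i) v
          placed-v i with v Fin.≟ v
          ... | yes _   = ≡.refl
          ... | no v≢v = contradiction ≡.refl v≢v

          placed-other : ∀ {x} → x ≢ v → ∀ i → placed x i ≡ X (κ i) x
          placed-other {x} x≢v i with x Fin.≟ v
          ... | yes x≡v = contradiction x≡v x≢v
          ... | no _    = ≡.refl

          α̃-swap : ∀ P → Swap 1# (λ x y i → ⟦ α̃ x y i ⟧ P) (λ x y i → ⟦ α̃ x y i ⟧ P)
          α̃-swap P x y i = cases ((x Fin.≟ u) ×-dec (y Fin.≟ v)) ((x Fin.≟ v) ×-dec (y Fin.≟ u))
            where
            value : ∀ {e f} → e ≡ f → ⟦ e ⟧ P ≈ ⟦ f ⟧ P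
            value = reflexive ∘ ≡.cong (λ e → ⟦ e ⟧ P)
            cases : Dec (x ≡ u × y ≡ v) → Dec (x ≡ v × y ≡ u) → ⟦ α̃ y x i ⟧ P ≈ - (1# * ⟦ α̃ x y i ⟧ P)
            cases (yes (≡.refl , ≡.refl)) _ = trans (value (α̃-edge′ i))
                (sym (trans (-‿cong (trans (*-identityˡ _) (value (α̃-edge i)))) (-‿involutive _)))
            cases (no _) (yes (≡.refl , ≡.refl)) = trans (value (α̃-edge i))
                (-‿cong (sym (trans (*-identityˡ _) (value (α̃-edge′ i)))))
            cases (no ¬p) (no ¬q) = trans (value (α̃-other (λ (a , b) → ¬q (b , a)) (λ (a , b) → ¬p (b , a)) i))
              (trans (difference-swap _ _) (-‿cong (*-congˡ (sym (value (α̃-other ¬p ¬q i))))))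

          collapsed : Point n
          collapsed j x with j Fin.≟ η
          ... | yes _ = 0#
          ... | no _  = A j x

          collapsed-η : collapsed η η ≡ 0#
          collapsed-η with η Fin.≟ η
          ... | yes _   = ≡.refl
          ... | no η≢η = contradiction ≡.refl η≢η

          collapsed-κ : ∀ i x → collapsed (κ i) x ≡ A (κ i) x
          collapsed-κ i x with κ i Fin.≟ η
          ... | yes eq = contradiction eq (κ≢η i)
          ... | no _   = ≡.refl

          placed-collapsed : ∀ {x} → x ≢ v → ∀ i → ⟦ placed x i ⟧ collapsed ≈ A (κ i) x
          placed-collapsed {x} x≢v i = reflexive (≡.trans
              (≡.cong (λ e → ⟦ e ⟧ collapsed) (placed-other x≢v i)) (collapsed-κ i x))

          placed-v-collapsed : ∀ i → ⟦ placed v i ⟧ collapsed ≈ A (κ i) u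
          placed-v-collapsed i = trans (reflexive (≡.cong (λ e → ⟦ e ⟧ collapsed) (placed-v i)))
            (trans (+-cong (reflexive (collapsed-κ i u))
                (trans (*-congʳ (reflexive collapsed-η)) (zeroˡ _))) (+-identityʳ _))

          other-collapsed : ∀ {x y} → x ≢ v → y ≢ v → ∀ i → ⟦ α̃ x y i ⟧ collapsed ≈ A (κ i) x - A (κ i) y
          other-collapsed x≢v y≢v i = trans
            (reflexive (≡.cong (λ e → ⟦ e ⟧ collapsed)
                (α̃-other (λ (_ , y≡v) → y≢v y≡v) (λ (x≡v , _) → x≢v x≡v) i)))
            (+-cong (placed-collapsed x≢v i) (-‿cong (placed-collapsed y≢v i)))

          v-collapsed : ∀ {x} → x ≢ u → x ≢ v → ∀ i → ⟦ α̃ x v i ⟧ collapsed ≈ A (κ i) x - A (κ i) u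
          v-collapsed x≢u x≢v i = trans
            (reflexive (≡.cong (λ e → ⟦ e ⟧ collapsed)
                (α̃-other (λ (x≡u , _) → x≢u x≡u) (λ (x≡v , _) → x≢v x≡v) i)))
            (+-cong (placed-collapsed x≢v i) (-‿cong (placed-v-collapsed i)))

          direction : Fin n → Fin d → Expr n
          direction x i with x Fin.≟ u
          ... | yes _ = ⟨-⟩ X (κ i) v
          ... | no _  = X (κ i) x ⟨+⟩ ⟨-⟩ X (κ i) u

          module _ (e : Fin n → Fin d → Carrier) where
            -- With u at the origin, v at minus the vector of u and every other vertex x at `e x`,
            -- the directions -p(v) and p(x) - p(u) become the vectors prescribed by `e`.
            special : Fin n → Fin d → Carrier
            special x i with x Fin.≟ u | x Fin.≟ v
            ... | yes _ | _     = 0#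
            ... | no _  | yes _ = - e u i
            ... | no _  | no _  = e x i

            special-u : ∀ i → special u i ≡ 0#
            special-u i with u Fin.≟ u
            ... | yes _   = ≡.refl
            ... | no u≢u = contradiction ≡.refl u≢u

            special-v : ∀ i → special v i ≡ - e u i
            special-v i with v Fin.≟ u | v Fin.≟ v
            ... | yes v≡u | _      = contradiction (≡.sym v≡u) u≢v′
            ... | no _    | yes _  = ≡.refl
            ... | no _    | no v≢v = contradiction ≡.refl v≢v

            special-other : ∀ {x} → x ≢ u → x ≢ v → ∀ i → special x i ≡ e x i
            special-other {x} x≢u x≢v i with x Fin.≟ u | x Fin.≟ v
            ... | yes x≡u | _       = contradiction x≡u x≢u
            ... | no _    | yes x≡v = contradiction x≡v x≢v
            ... | no _    | no _    = ≡.refl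

            direction-special : ∀ x → Relevant G u~v c<d x → ∀ i → ⟦ direction x i ⟧ (extend special) ≈ e x i
            direction-special x rel i with x Fin.≟ u
            direction-special x rel i | yes ≡.refl =
              trans (-‿cong (reflexive (≡.trans (extend-κ special i v) (special-v i)))) (-‿involutive _)
            direction-special x (inj₁ x≡u) i | no x≢u = contradiction x≡u x≢u
            direction-special x (inj₂ (u~x , v~x)) i | no x≢u = trans
              (+-cong (reflexive (≡.trans (extend-κ special i x) (special-other x≢u (λ { ≡.refl → ~-irrefl ≡.refl v~x }) i)))
                (trans (-‿cong (reflexive (≡.trans (extend-κ special i u) (special-u i)))) -0#≈0#))
              (+-identityʳ _)

          direction-u : ∀ i → direction u i ≡ ⟨-⟩ X (κ i) v
          direction-u i with u Fin.≟ u
          ... | yes _   = ≡.refl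
          ... | no u≢u = contradiction ≡.refl u≢u

          direction-other : ∀ {x} → x ≢ u → ∀ i → direction x i ≡ X (κ i) x ⟨+⟩ ⟨-⟩ X (κ i) u
          direction-other {x} x≢u i with x Fin.≟ u
          ... | yes x≡u = contradiction x≡u x≢u
          ... | no _    = ≡.refl

          α̃-system : Point n → Set _
          α̃-system P = System 1*1≈1 _~_ (λ x y i → ⟦ α̃ x y i ⟧ P) (λ x y i → ⟦ α̃ x y i ⟧ P)

          collapsed-system : (∀ τ → ∃ λ z → ∀ x → Relevant G u~v c<d x → ip (λ i → ⟦ direction x i ⟧ A) z ≈
              τ x) →
                             RigiditySystem (contract G u v) → α̃-system collapsed
          collapsed-system independent = contraction-system 1*1≈1 G u~v (α̃-swap collapsed)
            (λ x≢v y≢v i → other-collapsed x≢v y≢v i , other-collapsed x≢v y≢v i)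
            (λ x≢u x≢v i → agree x≢u x≢v i , agree x≢u x≢v i)
            (λ _ → refl)
            (λ τ → let z , eqs = independent τ in z ,
              trans (ip-cong (λ i → trans (reflexive (≡.cong (λ e → ⟦ e ⟧ collapsed) (α̃-edge i)))
                (trans (-‿cong (reflexive (collapsed-κ i v)))
                    (reflexive (≡.cong (λ e → ⟦ e ⟧ A) (≡.sym (direction-u i)))))) (λ _ → refl))
                (eqs u (inj₁ ≡.refl)) ,
              λ x u~x v~x → trans (ip-cong (λ i → trans (other-collapsed {x} {u} (λ { ≡.refl → ~-irrefl ≡.refl v~x }) u≢v′ i)
                (reflexive (≡.cong (λ e → ⟦ e ⟧ A) (≡.sym (direction-other (λ { ≡.refl → ~-irrefl ≡.refl u~x }) i))))) (λ _ → refl))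
                (eqs x (inj₂ (u~x , v~x))))
            where
            agree : ∀ {x} → x ≢ u → x ≢ v → ∀ i → ⟦ α̃ x v i ⟧ collapsed ≈ ⟦ α̃ x u i ⟧ collapsed
            agree x≢u x≢v i = trans (v-collapsed x≢u x≢v i) (sym (other-collapsed x≢v u≢v′ i))

          spread : Point n
          spread j x with x Fin.≟ v
          ... | yes _ = A j u + A η η * A j v
          ... | no _  = A j x

          spread-placed : ∀ x i → spread (κ i) x ≡ ⟦ placed x i ⟧ A
          spread-placed x i with x Fin.≟ v
          ... | yes _ = ≡.refl
          ... | no _  = ≡.refl

          -- With ε invertible the division is undone row by row: the rows of the rigidity matrix at
          -- `spread` are those of `α̃` at A up to the factor `scale`.
          spread-system : A η η # 0# → α̃-system A →
                          System 1*1≈1 _~_ (λ x y i → ⟦ αʳ x y i ⟧ spread) (λ x y i → ⟦ αʳ x y i ⟧ spread)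
          spread-system ε#0 system t t-sym = w , eqs
            where
            ε = A η η
            ε⁻¹ = proj₁ (inverse ε#0)
            scale : Fin n → Fin n → Carrier
            scale x y with (x Fin.≟ u) ×-dec (y Fin.≟ v) | (x Fin.≟ v) ×-dec (y Fin.≟ u)
            ... | yes _ | _     = ε
            ... | no _  | yes _ = ε
            ... | no _  | no _  = 1#
            scale⁻¹ : Fin n → Fin n → Carrier
            scale⁻¹ x y with (x Fin.≟ u) ×-dec (y Fin.≟ v) | (x Fin.≟ v) ×-dec (y Fin.≟ u)
            ... | yes _ | _     = ε⁻¹
            ... | no _  | yes _ = ε⁻¹
            ... | no _  | no _  = 1#
            scale-inverse : ∀ x y → scale x y * scale⁻¹ x y ≈ 1#
            scale-inverse x y with (x Fin.≟ u) ×-dec (y Fin.≟ v) | (x Fin.≟ v) ×-dec (y Fin.≟ u)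
            ... | yes _ | _     = proj₂ (inverse ε#0)
            ... | no _  | yes _ = proj₂ (inverse ε#0)
            ... | no _  | no _  = *-identityˡ 1#
            scale⁻¹-sym : ∀ x y → scale⁻¹ y x ≡ scale⁻¹ x y
            scale⁻¹-sym x y with (x Fin.≟ u) ×-dec (y Fin.≟ v) | (x Fin.≟ v) ×-dec (y Fin.≟ u)
                               | (y Fin.≟ u) ×-dec (x Fin.≟ v) | (y Fin.≟ v) ×-dec (x Fin.≟ u)
            ... | yes _       | _           | yes _       | _           = ≡.refl
            ... | yes _       | _           | no _        | yes _       = ≡.refl
            ... | yes (a , b) | _           | no _        | no ¬p       = contradiction (b , a) ¬p
            ... | no _        | yes _       | yes _       | _           = ≡.refl
            ... | no _        | yes (a , b) | no ¬p       | _           = contradiction (b , a) ¬p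
            ... | no _        | no ¬p       | yes (a , b) | _           = contradiction (b , a) ¬p
            ... | no ¬p       | no _        | no _        | yes (a , b) = contradiction (b , a) ¬p
            ... | no _        | no _        | no _        | no _        = ≡.refl
            solution = system (λ x y → scale⁻¹ x y * t x y)
              (λ x y → trans (*-cong (reflexive (scale⁻¹-sym x y)) (t-sym x y))
                  (solve 3 (λ a b s → a :* (s :* b) := s :* (a :* b)) refl (scale⁻¹ x y) (t x y) 1#))
            w = proj₁ solution
            scaled : ∀ x y i → ⟦ αʳ x y i ⟧ spread ≈ scale x y * ⟦ α̃ x y i ⟧ A
            scaled x y i with (x Fin.≟ u) ×-dec (y Fin.≟ v) | (x Fin.≟ v) ×-dec (y Fin.≟ u)
            ... | yes (≡.refl , ≡.refl) | _ = trans
              (+-cong (reflexive (≡.trans (spread-placed u i) (≡.cong (λ e → ⟦ e ⟧ A) (placed-other u≢v′ i))))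
                      (-‿cong (reflexive (≡.trans (spread-placed v i) (≡.cong (λ e → ⟦ e ⟧ A) (placed-v i))))))
              (solve 3 (λ p e q → p :- (p :+ e :* q) := e :* :- q) refl (A (κ i) u) ε (A (κ i) v))
            ... | no _ | yes (≡.refl , ≡.refl) = trans
              (+-cong (reflexive (≡.trans (spread-placed v i) (≡.cong (λ e → ⟦ e ⟧ A) (placed-v i))))
                      (-‿cong (reflexive (≡.trans (spread-placed u i)
                          (≡.cong (λ e → ⟦ e ⟧ A) (placed-other u≢v′ i))))))
              (solve 3 (λ p e q → p :+ e :* q :- p := e :* q) refl (A (κ i) u) ε (A (κ i) v))
            ... | no _ | no _ = trans (+-cong (reflexive (spread-placed x i))
                (-‿cong (reflexive (spread-placed y i)))) (sym (*-identityˡ _))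
            eqs : ∀ x y → x ~ y → row (λ x y i → ⟦ αʳ x y i ⟧ spread) (λ x y i → ⟦ αʳ x y i ⟧ spread) x y w
                ≈ t x y
            eqs x y x~y = begin
              ip (λ i → ⟦ αʳ x y i ⟧ spread) (w y) - ip (λ i → ⟦ αʳ x y i ⟧ spread) (w x)
                ≈⟨ +-cong (side (w y)) (-‿cong (side (w x))) ⟩
              σ * ip γ (w y) - σ * ip γ (w x)
                ≈⟨ solve 3 (λ s p q → s :* p :- s :* q := s :* (p :- q)) refl σ (ip γ (w y)) (ip γ (w x)) ⟩
              σ * (ip γ (w y) - ip γ (w x))      ≈⟨ *-congˡ (proj₂ solution x y x~y) ⟩
              σ * (scale⁻¹ x y * t x y)          ≈⟨ *-assoc _ _ _ ⟨
              σ * scale⁻¹ x y * t x y            ≈⟨ *-congʳ (scale-inverse x y) ⟩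
              1# * t x y                         ≈⟨ *-identityˡ _ ⟩
              t x y                              ∎
              where
              σ = scale x y
              γ = λ i → ⟦ α̃ x y i ⟧ A
              side : ∀ v → ip (λ i → ⟦ αʳ x y i ⟧ spread) v ≈ σ * ip γ v
              side v = trans (ip-cong (scaled x y) (λ _ → refl)) (ip-*ˡ σ γ v)

        -- Two transfers are needed: from ε = 0 to A for the divided rows and, after rescaling, from
        -- `spread`, where v still sits at u plus ε times its old position, to A itself.
        rigidity-system : ∀ {G} → Reducible d G → ¬ ¬ RigiditySystem G
        rigidity-system {G} (edgeless none) = pure (edgeless-system 1*1≈1 {G} none)
        rigidity-system {G} (contraction {u} {v} u~v c<d R) =
          rigidity-system R >>= λ system →
          generic-independent G u~v c<d {A = A} generic direction (extend (special e)) (direction-special e)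
              >>= λ independent →
          system-transfer 1*1≈1 {A = A} generic _~?_ ~-sym (λ _ → refl) α̃ α̃ α̃-swap collapsed
            (collapsed-system independent system) >>= λ system̃ →
          generic-nonzero {A = A} generic (X η η) (λ _ _ → 1#) (#⇒≉ 1#0) >>= λ ε#0 →
          system-transfer 1*1≈1 {A = A} generic _~?_ ~-sym (λ _ → refl) αʳ αʳ
            (λ P x y i → difference-swap (P (κ i) x) (P (κ i) y)) spread (spread-system ε#0 system̃)
          where
          open Graph G
          open Collapse G u~v c<d
          e = basis G u~v c<d

  -- From the rigidity matrix to the symmetric system

  module SymmetricSystem {n : ℕ} {A : Point n} (generic : Generic k char0 A)
    {d} (κ : Fin d → Fin n) (κ-injective : ∀ {i j} → κ i ≡ κ j → i ≡ j)
    (o η : Fin n) (κ≢o : ∀ i → κ i ≢ o) (κ≢η : ∀ i → κ i ≢ η) where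

    κ⁺ : Fin (suc d) → Fin n
    κ⁺ zero    = o
    κ⁺ (suc i) = κ i

    module _ (G : Graph n) where
      open Graph G

      Touching : Fin n → Fin n → Set
      Touching x y = x ≡ y ⊎ x ~ y

      -- The left-hand side for x y is the coefficient of the product of the two variables in a sum
      -- of products of forms, and twice that coefficient on the diagonal. Squares of variables are
      -- nonzero in the face ring, so every vertex contributes a loop.
      ConeSystem : Set _
      ConeSystem = System 1*1≈1 Touching (λ x y i → A (κ⁺ i) x) (λ x y i → - A (κ⁺ i) y)

      private
        flat : Point n
        flat j x with j Fin.≟ o
        ... | yes _ = 1#
        ... | no _  = A j x

        flat-o : ∀ x → flat o x ≡ 1#
        flat-o x with o Fin.≟ o
        ... | yes _   = ≡.refl
        ... | no o≢o = contradiction ≡.refl o≢o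

        flat-κ : ∀ i x → flat (κ i) x ≡ A (κ i) x
        flat-κ i x with κ i Fin.≟ o
        ... | yes eq = contradiction eq (κ≢o i)
        ... | no _   = ≡.refl

        touching-sym : ∀ {x y} → Touching x y → Touching y x
        touching-sym (inj₁ x≡y) = inj₁ (≡.sym x≡y)
        touching-sym (inj₂ x~y) = inj₂ (~-sym x~y)

        half : ∃ λ h → h + h ≈ 1#
        half = let h , eq = inverse (char0 1) in h , trans (twice h) eq
          where
          twice : ∀ h → h + h ≈ (1# + (1# + 0#)) * h
          twice h = trans (sym (+-cong (*-identityˡ h) (*-identityˡ h)))
            (trans (sym (distribʳ h 1# 1#)) (*-congʳ (+-congˡ (sym (+-identityʳ 1#)))))

        -- In the affine chart where the coordinate o is 1, the loops determine the coordinate o of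
        -- the unknowns, and the remaining equations form the rigidity matrix.
        flat-system : Generically.RigiditySystem {A = A} generic κ κ-injective G →
                      System 1*1≈1 Touching (λ x y i → flat (κ⁺ i) x) (λ x y i → - flat (κ⁺ i) y)
        flat-system system t t-sym = w , eqs
          where
          h = proj₁ half
          q : Fin n → Fin d → Carrier
          q x i = A (κ i) x
          s : Fin n → Carrier
          s x = h * t x x
          solution = system (λ x y → t x y - s x - s y)
            (λ x y → trans (+-congʳ (+-congʳ (trans (t-sym x y) (*-identityˡ _))))
               (trans (solve 3 (λ t a b → t :- b :- a := t :- a :- b) refl (t x y) (s x) (s y))
                   (sym (*-identityˡ _))))
          w′ = proj₁ solution
          w : Array n (suc d)
          w x zero    = s x - ip (q x) (w′ x)
          w x (suc i) = w′ x i
          side : ∀ x y → ip (λ i → flat (κ⁺ i) x) (w y) ≈ s y - ip (q y) (w′ y) + ip (q x) (w′ y)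
          side x y = +-cong (trans (*-congʳ (reflexive (flat-o x))) (*-identityˡ _))
            (ip-cong (λ i → reflexive (flat-κ i x)) (λ _ → refl))
          row≈ : ∀ x y → row (λ x y i → flat (κ⁺ i) x) (λ x y i → - flat (κ⁺ i) y) x y w ≈
                 (s y - ip (q y) (w′ y) + ip (q x) (w′ y)) + (s x - ip (q x) (w′ x) + ip (q y) (w′ x))
          row≈ x y = +-cong (side x y) (trans (-‿cong (ip-neg (λ i → flat (κ⁺ i) y) (w x)))
              (trans (-‿involutive _) (side y x)))
          eqs : ∀ x y → Touching x y → row (λ x y i → flat (κ⁺ i) x) (λ x y i → - flat (κ⁺ i) y) x y w ≈ t x y
          eqs x .x (inj₁ ≡.refl) = begin
            _                              ≈⟨ row≈ x x ⟩
            _ ≈⟨ solve 2 (λ s p → (s :- p :+ p) :+ (s :- p :+ p) := s :+ s) refl (s x) (ip (q x) (w′ x)) ⟩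
            h * t x x + h * t x x          ≈⟨ distribʳ _ _ _ ⟨
            (h + h) * t x x                ≈⟨ *-congʳ (proj₂ half) ⟩
            1# * t x x                     ≈⟨ *-identityˡ _ ⟩
            t x x                          ∎
          eqs x y (inj₂ x~y) = begin
            _                              ≈⟨ row≈ x y ⟩
            _ ≈⟨ solve 6 (λ sx sy yy xy xx yx → (sy :- yy :+ xy) :+ (sx :- xx :+ yx) :=
                                                ((xy :- yy) :- (xx :- yx)) :+ sx :+ sy) refl (s x) (s y)
                                                    (ip (q y) (w′ y)) (ip (q x) (w′ y)) (ip (q x) (w′ x))
                                                    (ip (q y) (w′ x)) ⟩
            (ip (q x) (w′ y) - ip (q y) (w′ y)) - (ip (q x) (w′ x) - ip (q y) (w′ x)) + s x + s y
              ≈⟨ +-congʳ (+-congʳ (+-cong (ip-- (q x) (q y) (w′ y)) (-‿cong (ip-- (q x) (q y) (w′ x))))) ⟨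
            row (λ x y i → q x i - q y i) (λ x y i → q x i - q y i) x y w′ + s x + s y
              ≈⟨ +-congʳ (+-congʳ (proj₂ solution x y x~y)) ⟩
            t x y - s x - s y + s x + s y ≈⟨ solve 3 (λ t a b → t :- a :- b :+ a :+ b := t) refl (t x y)
                (s x) (s y) ⟩
            t x y                          ∎

      cone-system : Reducible d G → ¬ ¬ ConeSystem
      cone-system R = Generically.rigidity-system {A = A} generic κ κ-injective η κ≢η R >>= λ system →
        system-transfer 1*1≈1 {A = A} generic (λ x y → (x Fin.≟ y) ⊎-dec (x ~? y)) touching-sym (λ _ → refl)
          (λ x y i → X (κ⁺ i) x) (λ x y i → ⟨-⟩ X (κ⁺ i) y)
          (λ P x y i → sym (trans (-‿cong (*-identityˡ _)) (-‿involutive _))) flat (flat-system system)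

  module _ {n : ℕ} {A : Point n} (generic : Generic k char0 A) where

    -- The identity matrix is the special point. This is what expresses an arbitrary vector of
    -- unknowns through the generic basis.
    generic-spans : ¬ ¬ (∀ (v : Fin n → Carrier) → ∃ λ c → ∀ x → sum (λ j → c j * A j x) ≈ v x)
    generic-spans = transfer generic {m = n} {b = 1} {Active = λ _ → ⊤} (λ _ → yes tt) (λ x j _ → X j x)
        identity solvable >>= λ solve →
      pure λ v → let w , eqs = solve v in (λ j → w j zero) , λ x →
        trans (sum-cong {n} λ j → trans (*-comm _ _) (sym (+-identityʳ _))) (eqs x tt)
      where
      identity : Point n
      identity j x with j Fin.≟ x
      ... | yes _ = 1#
      ... | no _  = 0#
      solvable : Solvable (λ _ → ⊤) (at (λ x j (_ : Fin 1) → X j x) identity)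
      solvable t = (λ j _ → t j) , λ x _ → trans
        (sum-single x λ j j≢x → trans (+-identityʳ _) (trans (*-congʳ (off j≢x)) (zeroˡ _)))
        (trans (+-identityʳ _) (trans (*-congʳ (on x)) (*-identityˡ _)))
        where
        off : ∀ {j x} → j ≢ x → identity j x ≈ 0#
        off {j} {x} j≢x with j Fin.≟ x
        ... | yes j≡x = contradiction j≡x j≢x
        ... | no _    = refl
        on : ∀ x → identity x x ≈ 1#
        on x with x Fin.≟ x
        ... | yes _   = refl
        ... | no x≢x = contradiction ≡.refl x≢x

  -- Elements of degree two

  module Quadratic {B : Set} (_≟_ : DecidableEquality B) (_·_ : Op₂ B) (ε : B)
    (identityˡ : ∀ b → ε · b ≡ b) {n : ℕ} (m : Fin n → Fin n → B) where

    open MonoidAlgebra (ring k) _≟_ _·_ ε public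
    open Pairing (ring k) _≟_ _·_ ε id id refl refl (λ _ _ → refl) (λ _ _ → refl) public

    infix 4 _≃_
    -- Equality under all functionals: it composes along the pairing laws, and indicator functions
    -- turn it into equality of coefficients.
    _≃_ : Alg → Alg → Set _
    p ≃ q = ∀ φ → ⟨ p , φ ⟩ ≈ ⟨ q , φ ⟩

    ≃⇒≋ : ∀ {p q} → p ≃ q → p ≋ q
    ≃⇒≋ {p} {q} eq b = trans (coeff≈ p) (trans (eq δ) (sym (coeff≈ q)))
      where
      δ : B → Carrier
      δ b′ = if does (b′ ≟ b) then 1# else 0#
      coeff≈ : ∀ p → coeff p b ≈ ⟨ p , δ ⟩
      coeff≈ []             = refl
      coeff≈ ((a , b′) ∷ p) with does (b′ ≟ b)
      ... | true  = +-cong (sym (*-identityʳ a)) (coeff≈ p)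
      ... | false = trans (coeff≈ p) (sym (trans (+-congʳ (zeroʳ a)) (+-identityˡ _)))

    pair-⊖ : ∀ p q {φ} → ⟨ p ⊖ q , φ ⟩ ≈ ⟨ p , φ ⟩ - ⟨ q , φ ⟩
    pair-⊖ p q = trans (pair-⊕ p ((- 1#) ⊙ q)) (+-congˡ (trans (pair-⊙ (- 1#) q) (-1*x≈-x _)))

    ⨁ : ∀ {l} → (Fin l → Alg) → Alg
    ⨁ {zero}  f = 𝟘
    ⨁ {suc l} f = f zero ⊕ ⨁ (f ∘ suc)

    Matrix : Set _
    Matrix = Fin n → Fin n → Carrier

    evalAt : Matrix → (B → Carrier) → Carrier
    evalAt T φ = sum λ u → sum λ v → T u v * φ (m u v)

    -- The matrix lists coefficients by ordered pairs; it is not unique when `m u v` and `m v u`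
    -- coincide, as for commuting variables.
    Quad : Alg → Matrix → Set _
    Quad p T = ∀ φ → ⟨ p , φ ⟩ ≈ evalAt T φ

    quad-0 : Quad 𝟘 (λ _ _ → 0#)
    quad-0 φ = sym (sum-zero {n} λ u → sum-zero {n} λ v → zeroˡ _)

    quad-⊕ : ∀ {p q S T} → Quad p S → Quad q T → Quad (p ⊕ q) (λ u v → S u v + T u v)
    quad-⊕ {p} {q} {S} {T} P Q φ = trans (pair-⊕ p q)
        (trans (+-cong (P φ) (Q φ)) (sym (dot-+ˡ S T (λ u v → φ (m u v)))))

    quad-⊙ : ∀ {p T} x → Quad p T → Quad (x ⊙ p) (λ u v → x * T u v)
    quad-⊙ {p} {T} x P φ = trans (pair-⊙ x p) (trans (*-congˡ (P φ)) (sym (dot-*ˡ x T (λ u v → φ (m u v)))))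

    quad-cong : ∀ {p S T} → (∀ u v → S u v ≈ T u v) → Quad p S → Quad p T
    quad-cong {p} {S} {T} eq P φ = trans (P φ) (dot-cong {M = S} {T} {λ u v → φ (m u v)} eq (λ _ _ → refl))

    quad-⊖ : ∀ {p q S T} → Quad p S → Quad q T → Quad (p ⊖ q) (λ u v → S u v - T u v)
    quad-⊖ {p} {q} {S} {T} P Q = quad-cong {p ⊖ q} (λ u v → +-congˡ (-1*x≈-x _))
      (quad-⊕ {p} {(- 1#) ⊙ q} {S} P (quad-⊙ {q} {T} (- 1#) Q))

    quad-⨁ : ∀ {l} {f : Fin l → Alg} {T : Fin l → Matrix} → (∀ i → Quad (f i) (T i)) →
             Quad (⨁ f) (λ u v → sum λ i → T i u v)
    quad-⨁ {zero}  P = quad-0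
    quad-⨁ {suc l} {f} {T} P = quad-⊕ {f zero} {⨁ (f ∘ suc)} {T zero} (P zero) (quad-⨁ {l} (P ∘ suc))

    module _ {g} (Gen : Pred Alg g) where

      ideal-⊙ : ∀ a {p} → Ideal Gen p → Ideal Gen (a ⊙ p)
      ideal-⊙ a {p} I = resp (≃⇒≋ {scalar ⊛ p} {a ⊙ p} λ φ → trans (pair-⊛ scalar p) (trans (+-identityʳ _)
          (trans (*-congˡ (pair-cong p λ b → reflexive (≡.cong φ (identityˡ b)))) (sym (pair-⊙ a p)))))
        (mulˡ scalar I)
        where
        scalar : Alg
        scalar = (a , ε) ∷ []

      ideal-⨁ : ∀ {l} {f : Fin l → Alg} → (∀ i → Ideal Gen (f i)) → Ideal Gen (⨁ f)
      ideal-⨁ {zero}  I = zero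
      ideal-⨁ {suc l} I = add (I zero) (ideal-⨁ {l} (I ∘ suc))

      -- Doubling the quadratic form allows its terms to be grouped in transposed pairs.
      quad-ideal : ∀ {p T} → Quad p T →
                   (∀ u v → Ideal Gen (T u v ⊙ monomial (m u v) ⊕ T v u ⊙ monomial (m v u))) → Ideal Gen p
      quad-ideal {p} {T} P I = resp (≃⇒≋ {half ⊙ doubled} {p} equal)
        (ideal-⊙ half {doubled} (ideal-⨁ λ u → ideal-⨁ λ v → I u v))
        where
        doubled : Alg
        doubled = ⨁ λ u → ⨁ λ v → T u v ⊙ monomial (m u v) ⊕ T v u ⊙ monomial (m v u)
        half = proj₁ (inverse (char0 1))
        pair-⨁ : ∀ {l} (f : Fin l → Alg) φ → ⟨ ⨁ f , φ ⟩ ≈ sum (λ i → ⟨ f i , φ ⟩)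
        pair-⨁ {zero}  f φ = refl
        pair-⨁ {suc l} f φ = trans (pair-⊕ (f zero) (⨁ (f ∘ suc))) (+-congˡ (pair-⨁ (f ∘ suc) φ))
        term : ∀ x b φ → ⟨ x ⊙ monomial b , φ ⟩ ≈ x * φ b
        term x b φ = trans (pair-⊙ x (monomial b) {φ}) (*-congˡ (pair-monomial b {φ}))
        twice : ∀ φ → ⟨ doubled , φ ⟩ ≈ evalAt T φ + evalAt T φ
        twice φ = begin
          ⟨ doubled , φ ⟩
            ≈⟨ trans (pair-⨁ (λ u → ⨁ λ v → T u v ⊙ monomial (m u v) ⊕ T v u ⊙ monomial (m v u)) φ)
                 (sum-cong {n} λ u → trans (pair-⨁
                     (λ v → T u v ⊙ monomial (m u v) ⊕ T v u ⊙ monomial (m v u)) φ) (sum-cong {n} λ v →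
                   trans (pair-⊕ (T u v ⊙ monomial (m u v)) (T v u ⊙ monomial (m v u)) {φ})
                       (+-cong (term (T u v) (m u v) φ) (term (T v u) (m v u) φ)))) ⟩
          sum (λ u → sum λ v → F u v + F v u)
            ≈⟨ trans (sum-cong {n} λ u → sum-+ (F u) (λ v → F v u))
                (sum-+ (λ u → sum (F u)) (λ u → sum λ v → F v u)) ⟩
          evalAt T φ + sum (λ u → sum λ v → F v u)     ≈⟨ +-congˡ (∑-comm {n} {n} (λ u v → F v u)) ⟩
          evalAt T φ + evalAt T φ ∎
          where
          F : Matrix
          F u v = T u v * φ (m u v)
        equal : half ⊙ doubled ≃ p
        equal φ = begin
          ⟨ half ⊙ doubled , φ ⟩                ≈⟨ trans (pair-⊙ half doubled) (*-congˡ (twice φ)) ⟩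
          half * (evalAt T φ + evalAt T φ) ≈⟨ *-congˡ
              (trans (sym (+-cong (*-identityˡ _) (*-identityˡ _)))
              (trans (sym (distribʳ _ 1# 1#)) (*-congʳ (+-congˡ (sym (+-identityʳ 1#)))))) ⟩
          half * ((1# + (1# + 0#)) * evalAt T φ)  ≈⟨ *-assoc _ _ _ ⟨
          half * (1# + (1# + 0#)) * evalAt T φ  ≈⟨ *-congʳ (trans (*-comm _ _) (proj₂ (inverse (char0 1)))) ⟩
          1# * evalAt T φ                       ≈⟨ *-identityˡ _ ⟩
          evalAt T φ                            ≈⟨ P φ ⟨
          ⟨ p , φ ⟩                             ∎

    module _ {f} {F : Pred Alg f} where

      span-⊕ : ∀ {p q} → Span F p → Span F q → Span F (p ⊕ q)
      span-⊕ zero Q = Q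
      span-⊕ (step a {p} {q} Fp P) Q =
        ≡.subst (Span F) (≡.sym (List.++-assoc (a ⊙ p) q _)) (step a Fp (span-⊕ P Q))

      span-⨁ : ∀ {l} {g : Fin l → Alg} → (∀ i → Span F (g i)) → Span F (⨁ g)
      span-⨁ {zero}  P = zero
      span-⨁ {suc l} P = span-⊕ (P zero) (span-⨁ {l} (P ∘ suc))

  -- Exterior shifting

  filter-none : ∀ {m n} {P : Pred (Fin n) 0ℓ} (P? : Decidable P) (f : Fin m → Fin n) →
                (∀ x → ¬ P (f x)) → filter P? (tabulate f) ≡ []
  filter-none P? f none = List.filter-none P? (All.tabulate⁺ none)

  filter-one : ∀ {m n} {P : Pred (Fin n) 0ℓ} (P? : Decidable P) (f : Fin m → Fin n) j →
               P (f j) → (∀ x → P (f x) → x ≡ j) → filter P? (tabulate f) ≡ f j ∷ []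
  filter-one P? f zero    Pj only = ≡.trans (List.filter-accept P? Pj)
    (≡.cong (f zero ∷_) (filter-none P? (f ∘ suc) λ x p → Fin.0≢1+n (≡.sym (only (suc x) p))))
  filter-one P? f (suc j) Pj only = ≡.trans (List.filter-reject P? λ p → Fin.0≢1+n (only zero p))
    (filter-one P? (f ∘ suc) j Pj λ x p → Fin.suc-injective (only (suc x) p))

  filter-two : ∀ {m n} {P : Pred (Fin n) 0ℓ} (P? : Decidable P) (f : Fin m → Fin n) i j → i <ᶠ j →
               P (f i) → P (f j) → (∀ x → P (f x) → x ≡ i ⊎ x ≡ j) →
               filter P? (tabulate f) ≡ f i ∷ f j ∷ []
  filter-two P? f zero (suc j) _ Pi Pj only = ≡.trans (List.filter-accept P? Pi)
    (≡.cong (f zero ∷_) (filter-one P? (f ∘ suc) j Pj λ x p → [ (λ ()) , Fin.suc-injective ]′ (only (suc x) p)))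
  filter-two P? f (suc i) (suc j) (s≤s i<j) Pi Pj only =
    ≡.trans (List.filter-reject P? λ p → [ (λ ()) , (λ ()) ]′ (only zero p))
      (filter-two P? (f ∘ suc) i j i<j Pi Pj λ x p → [ inj₁ ∘ Fin.suc-injective , inj₂ ∘ Fin.suc-injective
          ]′ (only (suc x) p))

  module _ {n : ℕ} where

    ∈-pair⁻ : ∀ {x} (u v : Fin n) → x ∈ ⁅ u ⁆ ∪ ⁅ v ⁆ → x ≡ u ⊎ x ≡ v
    ∈-pair⁻ u v x∈ = [ inj₁ ∘ x∈⁅y⁆⇒x≡y u , inj₂ ∘ x∈⁅y⁆⇒x≡y v ]′ (x∈p∪q⁻ ⁅ u ⁆ ⁅ v ⁆ x∈)

    ∈-pairˡ : ∀ (u v : Fin n) → u ∈ ⁅ u ⁆ ∪ ⁅ v ⁆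
    ∈-pairˡ u v = x∈p∪q⁺ (inj₁ (x∈⁅x⁆ u))

    ∈-pairʳ : ∀ (u v : Fin n) → v ∈ ⁅ u ⁆ ∪ ⁅ v ⁆
    ∈-pairʳ u v = x∈p∪q⁺ {p = ⁅ u ⁆} (inj₂ (x∈⁅x⁆ v))

    elements-pair : ∀ {u v : Fin n} → u <ᶠ v → elements (⁅ u ⁆ ∪ ⁅ v ⁆) ≡ u ∷ v ∷ []
    elements-pair {u} {v} u<v = filter-two (_∈? (⁅ u ⁆ ∪ ⁅ v ⁆)) id u v u<v (∈-pairˡ u v) (∈-pairʳ u v)
        (λ x → ∈-pair⁻ u v)

    face-adjacent : ∀ (G : Graph n) {S u v} → GraphFace G S → u ∈ S → v ∈ S → u ≢ v → Adjacent G u v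
    face-adjacent G empty u∈ _ _ = contradiction u∈ ∉⊥
    face-adjacent G (vertex w) u∈ v∈ u≢v = contradiction (≡.trans (x∈⁅y⁆⇒x≡y w u∈) (≡.sym (x∈⁅y⁆⇒x≡y w v∈))) u≢v
    face-adjacent G (edge a b a~b) u∈ v∈ u≢v with ∈-pair⁻ a b u∈ | ∈-pair⁻ a b v∈
    ... | inj₁ ≡.refl | inj₁ ≡.refl = contradiction ≡.refl u≢v
    ... | inj₁ ≡.refl | inj₂ ≡.refl = a~b
    ... | inj₂ ≡.refl | inj₁ ≡.refl = Graph.~-sym G a~b
    ... | inj₂ ≡.refl | inj₂ ≡.refl = contradiction ≡.refl u≢v

  ∣pair∣ : ∀ {n} {u v : Fin n} → u <ᶠ v → ∣ ⁅ u ⁆ ∪ ⁅ v ⁆ ∣ ≡ 2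
  ∣pair∣ {u = zero}  {suc v} _         = ≡.cong suc (≡.trans (≡.cong ∣_∣ (∪-identityˡ ⁅ v ⁆)) (∣⁅x⁆∣≡1 v))
  ∣pair∣ {u = suc u} {suc v} (s≤s u<v) = ∣pair∣ u<v

  module Exterior {n : ℕ} {A : Point n} (generic : Generic k char0 A)
    {d} (κ : Fin d → Fin n) (toℕ-κ : ∀ i → toℕ (κ i) ≡ toℕ i)
    {x y : Fin n} (toℕ-x : toℕ x ≡ d) (toℕ-y : toℕ y ≡ suc d) (G : Graph n) where

    open Graph G
    open ExteriorShifting k A (graphComplex G)
    open Quadratic {List (Fin n)} (List.≡-dec Fin._≟_) _++_ [] (λ _ → ≡.refl) {n} (λ u v → u ∷ v ∷ [])
      using (⟨_,_⟩; _≃_; ≃⇒≋; Quad; quad-⊕; quad-⊙; quad-0; quad-⊖; quad-⨁; ⨁; quad-ideal; ideal-⊙; span-⨁;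
             pair-⊛; pair-linear; pair-⊕; pair-⊙; pair-monomial; pair-cong; Ideal; Span; evalAt; Alg; _⊕_; _⊖_; _⊛_; _⊙_; 𝟘; 𝟙; monomial;
             generator; zero; add; resp; step; InSpanMod)

    private
      tensor : Fin n → Fin n → List (Fin n)
      tensor u v = u ∷ v ∷ []

    quad-product : ∀ a b → Quad (vector a ⊛ vector b) (λ u v → a u * b v)
    quad-product a b φ = begin
      ⟨ vector a ⊛ vector b , φ ⟩                              ≈⟨ pair-⊛ (vector a) (vector b) {φ} ⟩
      ⟨ vector a , (λ s → ⟨ vector b , (λ t → φ (s ++ t)) ⟩) ⟩   ≈⟨ pair-linear (λ j → j ∷ []) a ⟩
      sum (λ u → a u * ⟨ vector b , (λ t → φ (u ∷ t)) ⟩)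
        ≈⟨ sum-cong {n} (λ u → trans (*-congˡ (pair-linear (λ j → j ∷ []) b))
            (trans (sym (sum-*ˡ (a u) (λ v → b v * φ (tensor u v))))
            (sum-cong {n} λ v → sym (*-assoc _ _ _)))) ⟩
      evalAt (λ u v → a u * b v) φ                             ∎

    wedge-pair : ∀ (g : Fin n → Alg) {u v} → u <ᶠ v → wedge g (⁅ u ⁆ ∪ ⁅ v ⁆) ≃ g u ⊛ g v
    wedge-pair g {u} {v} u<v φ rewrite elements-pair u<v = begin
      ⟨ g u ⊛ (g v ⊛ 𝟙) , φ ⟩                                  ≈⟨ pair-⊛ (g u) (g v ⊛ 𝟙) {φ} ⟩
      ⟨ g u , (λ s → ⟨ g v ⊛ 𝟙 , (λ t → φ (s ++ t)) ⟩) ⟩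
        ≈⟨ pair-cong (g u) (λ s → trans (pair-⊛ (g v) 𝟙) (pair-cong (g v) λ t →
             trans (pair-monomial [] {λ r → φ (s ++ (t ++ r))})
                 (reflexive (≡.cong (λ r → φ (s ++ r)) (List.++-identityʳ t))))) ⟩
      ⟨ g u , (λ s → ⟨ g v , (λ t → φ (s ++ t)) ⟩) ⟩            ≈⟨ pair-⊛ (g u) (g v) {φ} ⟨
      ⟨ g u ⊛ g v , φ ⟩                                        ∎

    quad-wedge : ∀ {i j} → i <ᶠ j → Quad (wedge f (⁅ i ⁆ ∪ ⁅ j ⁆)) (λ u v → A i u * A j v)
    quad-wedge i<j φ = trans (wedge-pair f i<j φ) (quad-product (A _) (A _) φ)

    private
      I : Alg → Set _
      I = Ideal Relator

      δ : Fin n → Fin n → Carrier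
      δ u j with j Fin.≟ u
      ... | yes _ = 1#
      ... | no _  = 0#

      δ-on : ∀ u → δ u u ≈ 1#
      δ-on u with u Fin.≟ u
      ... | yes _   = refl
      ... | no u≢u = contradiction ≡.refl u≢u

      δ-off : ∀ {u j} → j ≢ u → δ u j ≈ 0#
      δ-off {u} {j} j≢u with j Fin.≟ u
      ... | yes j≡u = contradiction j≡u j≢u
      ... | no _    = refl

      pick-product : ∀ u v φ → evalAt (λ p q → δ u p * δ v q) φ ≈ φ (tensor u v)
      pick-product u v φ = trans
        (sum-single u λ p p≢u → sum-zero {n} λ q → trans (*-congʳ (trans (*-congʳ (δ-off p≢u)) (zeroˡ _)))
            (zeroˡ _))
        (trans (sum-single v λ q q≢v → trans (*-congʳ (trans (*-congˡ (δ-off q≢v)) (zeroʳ _))) (zeroˡ _))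
          (trans (*-congʳ (trans (*-cong (δ-on u) (δ-on v)) (*-identityˡ _))) (*-identityˡ _)))

      -- The polarisation of v ⊗ v.
      anticommutator : ∀ u v → I (monomial (tensor u v) ⊕ monomial (tensor v u))
      anticommutator u v = resp (≃⇒≋ {square-sum ⊕ minus-squares}
          {monomial (tensor u v) ⊕ monomial (tensor v u)} equal)
        (add (generator (square s)) (ideal-⊙ Relator (- 1#)
            (add (generator (square (δ u))) (generator (square (δ v))))))
        where
        s : Fin n → Carrier
        s j = δ u j + δ v j
        square-sum minus-squares : Alg
        square-sum = vector s ⊛ vector s
        minus-squares = (- 1#) ⊙ ((vector (δ u) ⊛ vector (δ u)) ⊕ (vector (δ v) ⊛ vector (δ v)))
        expand : ∀ φ → evalAt (λ p q → s p * s q) φ ≈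
                 (φ (tensor u u) + φ (tensor v v)) + (φ (tensor u v) + φ (tensor v u))
        expand φ = begin
          evalAt (λ p q → s p * s q) φ
            ≈⟨ dot-cong {M = λ p q → s p * s q} {λ p q → (δ u p * δ u q + δ v p * δ v q) +
                (δ u p * δ v q + δ v p * δ u q)} {λ p q → φ (tensor p q)}
                 (λ p q → solve 4 (λ a b c d → (a :+ b) :* (c :+ d) := (a :* c :+ b :* d) :+
                     (a :* d :+ b :* c)) refl (δ u p) (δ v p) (δ u q) (δ v q)) (λ _ _ → refl) ⟩
          _ ≈⟨ dot-+ˡ (λ p q → δ u p * δ u q + δ v p * δ v q) (λ p q → δ u p * δ v q + δ v p * δ u q)
              (λ p q → φ (tensor p q)) ⟩
          _ ≈⟨ +-cong (trans (dot-+ˡ (λ p q → δ u p * δ u q) (λ p q → δ v p * δ v q)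
              (λ p q → φ (tensor p q))) (+-cong (pick-product u u φ) (pick-product v v φ)))
                      (trans (dot-+ˡ (λ p q → δ u p * δ v q) (λ p q → δ v p * δ u q)
                          (λ p q → φ (tensor p q))) (+-cong (pick-product u v φ) (pick-product v u φ))) ⟩
          (φ (tensor u u) + φ (tensor v v)) + (φ (tensor u v) + φ (tensor v u)) ∎
        equal : square-sum ⊕ minus-squares ≃ monomial (tensor u v) ⊕ monomial (tensor v u)
        equal φ = begin
          ⟨ square-sum ⊕ minus-squares , φ ⟩
            ≈⟨ trans (pair-⊕ square-sum minus-squares) (+-cong (trans (quad-product s s φ) (expand φ))
                 (trans (pair-⊙ (- 1#) ((vector (δ u) ⊛ vector (δ u)) ⊕ (vector (δ v) ⊛ vector (δ v))))
                     (trans (-1*x≈-x _) (-‿cong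
                   (trans (pair-⊕ (vector (δ u) ⊛ vector (δ u)) (vector (δ v) ⊛ vector (δ v)))
                     (+-cong (trans (quad-product (δ u) (δ u) φ) (pick-product u u φ))
                         (trans (quad-product (δ v) (δ v) φ) (pick-product v v φ)))))))) ⟩
          (φ (tensor u u) + φ (tensor v v)) + (φ (tensor u v) + φ (tensor v u)) -
              (φ (tensor u u) + φ (tensor v v))
            ≈⟨ solve 2 (λ a b → a :+ b :- a := b) refl (φ (tensor u u) + φ (tensor v v))
                (φ (tensor u v) + φ (tensor v u)) ⟩
          φ (tensor u v) + φ (tensor v u)
            ≈⟨ trans (pair-⊕ (monomial (tensor u v)) (monomial (tensor v u)) {φ})
                (+-cong (pair-monomial (tensor u v) {φ}) (pair-monomial (tensor v u) {φ})) ⟨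
          ⟨ monomial (tensor u v) ⊕ monomial (tensor v u) , φ ⟩ ∎

      nonedge-< : ∀ {u v} → u <ᶠ v → ¬ u ~ v → I (monomial (tensor u v))
      nonedge-< {u} {v} u<v u≁v = resp (≃⇒≋ {wedge e S} {monomial (tensor u v)} λ φ →
          trans (wedge-pair e u<v φ) (trans (pair-⊛ (e u) (e v) {φ})
              (trans (pair-monomial (u ∷ []) {λ s → ⟨ e v , (λ t → φ (s ++ t)) ⟩})
              (trans (pair-monomial (v ∷ []) {λ t → φ (u ∷ t)}) (sym (pair-monomial (tensor u v) {φ}))))))
        (generator (nonface S λ face → u≁v (face-adjacent G face (∈-pairˡ u v) (∈-pairʳ u v) (Fin.<⇒≢ u<v))))
        where
        S = ⁅ u ⁆ ∪ ⁅ v ⁆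

      -- The nonface relators contain only the product in increasing order; the other order follows
      -- from anticommutation.
      nonedge-> : ∀ {u v} → v <ᶠ u → ¬ u ~ v → I (monomial (tensor u v))
      nonedge-> {u} {v} v<u u≁v = resp (≃⇒≋ {(monomial (tensor u v) ⊕ monomial (tensor v u)) ⊕
          ((- 1#) ⊙ monomial (tensor v u))} {monomial (tensor u v)} λ φ → begin
          ⟨ (monomial (tensor u v) ⊕ monomial (tensor v u)) ⊕ ((- 1#) ⊙ monomial (tensor v u)) , φ ⟩
            ≈⟨ trans (pair-⊕ (monomial (tensor u v) ⊕ monomial (tensor v u))
                ((- 1#) ⊙ monomial (tensor v u)) {φ})
                 (+-cong (pair-⊕ (monomial (tensor u v)) (monomial (tensor v u)) {φ})
                     (trans (pair-⊙ (- 1#) (monomial (tensor v u)) {φ}) (-1*x≈-x _))) ⟩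
          ⟨ monomial (tensor u v) , φ ⟩ + ⟨ monomial (tensor v u) , φ ⟩ - ⟨ monomial (tensor v u) , φ ⟩
            ≈⟨ solve 2 (λ a b → a :+ b :- b := a) refl ⟨ monomial (tensor u v) , φ ⟩
                ⟨ monomial (tensor v u) , φ ⟩ ⟩
          ⟨ monomial (tensor u v) , φ ⟩ ∎)
        (add (anticommutator u v) (ideal-⊙ Relator (- 1#) (nonedge-< v<u (u≁v ∘ ~-sym))))

      symmetric-ideal : ∀ {T : Fin n → Fin n → Carrier} u v → T u v ≈ T v u →
                        I (T u v ⊙ monomial (tensor u v) ⊕ T v u ⊙ monomial (tensor v u))
      symmetric-ideal {T} u v eq = resp (≃⇒≋ {T u v ⊙ (monomial (tensor u v) ⊕ monomial (tensor v u))}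
          {T u v ⊙ monomial (tensor u v) ⊕ T v u ⊙ monomial (tensor v u)} λ φ → begin
          ⟨ T u v ⊙ (monomial (tensor u v) ⊕ monomial (tensor v u)) , φ ⟩
            ≈⟨ trans (pair-⊙ (T u v) (monomial (tensor u v) ⊕ monomial (tensor v u)) {φ})
                (trans (*-congˡ (pair-⊕ (monomial (tensor u v)) (monomial (tensor v u)) {φ}))
                (distribˡ _ _ _)) ⟩
          T u v * ⟨ monomial (tensor u v) , φ ⟩ + T u v * ⟨ monomial (tensor v u) , φ ⟩
              ≈⟨ +-congˡ (*-congʳ eq) ⟩
          T u v * ⟨ monomial (tensor u v) , φ ⟩ + T v u * ⟨ monomial (tensor v u) , φ ⟩
            ≈⟨ trans (pair-⊕ (T u v ⊙ monomial (tensor u v)) (T v u ⊙ monomial (tensor v u)) {φ})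
                (+-cong (pair-⊙ (T u v) (monomial (tensor u v)) {φ})
                (pair-⊙ (T v u) (monomial (tensor v u)) {φ})) ⟨
          ⟨ T u v ⊙ monomial (tensor u v) ⊕ T v u ⊙ monomial (tensor v u) , φ ⟩ ∎)
        (ideal-⊙ Relator (T u v) (anticommutator u v))

    -- Products over nonedges lie in the ideal anyway, and on an edge a symmetric pair of
    -- coefficients gives a multiple of an anticommutator. Only the differences T u v - T v u on
    -- edges are left to control.
    quad-relations : ∀ {p T} → Quad p T → (∀ {u v} → u ~ v → T u v ≈ T v u) → I p
    quad-relations {p} {T} P sym-T = quad-ideal Relator {p} {T} P relation
      where
      relation : ∀ u v → I (T u v ⊙ monomial (tensor u v) ⊕ T v u ⊙ monomial (tensor v u))
      relation u v with u ~? v | Fin.<-cmp u v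
      ... | yes u~v | _ = symmetric-ideal {T} u v (sym-T u~v)
      ... | no _ | tri≈ _ ≡.refl _ = symmetric-ideal {T} u u refl
      ... | no u≁v | tri< u<v _ _ = add (ideal-⊙ Relator (T u v) (nonedge-< u<v u≁v))
          (ideal-⊙ Relator (T v u) (nonedge-> u<v (u≁v ∘ ~-sym)))
      ... | no u≁v | tri> _ _ v<u = add (ideal-⊙ Relator (T u v) (nonedge-> v<u u≁v))
          (ideal-⊙ Relator (T v u) (nonedge-< v<u (u≁v ∘ ~-sym)))

    private
      S₀ : Subset n
      S₀ = ⁅ x ⁆ ∪ ⁅ y ⁆

      x<y : x <ᶠ y
      x<y = ≡.subst₂ ℕ._<_ (≡.sym toℕ-x) (≡.sym toℕ-y) (ℕ.n<1+n d)

      κ<x : ∀ i → κ i <ᶠ x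
      κ<x i = ≡.subst₂ ℕ._<_ (≡.sym (toℕ-κ i)) (≡.sym toℕ-x) (Fin.toℕ<n i)

      Earlier : Pred Alg _
      Earlier p = ∃ λ S′ → ∣ S′ ∣ ≡ ∣ S₀ ∣ × S′ <ₛ S₀ × p ≡ wedge f S′

      -- Here p is the least element of the symmetric difference, since q, x and y are all larger.
      earlier : ∀ {p q} → p <ᶠ q → p <ᶠ x → Earlier (wedge f (⁅ p ⁆ ∪ ⁅ q ⁆))
      earlier {p} {q} p<q p<x = ⁅ p ⁆ ∪ ⁅ q ⁆ , ≡.trans (∣pair∣ p<q) (≡.sym (∣pair∣ x<y)) ,
        (p , ∈-pairˡ p q , (λ p∈ → [ Fin.<⇒≢ p<x , Fin.<⇒≢ (ℕ.<-trans p<x x<y) ]′ (∈-pair⁻ x y p∈)) ,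
         λ l l<p → mk⇔
           (λ l∈ → contradiction (∈-pair⁻ p q l∈) [ Fin.<⇒≢ l<p , Fin.<⇒≢ (ℕ.<-trans l<p p<q) ]′)
           (λ l∈ → contradiction (∈-pair⁻ x y l∈) [ Fin.<⇒≢ (ℕ.<-trans l<p p<x) , Fin.<⇒≢
               (ℕ.<-trans l<p (ℕ.<-trans p<x x<y)) ]′)) ,
        ≡.refl

      record Term (i : Fin d) (j : Fin n) (a : Carrier) : Set (c ⊔ ℓ₁) where
        field
          element  : Alg
          spanned  : Span Earlier element
          matrix   : Fin n → Fin n → Carrier
          is-quad  : Quad element matrix
          alternating : ∀ u v → matrix u v - matrix v u ≈ a * (A (κ i) u * A j v) - a * (A (κ i) v * A j u)

      -- a ⊙ f_{κ i} ∧ f_j, written with the increasing pair and the corresponding sign.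
      term : ∀ i j a → Term i j a
      term i j a with Fin.<-cmp (κ i) j
      ... | tri≈ _ ≡.refl _ = record
        { element = 𝟘 ; spanned = zero ; matrix = λ _ _ → 0# ; is-quad = quad-0
        ; alternating = λ u v → solve 3 (λ a p q → con (+ 0) :- con (+ 0) := a :* (p :* q) :- a :* (q :* p)) refl a (A j u) (A j v) }
      ... | tri< κ<j _ _ = record
        { element = a ⊙ wedge f (⁅ κ i ⁆ ∪ ⁅ j ⁆) ⊕ 𝟘
        ; spanned = step a (earlier κ<j (κ<x i)) zero
        ; matrix  = λ u v → a * (A (κ i) u * A j v) + 0#
        ; is-quad = quad-⊕ {a ⊙ wedge f (⁅ κ i ⁆ ∪ ⁅ j ⁆)} {𝟘} {λ u v → a * (A (κ i) u * A j v)} {λ _ _ → 0#}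
                      (quad-⊙ {wedge f (⁅ κ i ⁆ ∪ ⁅ j ⁆)} a (quad-wedge κ<j)) quad-0
        ; alternating = λ u v → +-cong (+-identityʳ _) (-‿cong (+-identityʳ _)) }
      ... | tri> _ _ j<κ = record
        { element = (- a) ⊙ wedge f (⁅ j ⁆ ∪ ⁅ κ i ⁆) ⊕ 𝟘
        ; spanned = step (- a) (earlier j<κ (ℕ.<-trans j<κ (κ<x i))) zero
        ; matrix  = λ u v → - a * (A j u * A (κ i) v) + 0#
        ; is-quad = quad-⊕ {(- a) ⊙ wedge f (⁅ j ⁆ ∪ ⁅ κ i ⁆)} {𝟘} {λ u v → - a * (A j u * A (κ i) v)} {λ _ _ → 0#}
                      (quad-⊙ {wedge f (⁅ j ⁆ ∪ ⁅ κ i ⁆)} (- a) (quad-wedge j<κ)) quad-0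
        ; alternating = λ u v → solve 5 (λ a p q r s → (:- a :* (p :* q) :+ con (+ 0)) :- (:- a :* (r :* s) :+ con (+ 0)) := a :* (s :* r) :- a :* (q :* p))
                          refl a (A j u) (A (κ i) v) (A j v) (A (κ i) u) }

    κ-injective : ∀ {i j} → κ i ≡ κ j → i ≡ j
    κ-injective {i} {j} eq = Fin.toℕ-injective (≡.trans (≡.sym (toℕ-κ i)) (≡.trans (≡.cong toℕ eq) (toℕ-κ j)))

    private
      sum-- : ∀ {l} (g h : Fin l → Carrier) → sum (λ i → g i - h i) ≈ sum g - sum h
      sum-- g h = trans (sum-+ g (λ i → - h i)) (+-congˡ (sum-neg h))

      module Combination (a : Fin d → Fin n → Carrier) (t : ∀ i j → Term i j (a i j)) where

        Q : Alg
        Q = ⨁ λ i → ⨁ λ j → Term.element (t i j)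

        M : Fin n → Fin n → Carrier
        M u v = sum λ i → sum λ j → Term.matrix (t i j) u v

        spanned : Span Earlier Q
        spanned = span-⨁ {g = λ i → ⨁ λ j → Term.element (t i j)} λ i →
          span-⨁ {g = λ j → Term.element (t i j)} λ j → Term.spanned (t i j)

        is-quad : Quad Q M
        is-quad = quad-⨁ {f = λ i → ⨁ λ j → Term.element (t i j)} {λ i u v → sum λ j → Term.matrix (t i j) u v}
          λ i → quad-⨁ {f = λ j → Term.element (t i j)} {λ j → Term.matrix (t i j)} λ j → Term.is-quad (t i j)

        alternating : ∀ u v → M u v - M v u ≈
          sum λ i → sum (λ j → a i j * (A (κ i) u * A j v)) - sum (λ j → a i j * (A (κ i) v * A j u))
        alternating u v = begin
          M u v - M v u
            ≈⟨ sum-- (λ i → sum λ j → Term.matrix (t i j) u v) (λ i → sum λ j → Term.matrix (t i j) v u) ⟨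
          sum (λ i → sum (λ j → Term.matrix (t i j) u v) - sum (λ j → Term.matrix (t i j) v u))
            ≈⟨ sum-cong {d} (λ i → begin
                 sum (λ j → Term.matrix (t i j) u v) - sum (λ j → Term.matrix (t i j) v u)
                   ≈⟨ sum-- (λ j → Term.matrix (t i j) u v) (λ j → Term.matrix (t i j) v u) ⟨
                 sum (λ j → Term.matrix (t i j) u v - Term.matrix (t i j) v u)
                   ≈⟨ sum-cong {n} (λ j → Term.alternating (t i j) u v) ⟩
                 sum (λ j → a i j * (A (κ i) u * A j v) - a i j * (A (κ i) v * A j u))
                   ≈⟨ sum-- (λ j → a i j * (A (κ i) u * A j v)) (λ j → a i j * (A (κ i) v * A j u)) ⟩
                 sum (λ j → a i j * (A (κ i) u * A j v)) - sum (λ j → a i j * (A (κ i) v * A j u)) ∎) ⟩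
          sum (λ i → sum (λ j → a i j * (A (κ i) u * A j v)) - sum (λ j → a i j * (A (κ i) v * A j u))) ∎

      target : Fin n → Fin n → Carrier
      target u v = A x u * A y v - A x v * A y u

      target-symmetry : Symmetry (- 1#) target
      target-symmetry u v = trans
        (solve 4 (λ p q r s → r :* q :- p :* s := :- (p :* s :- r :* q)) refl (A x u) (A y u) (A x v)
            (A y v)) (sym (-1*x≈-x _))

    -- Component i of w is the vector with coordinates `a i` in the basis f, so Q is the sum of the
    -- products of f (κ i) with these vectors. The edge equations say that its alternating
    -- coefficients agree with those of the wedge of f x and f y on every edge.
    in-span : (w : Array n d) →
              (∀ u v → u ~ v → row (λ x y i → A (κ i) x) (λ x y i → A (κ i) y) u v w ≈ target u v) →
              (a : Fin d → Fin n → Carrier) → (∀ i v → sum (λ j → a i j * A j v) ≈ w v i) →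
              InSpanMod I Earlier (wedge f S₀)
    in-span w row-w a a-w = Q , spanned ,
      quad-relations {wedge f S₀ ⊖ Q} {λ u v → A x u * A y v - M u v}
        (quad-⊖ {wedge f S₀} {Q} {λ u v → A x u * A y v} {M} (quad-wedge x<y) is-quad) symmetric′
      where
      open Combination a (λ i j → term i j (a i j))
      inner : ∀ i u v → sum (λ j → a i j * (A (κ i) u * A j v)) ≈ A (κ i) u * w v i
      inner i u v = begin
        sum (λ j → a i j * (A (κ i) u * A j v)) ≈⟨ sum-cong {n}
            (λ j → solve 3 (λ a p q → a :* (p :* q) := p :* (a :* q)) refl (a i j) (A (κ i) u) (A j v)) ⟩
        sum (λ j → A (κ i) u * (a i j * A j v))    ≈⟨ sum-*ˡ (A (κ i) u) (λ j → a i j * A j v) ⟩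
        A (κ i) u * sum (λ j → a i j * A j v)      ≈⟨ *-congˡ (a-w i v) ⟩
        A (κ i) u * w v i                          ∎
      alternating-M : ∀ {u v} → u ~ v → M u v - M v u ≈ target u v
      alternating-M {u} {v} u~v = begin
        M u v - M v u                                        ≈⟨ alternating u v ⟩
        _ ≈⟨ sum-cong {d} (λ i → +-cong (inner i u v) (-‿cong (inner i v u))) ⟩
        sum (λ i → A (κ i) u * w v i - A (κ i) v * w u i)
            ≈⟨ sum-- (λ i → A (κ i) u * w v i) (λ i → A (κ i) v * w u i) ⟩
        row (λ x y i → A (κ i) x) (λ x y i → A (κ i) y) u v w  ≈⟨ row-w u v u~v ⟩
        target u v ∎
      symmetric′ : ∀ {u v} → u ~ v → A x u * A y v - M u v ≈ A x v * A y u - M v u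
      symmetric′ {u} {v} u~v = begin
        A x u * A y v - M u v
          ≈⟨ solve 4 (λ p q m m′ → p :- m := (q :- m′) :+ ((p :- q) :- (m :- m′))) refl (A x u * A y v)
              (A x v * A y u) (M u v) (M v u) ⟩
        (A x v * A y u - M v u) + (target u v - (M u v - M v u))
          ≈⟨ +-congˡ (trans (+-congˡ (-‿cong (alternating-M u~v))) (-‿inverseʳ _)) ⟩
        (A x v * A y u - M v u) + 0#    ≈⟨ +-identityʳ _ ⟩
        A x v * A y u - M v u ∎

    not-shifted : Reducible d G → ¬ shifted S₀
    not-shifted R ¬span = (Generically.exterior-system {A = A} generic κ κ-injective R >>= λ system →
      generic-spans {A = A} generic >>= λ spans →
      let w , row-w = system target target-symmetry in
      pure (in-span w row-w (λ i → proj₁ (spans λ v → w v i)) (λ i → proj₂ (spans λ v → w v i)))) ¬span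

  -- Symmetric shifting

  +ᵉ-identityˡ : ∀ {n} (a : Exponent n) → 0ᵉ +ᵉ a ≡ a
  +ᵉ-identityˡ = Vec.zipWith-identityˡ ℕ.+-identityˡ

  +ᵉ-identityʳ : ∀ {n} (a : Exponent n) → a +ᵉ 0ᵉ ≡ a
  +ᵉ-identityʳ = Vec.zipWith-identityʳ ℕ.+-identityʳ

  +ᵉ-comm : ∀ {n} (a b : Exponent n) → a +ᵉ b ≡ b +ᵉ a
  +ᵉ-comm = Vec.zipWith-comm ℕ.+-comm

  +ᵉ-assoc : ∀ {n} (a b d : Exponent n) → (a +ᵉ b) +ᵉ d ≡ a +ᵉ (b +ᵉ d)
  +ᵉ-assoc = Vec.zipWith-assoc ℕ.+-assoc

  degree-+ : ∀ {n} (a b : Exponent n) → degree (a +ᵉ b) ≡ degree a ℕ.+ degree b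
  degree-+ []      []      = ≡.refl
  degree-+ (x ∷ a) (y ∷ b) = ≡.trans (≡.cong (x ℕ.+ y ℕ.+_) (degree-+ a b))
    (CommutativeSemigroupProperties.interchange ℕ.+-commutativeSemigroup x y (degree a) (degree b))

  degree-0 : ∀ n → degree (0ᵉ {n}) ≡ 0
  degree-0 zero    = ≡.refl
  degree-0 (suc n) = degree-0 n

  degree-var : ∀ {n} (j : Fin n) → degree (var j) ≡ 1
  degree-var {suc n} zero = ≡.cong suc (degree-0 n)
  degree-var (suc j)      = degree-var j

  lookup-+ : ∀ {n} (a b : Exponent n) j → lookup (a +ᵉ b) j ≡ lookup a j ℕ.+ lookup b j
  lookup-+ a b j = Vec.lookup-zipWith ℕ._+_ j a b

  var-on : ∀ {n} (j : Fin n) → lookup (var j) j ≡ 1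
  var-on j = Vec.lookup∘update j 0ᵉ 1

  var-off : ∀ {n} {i j : Fin n} → i ≢ j → lookup (var j) i ≡ 0
  var-off {i = i} i≢j = ≡.trans (Vec.lookup∘update′ i≢j 0ᵉ 1) (Vec.lookup-replicate i 0)

  face-size : ∀ {n} (G : Graph n) {S} → GraphFace G S → ∣ S ∣ ℕ.≤ 2
  face-size {n} G empty      = ≡.subst (ℕ._≤ 2) (≡.sym (∣⊥∣≡0 n)) z≤n
  face-size G (vertex u)     = ≡.subst (ℕ._≤ 2) (≡.sym (∣⁅x⁆∣≡1 u)) (s≤s z≤n)
  face-size G (edge u v u~v) with Fin.<-cmp u v
  ... | tri< u<v _ _ = ℕ.≤-reflexive (∣pair∣ u<v)
  ... | tri≈ _ u≡v _ = contradiction u~v (Graph.~-irrefl G u≡v)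
  ... | tri> _ _ v<u = ℕ.≤-reflexive (≡.trans (≡.cong ∣_∣ (∪-comm ⁅ u ⁆ ⁅ v ⁆)) (∣pair∣ v<u))

  module Symmetric {n : ℕ} {A : Point n} (generic : Generic k char0 A)
    {d} (κ : Fin d → Fin n) (toℕ-κ : ∀ i → toℕ (κ i) ≡ toℕ i)
    {o η : Fin n} (toℕ-o : toℕ o ≡ d) (toℕ-η : toℕ η ≡ suc d) (G : Graph n) where

    open Graph G
    open SymmetricShifting k A (graphComplex G)
    open Quadratic {Exponent n} (Vec.≡-dec ℕ._≟_) _+ᵉ_ 0ᵉ +ᵉ-identityˡ {n} (λ u v → var u +ᵉ var v)
      using (⟨_,_⟩; _≃_; ≃⇒≋; Quad; quad-⊕; quad-⊙; quad-0; quad-⊖; quad-⨁; ⨁; quad-ideal; ideal-⊙; span-⨁;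
             pair-⊛; pair-linear; pair-⊕; pair-⊙; pair-monomial; pair-cong; Ideal; Span; evalAt; Alg; _⊕_; _⊖_; _⊛_; _⊙_; 𝟘; 𝟙; monomial;
             generator; zero; add; resp; step; InSpanMod; prod; pow)

    private
      mon : Fin n → Fin n → Exponent n
      mon u v = var u +ᵉ var v

      pair-swap : ∀ p q (φ : Exponent n → Exponent n → Carrier) →
                  ⟨ p , (λ b → ⟨ q , φ b ⟩) ⟩ ≈ ⟨ q , (λ b′ → ⟨ p , (λ b → φ b b′) ⟩) ⟩
      pair-swap []            q φ = sym (vanishing q)
        where
        vanishing : ∀ q → ⟨ q , (λ _ → 0#) ⟩ ≈ 0#
        vanishing []            = refl
        vanishing ((x , b) ∷ q) = trans (+-cong (zeroʳ x) (vanishing q)) (+-identityˡ 0#)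
      pair-swap ((x , b) ∷ p) q φ = trans (+-congˡ (pair-swap p q φ)) (sym (split q))
        where
        ψ : Exponent n → Carrier
        ψ b′ = ⟨ p , (λ b → φ b b′) ⟩
        split : ∀ q → ⟨ q , (λ b′ → x * φ b b′ + ψ b′) ⟩ ≈ x * ⟨ q , φ b ⟩ + ⟨ q , ψ ⟩
        split []             = sym (trans (+-congʳ (zeroʳ x)) (+-identityˡ 0#))
        split ((z , b′) ∷ q) = trans (+-congˡ (split q))
          (solve 6 (λ z x f g s t → z :* (x :* f :+ g) :+ (x :* s :+ t) := x :* (z :* f :+ s) :+ (z :* g :+ t))
            refl z x (φ b b′) (ψ b′) ⟨ q , φ b ⟩ ⟨ q , ψ ⟩)

    ⊛-cong : ∀ {p p′ q q′} → p ≃ p′ → q ≃ q′ → p ⊛ q ≃ p′ ⊛ q′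
    ⊛-cong {p} {p′} {q} {q′} p≃ q≃ φ = begin
      ⟨ p ⊛ q , φ ⟩                                   ≈⟨ pair-⊛ p q {φ} ⟩
      ⟨ p , (λ b → ⟨ q , (λ b′ → φ (b +ᵉ b′)) ⟩) ⟩      ≈⟨ p≃ _ ⟩
      ⟨ p′ , (λ b → ⟨ q , (λ b′ → φ (b +ᵉ b′)) ⟩) ⟩     ≈⟨ pair-cong p′ (λ b → q≃ _) ⟩
      ⟨ p′ , (λ b → ⟨ q′ , (λ b′ → φ (b +ᵉ b′)) ⟩) ⟩    ≈⟨ pair-⊛ p′ q′ {φ} ⟨
      ⟨ p′ ⊛ q′ , φ ⟩                                 ∎

    ⊛-comm : ∀ p q → p ⊛ q ≃ q ⊛ p
    ⊛-comm p q φ = begin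
      ⟨ p ⊛ q , φ ⟩                                   ≈⟨ pair-⊛ p q {φ} ⟩
      ⟨ p , (λ b → ⟨ q , (λ b′ → φ (b +ᵉ b′)) ⟩) ⟩      ≈⟨ pair-swap p q (λ b b′ → φ (b +ᵉ b′)) ⟩
      ⟨ q , (λ b′ → ⟨ p , (λ b → φ (b +ᵉ b′)) ⟩) ⟩
          ≈⟨ pair-cong q (λ b′ → pair-cong p λ b → reflexive (≡.cong φ (+ᵉ-comm b b′))) ⟩
      ⟨ q , (λ b′ → ⟨ p , (λ b → φ (b′ +ᵉ b)) ⟩) ⟩      ≈⟨ pair-⊛ q p {φ} ⟨
      ⟨ q ⊛ p , φ ⟩                                   ∎

    ⊛-assoc : ∀ p q r → (p ⊛ q) ⊛ r ≃ p ⊛ (q ⊛ r)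
    ⊛-assoc p q r φ = begin
      ⟨ (p ⊛ q) ⊛ r , φ ⟩                                                       ≈⟨ pair-⊛ (p ⊛ q) r {φ} ⟩
      ⟨ p ⊛ q , (λ b → ⟨ r , (λ z → φ (b +ᵉ z)) ⟩) ⟩                              ≈⟨ pair-⊛ p q ⟩
      ⟨ p , (λ a → ⟨ q , (λ b → ⟨ r , (λ z → φ ((a +ᵉ b) +ᵉ z)) ⟩) ⟩) ⟩
        ≈⟨ pair-cong p (λ a → pair-cong q λ b → pair-cong r λ z → reflexive (≡.cong φ (+ᵉ-assoc a b z))) ⟩
      ⟨ p , (λ a → ⟨ q , (λ b → ⟨ r , (λ z → φ (a +ᵉ (b +ᵉ z))) ⟩) ⟩) ⟩
          ≈⟨ pair-cong p (λ a → sym (pair-⊛ q r)) ⟩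
      ⟨ p , (λ a → ⟨ q ⊛ r , (λ b → φ (a +ᵉ b)) ⟩) ⟩                              ≈⟨ pair-⊛ p (q ⊛ r) {φ} ⟨
      ⟨ p ⊛ (q ⊛ r) , φ ⟩                                                       ∎

    ⊛-identityˡ : ∀ p → 𝟙 ⊛ p ≃ p
    ⊛-identityˡ p φ = trans (pair-⊛ 𝟙 p {φ}) (trans (pair-monomial 0ᵉ {λ b → ⟨ p , (λ b′ → φ (b +ᵉ b′)) ⟩})
      (pair-cong p λ b → reflexive (≡.cong φ (+ᵉ-identityˡ b))))

    ≃-sym : ∀ {p q} → p ≃ q → q ≃ p
    ≃-sym eq φ = sym (eq φ)

    ≃-trans : ∀ {p q r} → p ≃ q → q ≃ r → p ≃ r
    ≃-trans eq eq′ φ = trans (eq φ) (eq′ φ)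

    -- Packaged so that the interchange law of commutative semigroups is available for `powers-+`.
    ⊛-monoid : CommutativeMonoid _ _
    ⊛-monoid = record
      { Carrier = Alg ; _≈_ = _≃_ ; _∙_ = _⊛_ ; ε = 𝟙
      ; isCommutativeMonoid = record
        { isMonoid = record
          { isSemigroup = record
            { isMagma = record
              { isEquivalence = record
                { refl  = λ φ → refl
                ; sym   = λ {p} {q} → ≃-sym {p} {q}
                ; trans = λ {p} {q} {r} → ≃-trans {p} {q} {r} }
              ; ∙-cong = λ {p} {p′} {q} {q′} → ⊛-cong {p} {p′} {q} {q′} }
            ; assoc = ⊛-assoc }
          ; identity = ⊛-identityˡ , λ p → ≃-trans {p ⊛ 𝟙} {𝟙 ⊛ p} {p} (⊛-comm p 𝟙) (⊛-identityˡ p) }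
        ; comm = ⊛-comm } }

    private
      module Mon = CommutativeMonoid ⊛-monoid
      open CommutativeSemigroupProperties Mon.commutativeSemigroup using (interchange)

      powers : ∀ {l} → (Fin l → Alg) → Exponent l → Alg
      powers g a = prod (tabulate λ i → pow (g i) (lookup a i))

      pow-+ : ∀ p a b → pow p (a ℕ.+ b) ≃ pow p a ⊛ pow p b
      pow-+ p zero    b = Mon.sym {𝟙 ⊛ pow p b} {pow p b} (⊛-identityˡ (pow p b))
      pow-+ p (suc a) b = Mon.trans {p ⊛ pow p (a ℕ.+ b)} {p ⊛ (pow p a ⊛ pow p b)} {(p ⊛ pow p a) ⊛ pow p b}
        (Mon.∙-cong {p} {p} {pow p (a ℕ.+ b)} {pow p a ⊛ pow p b} (λ _ → refl) (pow-+ p a b))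
        (Mon.sym {(p ⊛ pow p a) ⊛ pow p b} {p ⊛ (pow p a ⊛ pow p b)} (⊛-assoc p (pow p a) (pow p b)))

      powers-+ : ∀ {l} (g : Fin l → Alg) a b → powers g (a +ᵉ b) ≃ powers g a ⊛ powers g b
      powers-+ {zero}  g [] [] = Mon.sym {𝟙 ⊛ 𝟙} {𝟙} (⊛-identityˡ 𝟙)
      powers-+ {suc l} g (x ∷ a) (z ∷ b) =
        Mon.trans {pow (g zero) (x ℕ.+ z) ⊛ powers (g ∘ suc) (a +ᵉ b)}
                  {(pow (g zero) x ⊛ pow (g zero) z) ⊛ (powers (g ∘ suc) a ⊛ powers (g ∘ suc) b)}
                  {(pow (g zero) x ⊛ powers (g ∘ suc) a) ⊛ (pow (g zero) z ⊛ powers (g ∘ suc) b)}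
          (Mon.∙-cong {pow (g zero) (x ℕ.+ z)} {pow (g zero) x ⊛ pow (g zero) z} {powers (g ∘ suc) (a +ᵉ b)}
              {powers (g ∘ suc) a ⊛ powers (g ∘ suc) b}
            (pow-+ (g zero) x z) (powers-+ (g ∘ suc) a b))
          (interchange (pow (g zero) x) (pow (g zero) z) (powers (g ∘ suc) a) (powers (g ∘ suc) b))

      powers-0 : ∀ {l} (g : Fin l → Alg) → powers g 0ᵉ ≃ 𝟙
      powers-0 {zero}  g = λ _ → refl
      powers-0 {suc l} g = Mon.trans {𝟙 ⊛ powers (g ∘ suc) 0ᵉ} {powers (g ∘ suc) 0ᵉ} {𝟙}
        (⊛-identityˡ (powers (g ∘ suc) 0ᵉ)) (powers-0 (g ∘ suc))

      powers-var : ∀ {l} (g : Fin l → Alg) j → powers g (var j) ≃ g j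
      powers-var g zero = Mon.trans {(g zero ⊛ 𝟙) ⊛ powers (g ∘ suc) 0ᵉ} {g zero ⊛ 𝟙} {g zero}
        (Mon.trans {(g zero ⊛ 𝟙) ⊛ powers (g ∘ suc) 0ᵉ} {(g zero ⊛ 𝟙) ⊛ 𝟙} {g zero ⊛ 𝟙}
          (Mon.∙-cong {g zero ⊛ 𝟙} {g zero ⊛ 𝟙} {powers (g ∘ suc) 0ᵉ} {𝟙} (λ _ → refl) (powers-0 (g ∘ suc)))
          (Mon.identityʳ (g zero ⊛ 𝟙)))
        (Mon.identityʳ (g zero))
      powers-var g (suc j) = Mon.trans {𝟙 ⊛ powers (g ∘ suc) (var j)} {powers (g ∘ suc) (var j)} {g (suc j)}
        (⊛-identityˡ (powers (g ∘ suc) (var j))) (powers-var (g ∘ suc) j)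

    quad-monomial : ∀ i j → Quad (y^ mon i j) (λ u v → A i u * A j v)
    quad-monomial i j φ = begin
      ⟨ y^ mon i j , φ ⟩              ≈⟨ powers-+ y (var i) (var j) φ ⟩
      ⟨ powers y (var i) ⊛ powers y (var j) , φ ⟩
        ≈⟨ ⊛-cong {powers y (var i)} {y i} {powers y (var j)} {y j} (powers-var y i) (powers-var y j) φ ⟩
      ⟨ y i ⊛ y j , φ ⟩             ≈⟨ pair-⊛ (y i) (y j) {φ} ⟩
      ⟨ y i , (λ b → ⟨ y j , (λ b′ → φ (b +ᵉ b′)) ⟩) ⟩      ≈⟨ pair-linear var (A i) ⟩
      sum (λ u → A i u * ⟨ y j , (λ b′ → φ (var u +ᵉ b′)) ⟩)
        ≈⟨ sum-cong {n} (λ u → trans (*-congˡ (pair-linear var (A j)))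
            (trans (sym (sum-*ˡ (A i u) (λ v → A j v * φ (mon u v))))
            (sum-cong {n} λ v → sym (*-assoc _ _ _)))) ⟩
      evalAt (λ u v → A i u * A j v) φ ∎

    private
      support-∈ : ∀ (a : Exponent n) u → lookup a u ≢ 0 → u ∈ support a
      support-∈ a u a≢0 = Vec.lookup⇒[]= u (support a)
          (≡.trans (Vec.lookup-map u positive a) (positive-≢ (lookup a u) a≢0))
        where
        positive-≢ : ∀ z → z ≢ 0 → positive z ≡ inside
        positive-≢ zero    z≢0 = contradiction ≡.refl z≢0
        positive-≢ (suc _) _   = ≡.refl

      ∈-left : ∀ u v → u ∈ support (mon u v)
      ∈-left u v = support-∈ (mon u v) u λ eq → ℕ.1+n≢0
          (≡.trans (≡.sym (≡.trans (lookup-+ (var u) (var v) u)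
          (≡.cong (ℕ._+ lookup (var v) u) (var-on u)))) eq)

      ∈-right : ∀ u v → v ∈ support (mon u v)
      ∈-right u v = ≡.subst (λ a → v ∈ support a) (+ᵉ-comm (var v) (var u)) (∈-left v u)

      I : Alg → Set _
      I = Ideal Relator

      nonedge : ∀ {u v} → u ≢ v → ¬ u ~ v → I (monomial (mon u v))
      nonedge {u} {v} u≢v u≁v = generator (nonface (mon u v) λ face →
        u≁v (face-adjacent G face (∈-left u v) (∈-right u v) u≢v))

      antisymmetric-ideal : ∀ {T : Fin n → Fin n → Carrier} u v → T u v + T v u ≈ 0# →
                            I (T u v ⊙ monomial (mon u v) ⊕ T v u ⊙ monomial (mon v u))
      antisymmetric-ideal {T} u v eq = resp (≃⇒≋ {𝟘}
          {T u v ⊙ monomial (mon u v) ⊕ T v u ⊙ monomial (mon v u)} λ φ → sym (begin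
          ⟨ T u v ⊙ monomial (mon u v) ⊕ T v u ⊙ monomial (mon v u) , φ ⟩
            ≈⟨ trans (pair-⊕ (T u v ⊙ monomial (mon u v)) (T v u ⊙ monomial (mon v u)) {φ})
                (+-cong (trans (pair-⊙ (T u v) (monomial (mon u v)) {φ})
                (*-congˡ (pair-monomial (mon u v) {φ})))
                (trans (pair-⊙ (T v u) (monomial (mon v u)) {φ})
                (*-congˡ (trans (pair-monomial (mon v u) {φ})
                (reflexive (≡.cong φ (+ᵉ-comm (var v) (var u)))))))) ⟩
          T u v * φ (mon u v) + T v u * φ (mon u v)   ≈⟨ distribʳ _ _ _ ⟨
          (T u v + T v u) * φ (mon u v)             ≈⟨ trans (*-congʳ eq) (zeroˡ _) ⟩
          0#                                      ∎)) zero

    -- Since the variables commute, only T u v + T v u matters; unlike in the exterior case the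
    -- diagonal counts, because squares survive in the face ring.
    quad-relations : ∀ {p T} → Quad p T → (∀ {u v} → u ≡ v ⊎ u ~ v → T u v + T v u ≈ 0#) → I p
    quad-relations {p} {T} P anti = quad-ideal Relator {p} {T} P relation
      where
      relation : ∀ u v → I (T u v ⊙ monomial (mon u v) ⊕ T v u ⊙ monomial (mon v u))
      relation u v with u Fin.≟ v | u ~? v
      ... | yes u≡v | _       = antisymmetric-ideal {T} u v (anti (inj₁ u≡v))
      ... | no _    | yes u~v = antisymmetric-ideal {T} u v (anti (inj₂ u~v))
      ... | no u≢v  | no u≁v  = add (ideal-⊙ Relator (T u v) (nonedge u≢v u≁v))
        (ideal-⊙ Relator (T v u) (nonedge (u≢v ∘ ≡.sym) (u≁v ∘ ~-sym)))

    κ-injective : ∀ {i j} → κ i ≡ κ j → i ≡ j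
    κ-injective {i} {j} eq = Fin.toℕ-injective (≡.trans (≡.sym (toℕ-κ i)) (≡.trans (≡.cong toℕ eq) (toℕ-κ j)))

    private
      o<η : o <ᶠ η
      o<η = ≡.subst₂ ℕ._<_ (≡.sym toℕ-o) (≡.sym toℕ-η) (ℕ.n<1+n d)

      κ<o : ∀ i → κ i <ᶠ o
      κ<o i = ≡.subst₂ ℕ._<_ (≡.sym (toℕ-κ i)) (≡.sym toℕ-o) (Fin.toℕ<n i)

      κ≢o : ∀ i → κ i ≢ o
      κ≢o i = Fin.<⇒≢ (κ<o i)

      κ≢η : ∀ i → κ i ≢ η
      κ≢η i = Fin.<⇒≢ (ℕ.<-trans (κ<o i) o<η)

    open SymmetricSystem {A = A} generic κ κ-injective o η κ≢o κ≢η

    private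
      κ⁺<η : ∀ i → κ⁺ i <ᶠ η
      κ⁺<η zero    = o<η
      κ⁺<η (suc i) = ℕ.<-trans (κ<o i) o<η

      Earlier : Pred Alg _
      Earlier p = ∃ λ b → degree b ≡ degree (mon η η) × b <ₘ mon η η × p ≡ y^ b

      vanish : ∀ {p q l : Fin n} → l ≢ p → l ≢ q → lookup (mon p q) l ≡ 0
      vanish {p} {q} {l} l≢p l≢q = ≡.trans (lookup-+ (var p) (var q) l)
          (≡.cong₂ ℕ._+_ (var-off l≢p) (var-off l≢q))

      degree-mon : ∀ p q → degree (mon p q) ≡ 2
      degree-mon p q = ≡.trans (degree-+ (var p) (var q)) (≡.cong₂ ℕ._+_ (degree-var p) (degree-var q))

      earlier-≤ : ∀ {p q} → p <ᶠ η → p ≤ᶠ q → mon p q <ₘ mon η η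
      earlier-≤ {p} {q} p<η p≤q = p ,
        ≡.subst₂ ℕ._<_ (≡.sym (vanish (Fin.<⇒≢ p<η) (Fin.<⇒≢ p<η)))
          (≡.sym (≡.trans (lookup-+ (var p) (var q) p) (≡.cong (ℕ._+ lookup (var q) p) (var-on p)))) (s≤s z≤n) ,
        λ l l<p → ≡.trans (vanish (Fin.<⇒≢ l<p) (Fin.<⇒≢ (ℕ.<-≤-trans l<p p≤q)))
          (≡.sym (vanish (Fin.<⇒≢ (ℕ.<-trans l<p p<η)) (Fin.<⇒≢ (ℕ.<-trans l<p p<η))))

      -- The smaller of p and q is below η; there the first monomial has a positive exponent and the
      -- square has exponent zero.
      earlier : ∀ {p} → p <ᶠ η → ∀ q → Earlier (y^ mon p q)
      earlier {p} p<η q = mon p q , ≡.trans (degree-mon p q) (≡.sym (degree-mon η η)) , before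
          (ℕ.≤-total (toℕ p) (toℕ q)) , ≡.refl
        where
        before : p ≤ᶠ q ⊎ q ≤ᶠ p → mon p q <ₘ mon η η
        before (inj₁ p≤q) = earlier-≤ p<η p≤q
        before (inj₂ q≤p) = ≡.subst (_<ₘ mon η η) (+ᵉ-comm (var q) (var p))
            (earlier-≤ (ℕ.≤-<-trans q≤p p<η) q≤p)

      module Combination (a : Fin (suc d) → Fin n → Carrier) where
        element : Fin (suc d) → Fin n → Alg
        element i j = a i j ⊙ (y^ mon (κ⁺ i) j) ⊕ 𝟘

        Q : Alg
        Q = ⨁ λ i → ⨁ λ j → element i j

        M : Fin n → Fin n → Carrier
        M u v = sum λ i → sum λ j → a i j * (A (κ⁺ i) u * A j v) + 0#

        spanned : Span Earlier Q
        spanned = span-⨁ {g = λ i → ⨁ λ j → element i j} λ i →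
          span-⨁ {g = λ j → element i j} λ j → step (a i j) (earlier (κ⁺<η i) j) zero

        is-quad : Quad Q M
        is-quad = quad-⨁ {f = λ i → ⨁ λ j → element i j} {λ i u v → sum λ j → a i j * (A (κ⁺ i) u * A j v) + 0#}
          λ i → quad-⨁ {f = λ j → element i j} {λ j u v → a i j * (A (κ⁺ i) u * A j v) + 0#} λ j →
            quad-⊕ {a i j ⊙ (y^ mon (κ⁺ i) j)} {𝟘} {λ u v → a i j * (A (κ⁺ i) u * A j v)} {λ _ _ → 0#}
              (quad-⊙ {y^ mon (κ⁺ i) j} (a i j) (quad-monomial (κ⁺ i) j)) quad-0

      -- Both orders of a pair contribute to a coefficient, so the square appears symmetrised, with
      -- a factor 2.
      target : Fin n → Fin n → Carrier
      target u v = A η u * A η v + A η v * A η u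

      target-symmetry : Symmetry 1# target
      target-symmetry u v = trans (+-comm _ _) (sym (*-identityˡ _))

    -- Every quadratic monomial with an index below η precedes the square, so d + 1 factors are
    -- available, one more than in the exterior case; the loops use up the extra unknown at each
    -- vertex.
    in-span : (w : Array n (suc d)) →
              (∀ u v → u ≡ v ⊎ u ~ v → row (λ x y i → A (κ⁺ i) x) (λ x y i → - A (κ⁺ i) y) u v w ≈ target u v) →
              (a : Fin (suc d) → Fin n → Carrier) → (∀ i v → sum (λ j → a i j * A j v) ≈ w v i) →
              InSpanMod I Earlier (y^ mon η η)
    in-span w row-w a a-w = Q , spanned ,
      quad-relations {(y^ mon η η) ⊖ Q} {λ u v → A η u * A η v - M u v}
        (quad-⊖ {y^ mon η η} {Q} {λ u v → A η u * A η v} {M} (quad-monomial η η) is-quad) anti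
      where
      open Combination a
      M-value : ∀ u v → M u v ≈ ip (λ i → A (κ⁺ i) u) (w v)
      M-value u v = sum-cong {suc d} λ i → begin
        sum (λ j → a i j * (A (κ⁺ i) u * A j v) + 0#)
            ≈⟨ sum-cong {n} (λ j → solve 3 (λ a p q → a :* (p :* q) :+ con (+ 0) := p :* (a :* q)) refl
            (a i j) (A (κ⁺ i) u) (A j v)) ⟩
        sum (λ j → A (κ⁺ i) u * (a i j * A j v))       ≈⟨ sum-*ˡ (A (κ⁺ i) u) (λ j → a i j * A j v) ⟩
        A (κ⁺ i) u * sum (λ j → a i j * A j v)         ≈⟨ *-congˡ (a-w i v) ⟩
        A (κ⁺ i) u * w v i                             ∎
      M-sum : ∀ {u v} → u ≡ v ⊎ u ~ v → M u v + M v u ≈ target u v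
      M-sum {u} {v} touching = begin
        M u v + M v u ≈⟨ +-cong (M-value u v) (M-value v u) ⟩
        ip (λ i → A (κ⁺ i) u) (w v) + ip (λ i → A (κ⁺ i) v) (w u)             ≈⟨ +-congˡ (-‿involutive _) ⟨
        ip (λ i → A (κ⁺ i) u) (w v) - - ip (λ i → A (κ⁺ i) v) (w u)
            ≈⟨ +-congˡ (-‿cong (ip-neg (λ i → A (κ⁺ i) v) (w u))) ⟨
        row (λ x y i → A (κ⁺ i) x) (λ x y i → - A (κ⁺ i) y) u v w            ≈⟨ row-w u v touching ⟩
        target u v                                                           ∎
      anti : ∀ {u v} → u ≡ v ⊎ u ~ v → (A η u * A η v - M u v) + (A η v * A η u - M v u) ≈ 0#
      anti {u} {v} touching = begin
        (A η u * A η v - M u v) + (A η v * A η u - M v u)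
          ≈⟨ solve 4 (λ p q mon m′ → (p :- mon) :+ (q :- m′) := (p :+ q) :- (mon :+ m′)) refl
              (A η u * A η v) (A η v * A η u) (M u v) (M v u) ⟩
        target u v - (M u v + M v u)   ≈⟨ +-congˡ (-‿cong (M-sum touching)) ⟩
        target u v - target u v        ≈⟨ -‿inverseʳ _ ⟩
        0#                             ∎

    ¬¬in-span : Reducible d G → ¬ ¬ InSpanMod I Earlier (y^ mon η η)
    ¬¬in-span R = cone-system G R >>= λ system →
      generic-spans {A = A} generic >>= λ spans →
      let w , row-w = system target target-symmetry in
      pure (in-span w row-w (λ i → proj₁ (spans λ v → w v i)) (λ i → proj₂ (spans λ v → w v i)))

    private
      label-< : label o ℕ.< label η
      label-< = s≤s o<η

    -- Only r = 2 gives a set with two elements, and then both indices of the monomial equal η.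
    shifted⇒square : ∀ r (i : Fin r → Fin n) → gin r i →
      (∀ z → z ∈ ⁅ o ⁆ ∪ ⁅ η ⁆ → ∃ λ t → label z ≡ (label (i t) ∸ r) ℕ.+ label t) →
      exponent i ≡ mon η η
    shifted⇒square r i (_ , _ , (S , face , r≤S) , _) indices
      with ℕ.≤-trans r≤S (face-size G face) | indices o (∈-pairˡ o η) | indices η (∈-pairʳ o η)
    shifted⇒square 1 i _ _ | _ | 0F , eq | 0F , eq′ = contradiction (≡.trans eq (≡.sym eq′)) (ℕ.<⇒≢ label-<)
    shifted⇒square 2 i _ _ | _ | 0F , eq | 0F , eq′ = contradiction (≡.trans eq (≡.sym eq′)) (ℕ.<⇒≢ label-<)
    shifted⇒square 2 i _ _ | _ | 1F , eq | 1F , eq′ = contradiction (≡.trans eq (≡.sym eq′)) (ℕ.<⇒≢ label-<)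
    -- The labels increase with t, so o cannot come from the second index and η from the first.
    shifted⇒square 2 i (2≤i , mono , _) _ | _ | 1F , eq | 0F , eq′ =
      contradiction label-< (ℕ.≤⇒≯ (≡.subst₂ ℕ._≤_ (≡.sym eq′) (≡.sym eq)
        (ℕ.+-mono-≤ (ℕ.∸-monoˡ-≤ 2 (s≤s (mono 0F 1F z≤n))) (s≤s z≤n))))
    shifted⇒square 2 i (2≤i , _) _ | _ | 0F , eq | 1F , eq′ =
      ≡.cong₂ (λ p q → var p +ᵉ q) i₀≡η (≡.trans (+ᵉ-identityʳ (var (i 1F))) (≡.cong var i₁≡η))
      where
      label-injective : ∀ {p q : Fin n} → label p ≡ label q → p ≡ q
      label-injective = Fin.toℕ-injective ∘ ℕ.suc-injective
      i₁≡η : i 1F ≡ η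
      i₁≡η = label-injective (≡.trans (≡.sym (ℕ.m∸n+n≡m (2≤i 1F))) (≡.sym eq′))
      -- The first index is lowered by one in the passage to the shifted set, so its label is that
      -- of o plus one, which is the label of η.
      i₀≡η : i 0F ≡ η
      i₀≡η = label-injective (≡.trans (≡.sym (ℕ.m∸n+n≡m (2≤i 0F))) (≡.trans (ℕ.+-suc (label (i 0F) ∸ 2) 1)
        (≡.trans (≡.cong suc (≡.sym eq)) (≡.trans (≡.cong (λ z → suc (suc z)) toℕ-o)
            (≡.cong suc (≡.sym toℕ-η))))))
    shifted⇒square (suc (suc (suc _))) i _ _ | s≤s (s≤s ()) | _ | _

    not-shifted : Reducible d G → ¬ shifted (⁅ o ⁆ ∪ ⁅ η ⁆)
    not-shifted R (r , i , g , spec) = ¬¬in-span R (≡.subst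
      (λ a → ¬ InSpanMod I (λ p → ∃ λ b → degree b ≡ degree a × b <ₘ a × p ≡ y^ b) (y^ a))
      (shifted⇒square r i g (λ z → Equivalence.to (spec z)))
      (proj₂ (proj₂ (proj₂ (proj₂ g)))))

open Combinatorics using (Model; model⇒minor; model-or-reducible; Reducible)

theorem1p4 : ∀ {c ℓ₁ ℓ₂} (k : HeytingField c ℓ₁ ℓ₂) (char0 : CharacteristicZero k)
    {n : ℕ} (A : Fin n → Fin n → HeytingField.Carrier k) → Generic k char0 A →
    (op : Shifting) →
    ∀ (r : ℕ) → 2 ≤ r → r ≤ 6 →
    (G : Graph n) (x y : Fin n) → label x ≡ r ∸ 1 → label y ≡ r →
    Δ k op A (graphComplex G) (⁅ x ⁆ ∪ ⁅ y ⁆) →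
    HasMinor G (complete r)
theorem1p4 k char0 {n} A generic op (suc (suc d)) 2≤r@(s≤s (s≤s _)) r≤6 G x y label-x label-y shifted =
  conclude (model-or-reducible 2≤r r≤6 G)
  where
  -- Labels start at 1 and positions at 0: with r = d + 2, the labels r - 1 and r are the positions
  -- d and d + 1, preceded by the d positions in the image of κ.
  toℕ-x : toℕ x ≡ d
  toℕ-x = ℕ.suc-injective label-x
  toℕ-y : toℕ y ≡ suc d
  toℕ-y = ℕ.suc-injective label-y
  d≤n : d ≤ n
  d≤n = ℕ.<⇒≤ (subst (_< n) toℕ-x (Fin.toℕ<n x))
  κ : Fin d → Fin n
  κ i = inject≤ i d≤n
  toℕ-κ : ∀ i → toℕ (κ i) ≡ toℕ i
  toℕ-κ i = Fin.toℕ-inject≤ i d≤n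
  not-shifted : ∀ op → Reducible d G → ¬ Δ k op A (graphComplex G) (⁅ x ⁆ ∪ ⁅ y ⁆)
  not-shifted exterior  = Algebra.Exterior.not-shifted k char0 generic κ toℕ-κ toℕ-x toℕ-y G
  not-shifted symmetric = Algebra.Symmetric.not-shifted k char0 generic κ toℕ-κ toℕ-x toℕ-y G
  conclude : Model (suc (suc d)) G ⊎ Reducible d G → HasMinor G (complete (suc (suc d)))
  conclude (inj₁ M) = model⇒minor 2≤r G M
  conclude (inj₂ R) = contradiction shifted (not-shifted op R)
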